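{- For every $s\in\mathbb{C}$ with $\Re(s)>1$, $$(2^s+1)\sum_{n\ge1}\frac{t_{n-1}}{n^s}+(2^s-1)\sum_{n\ge1}\frac{t_n}{n^s}=2^s\zeta(s).$$
   Context: For $n\ge 0$, let $t_n\in\{0,1\}$ denote the sum of the binary digits of $n$ reduced modulo $2$ (so $t_0=0$; this is the Thue–Morse sequence). $\zeta(s)=\sum_{n\ge1}n^{ -s}$ is the Riemann zeta function. -}

module Defs where

open import Data.Digit using (toDigits)
open import Data.Integer.Base as ℤ using (+_)
import Data.Integer.Properties as ℤ
open import Data.List.Base using (map)
open import Data.Nat.ListAction using (sum)
open import Data.Nat.Base as ℕ using (ℕ; zero; suc; _∸_; _%_; z≤n; s≤s)
import Data.Nat.Properties as ℕ
open import Data.Nat.Coprimality using (1-coprimeTo)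
open import Data.Nat.Tactic.RingSolver using (solve-∀)
open import Data.Fin.Base using (toℕ)
open import Data.Product.Base using (∃; _×_; _,_; proj₁; proj₂)
open import Data.Sum.Base using (inj₁; inj₂)
open import Data.Rational.Base
  using (ℚ; mkℚ; 0ℚ; 1ℚ; _+_; _*_; _-_; -_; ∣_∣; _≤_; _<_; *≤*; *<*; _/_; 1/_; toℚᵘ; Positive; positive; nonNegative)
import Data.Rational.Unnormalised.Base as ℚᵘ
import Data.Rational.Unnormalised.Properties as ℚᵘ
open import Data.Rational.Properties
open import Data.Rational.Solver using (module +-*-Solver)
open import Relation.Binary.PropositionalEquality
open +-*-Solver using (solve; _:+_; _:*_; :-_; _:-_; _:=_; con)

private
  variable
    x y u v w p q ε : ℚ

0≤1 : 0ℚ ≤ 1ℚ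
0≤1 = *≤* (ℤ.+≤+ z≤n)

0<1 : 0ℚ < 1ℚ
0<1 = *<* (ℤ.+<+ (s≤s z≤n))

2ℚ : ℚ
2ℚ = 1ℚ + 1ℚ

0<2 : 0ℚ < 2ℚ
0<2 = *<* (ℤ.+<+ (s≤s z≤n))

mulˡ-≤ : 0ℚ ≤ p → x ≤ y → p * x ≤ p * y
mulˡ-≤ {p} 0≤p x≤y = *-monoˡ-≤-nonNeg p {{nonNegative 0≤p}} x≤y

mulʳ-≤ : 0ℚ ≤ p → x ≤ y → x * p ≤ y * p
mulʳ-≤ {p} 0≤p x≤y = *-monoʳ-≤-nonNeg p {{nonNegative 0≤p}} x≤y

0≤* : 0ℚ ≤ p → 0ℚ ≤ q → 0ℚ ≤ p * q
0≤* {p} {q} 0≤p 0≤q = ≤-trans (≤-reflexive (sym (*-zeroʳ p))) (mulˡ-≤ 0≤p 0≤q)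

0<* : 0ℚ < p → 0ℚ < q → 0ℚ < p * q
0<* {p} {q} 0<p 0<q =
  positive⁻¹ (p * q) {{pos*pos⇒pos p {{positive 0<p}} q {{positive 0<q}}}}

0≤+ : 0ℚ ≤ p → 0ℚ ≤ q → 0ℚ ≤ p + q
0≤+ {p} {q} 0≤p 0≤q = ≤-trans (≤-reflexive (sym (+-identityˡ 0ℚ))) (+-mono-≤ 0≤p 0≤q)

x≤x+p : 0ℚ ≤ p → x ≤ x + p
x≤x+p {p} {x} 0≤p = ≤-trans (≤-reflexive (sym (+-identityʳ x))) (+-monoʳ-≤ x 0≤p)

x≤p+x : 0ℚ ≤ p → x ≤ p + x
x≤p+x {p} {x} 0≤p = ≤-trans (x≤x+p 0≤p) (≤-reflexive (+-comm x p))

mul-≤ : 0ℚ ≤ p → 0ℚ ≤ y → p ≤ q → x ≤ y → p * x ≤ q * y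
mul-≤ 0≤p 0≤y p≤q x≤y = ≤-trans (mulˡ-≤ 0≤p x≤y) (mulʳ-≤ 0≤y p≤q)

quotient : 0ℚ < p → 0ℚ < ε → ∃ λ δ → 0ℚ < δ × p * δ ≡ ε
quotient {p} {ε} 0<p 0<ε = i * ε , 0<* 0<i 0<ε , eq
  where
  instance
    pos-p : Positive p
    pos-p = positive 0<p
    nz : _
    nz = pos⇒nonZero p
  i = 1/ p
  0<i : 0ℚ < i
  0<i = positive⁻¹ i {{1/pos⇒pos p}}
  eq : p * (i * ε) ≡ ε
  eq = trans (sym (*-assoc p i ε)) (trans (cong (_* ε) (*-inverseʳ p)) (*-identityˡ ε))

tri : ∀ x y z → ∣ x - z ∣ ≤ ∣ x - y ∣ + ∣ y - z ∣
tri x y z = ≤-trans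
  (≤-reflexive (cong ∣_∣ (solve 3 (λ x y z → x :- z := (x :- y) :+ (y :- z)) refl x y z)))
  (∣p+q∣≤∣p∣+∣q∣ (x - y) (y - z))

∣-∣-sym : ∀ x y → ∣ x - y ∣ ≡ ∣ y - x ∣
∣-∣-sym x y = trans (cong ∣_∣ (solve 2 (λ x y → x :- y := :- (y :- x)) refl x y))
                    (∣-p∣≡∣p∣ (y - x))

∣∣-≤ : x ≤ q → - x ≤ q → ∣ x ∣ ≤ q
∣∣-≤ {x} a b with ∣p∣≡p∨∣p∣≡-p x
... | inj₁ e = ≤-trans (≤-reflexive e) a
... | inj₂ e = ≤-trans (≤-reflexive e) b

x≤∣x∣ : ∀ x → x ≤ ∣ x ∣
x≤∣x∣ x with ≤-total 0ℚ x
... | inj₁ 0≤x = ≤-reflexive (sym (0≤p⇒∣p∣≡p 0≤x))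
... | inj₂ x≤0 = ≤-trans x≤0 (0≤∣p∣ x)

x-y≤ : x ≤ y + q → x - y ≤ q
x-y≤ {x} {y} {q} h = ≤-trans (+-monoˡ-≤ (- y) h)
  (≤-reflexive (solve 2 (λ y q → (y :+ q) :- y := q) refl y q))

∣∣x∣-∣y∣∣≤ : ∀ x y → ∣ ∣ x ∣ - ∣ y ∣ ∣ ≤ ∣ x - y ∣
∣∣x∣-∣y∣∣≤ x y = ∣∣-≤ (one x y)
  (≤-trans (≤-reflexive (solve 2 (λ a b → :- (a :- b) := b :- a) refl (∣ x ∣) (∣ y ∣)))
    (≤-trans (one y x) (≤-reflexive (∣-∣-sym y x))))
  where
  one : ∀ x y → ∣ x ∣ - ∣ y ∣ ≤ ∣ x - y ∣
  one x y = x-y≤ (≤-trans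
    (≤-reflexive (cong ∣_∣ (solve 2 (λ x y → x := y :+ (x :- y)) refl x y)))
    (∣p+q∣≤∣p∣+∣q∣ y (x - y)))

1/suc : ℕ → ℚ
1/suc n = mkℚ (+ 1) n (1-coprimeTo (suc n))

0<1/suc : ∀ n → 0ℚ < 1/suc n
0<1/suc n = *<* (ℤ.+<+ (s≤s z≤n))

0≤1/suc : ∀ n → 0ℚ ≤ 1/suc n
0≤1/suc n = <⇒≤ (0<1/suc n)

1/suc-anti : ∀ {m n} → m ℕ.≤ n → 1/suc n ≤ 1/suc m
1/suc-anti m≤n = *≤* (ℤ.+≤+ (s≤s (ℕ.+-monoˡ-≤ 0 m≤n)))

archimedean : 0ℚ < ε → ∃ λ N → ∀ n → N ℕ.≤ n → 1/suc n ≤ ε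
archimedean {mkℚ (+ zero) d c} (*<* (ℤ.+<+ ()))
archimedean {mkℚ (+ suc a) d c} _ = d , λ n d≤n → *≤* (ℤ.+≤+
  (ℕ.≤-trans (ℕ.≤-reflexive (ℕ.*-identityˡ (suc d)))
    (ℕ.≤-trans (s≤s d≤n) (ℕ.m≤m+n (suc n) (a ℕ.* suc n)))))
archimedean {mkℚ ℤ.-[1+ a ] d c} (*<* ())

archimedean-* : 0ℚ < p → 0ℚ < ε → ∃ λ N → ∀ n → N ℕ.≤ n → 1/suc n * p ≤ ε
archimedean-* {p} 0<p 0<ε with quotient 0<p 0<ε
... | δ , 0<δ , pδ≡ε with archimedean 0<δ
... | N , h = N , λ n N≤n → ≤-trans (mulʳ-≤ (<⇒≤ 0<p) (h n N≤n))
                    (≤-reflexive (trans (*-comm δ p) pδ≡ε))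

IsCauchy : (ℕ → ℚ) → Set
IsCauchy x = ∀ ε → 0ℚ < ε →
  ∃ λ N → ∀ m n → N ℕ.≤ m → N ℕ.≤ n → ∣ x m - x n ∣ ≤ ε

record ℝ : Set where
  constructor mkℝ
  field
    seq    : ℕ → ℚ
    cauchy : IsCauchy seq

open ℝ public

infix 4 _≈ᴿ_ _<ᴿ_

_≈ᴿ_ : ℝ → ℝ → Set
x ≈ᴿ y = ∀ ε → 0ℚ < ε → ∃ λ N → ∀ n → N ℕ.≤ n → ∣ seq x n - seq y n ∣ ≤ ε

_<ᴿ_ : ℝ → ℝ → Set
x <ᴿ y = ∃ λ δ → 0ℚ < δ × ∃ λ N → ∀ n → N ℕ.≤ n → seq x n + δ ≤ seq y n

cauchy-scale : ∀ x C → 0ℚ < C →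
  (∀ ε → 0ℚ < ε → ∃ λ N → ∀ m n → N ℕ.≤ m → N ℕ.≤ n → ∣ x m - x n ∣ ≤ C * ε) →
  IsCauchy x
cauchy-scale x C 0<C h ε 0<ε with quotient 0<C 0<ε
... | δ , 0<δ , e with h δ 0<δ
... | N , g = N , λ m n a b → ≤-trans (g m n a b) (≤-reflexive e)

upper : (x : ℕ → ℚ) → ∀ N → ∃ λ B → 0ℚ < B × (∀ n → n ℕ.≤ N → ∣ x n ∣ ≤ B)
upper x zero = ∣ x 0 ∣ + 1ℚ , <-≤-trans 0<1 (x≤p+x (0≤∣p∣ (x 0))) ,
  λ { .zero z≤n → x≤x+p 0≤1 }
upper x (suc N) with upper x N
... | B , 0<B , h = B + ∣ x (suc N) ∣ , <-≤-trans 0<B (x≤x+p (0≤∣p∣ _)) , g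
  where
  g : ∀ n → n ℕ.≤ suc N → ∣ x n ∣ ≤ B + ∣ x (suc N) ∣
  g n n≤ with ℕ.m≤n⇒m<n∨m≡n n≤
  ... | inj₁ (s≤s n≤N) = ≤-trans (h n n≤N) (x≤x+p (0≤∣p∣ _))
  ... | inj₂ refl = x≤p+x (<⇒≤ 0<B)

bounded : (x : ℝ) → ∃ λ B → 0ℚ < B × (∀ n → ∣ seq x n ∣ ≤ B)
bounded (mkℝ x c) with c 1ℚ 0<1
... | N , h with upper x N
... | B , 0<B , g = B + 1ℚ , <-≤-trans 0<B (x≤x+p 0≤1) , f
  where
  f : ∀ n → ∣ x n ∣ ≤ B + 1ℚ
  f n with ℕ.≤-total n N
  ... | inj₁ n≤N = ≤-trans (g n n≤N) (x≤x+p 0≤1)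
  ... | inj₂ N≤n = ≤-trans
    (≤-reflexive (cong ∣_∣ (solve 2 (λ a b → a := b :+ (a :- b)) refl (x n) (x N))))
    (≤-trans (∣p+q∣≤∣p∣+∣q∣ (x N) (x n - x N))
             (+-mono-≤ (g N ℕ.≤-refl) (h n N N≤n ℕ.≤-refl)))

fromℚ : ℚ → ℝ
fromℚ q = mkℝ (λ _ → q) λ ε 0<ε → 0 , λ _ _ _ _ →
  ≤-trans (≤-reflexive (cong ∣_∣ (+-inverseʳ q))) (<⇒≤ 0<ε)

0ᴿ 1ᴿ : ℝ
0ᴿ = fromℚ 0ℚ
1ᴿ = fromℚ 1ℚ

infixl 6 _+ᴿ_ _-ᴿ_
infixl 7 _*ᴿ_
infix  8 -ᴿ_

_+ᴿ_ : ℝ → ℝ → ℝ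
mkℝ x cx +ᴿ mkℝ y cy = mkℝ (λ n → x n + y n) (cauchy-scale (λ n → x n + y n) 2ℚ 0<2 lem)
  where
  lem : ∀ ε → 0ℚ < ε → _
  lem ε 0<ε with cx ε 0<ε | cy ε 0<ε
  ... | M , h | N , k = M ℕ.⊔ N , λ m n a b → ≤-trans
    (≤-reflexive (cong ∣_∣ (solve 4 (λ a b c d → (a :+ b) :- (c :+ d) := (a :- c) :+ (b :- d))
                                  refl (x m) (y m) (x n) (y n))))
    (≤-trans (∣p+q∣≤∣p∣+∣q∣ (x m - x n) (y m - y n))
      (≤-trans (+-mono-≤
          (h m n (ℕ.m⊔n≤o⇒m≤o M N a) (ℕ.m⊔n≤o⇒m≤o M N b))
          (k m n (ℕ.m⊔n≤o⇒n≤o M N a) (ℕ.m⊔n≤o⇒n≤o M N b)))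
        (≤-reflexive (solve 1 (λ e → e :+ e := con 2ℚ :* e) refl ε))))

-ᴿ_ : ℝ → ℝ
-ᴿ mkℝ x cx = mkℝ (λ n → - x n) λ ε 0<ε → proj₁ (cx ε 0<ε) , λ m n a b → ≤-trans
  (≤-reflexive (trans
    (cong ∣_∣ (solve 2 (λ a b → (:- a) :- (:- b) := :- (a :- b)) refl (x m) (x n)))
    (∣-p∣≡∣p∣ (x m - x n))))
  (proj₂ (cx ε 0<ε) m n a b)

_-ᴿ_ : ℝ → ℝ → ℝ
x -ᴿ y = x +ᴿ -ᴿ y

_*ᴿ_ : ℝ → ℝ → ℝ
X@(mkℝ x cx) *ᴿ Y@(mkℝ y cy) = mkℝ (λ n → x n * y n) cxy
  where
  cxy : IsCauchy (λ n → x n * y n)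
  cxy with bounded X | bounded Y
  ... | B , 0<B , xB | D , 0<D , yD =
    cauchy-scale (λ n → x n * y n) (B + D) (<-≤-trans 0<B (x≤x+p (<⇒≤ 0<D))) lem
    where
    lem : ∀ ε → 0ℚ < ε → _
    lem ε 0<ε with cx ε 0<ε | cy ε 0<ε
    ... | M , h | N , k = M ℕ.⊔ N , λ m n a b → ≤-trans
      (≤-reflexive (cong ∣_∣ (solve 4 (λ a b c d → (a :* b) :- (c :* d) := a :* (b :- d) :+ (a :- c) :* d)
                                    refl (x m) (y m) (x n) (y n))))
      (≤-trans (∣p+q∣≤∣p∣+∣q∣ (x m * (y m - y n)) ((x m - x n) * y n))
        (≤-trans (+-mono-≤
            (≤-trans (≤-reflexive (∣p*q∣≡∣p∣*∣q∣ (x m) (y m - y n)))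
              (mul-≤ (0≤∣p∣ _) (<⇒≤ 0<ε) (xB m)
                (k m n (ℕ.m⊔n≤o⇒n≤o M N a) (ℕ.m⊔n≤o⇒n≤o M N b))))
            (≤-trans (≤-reflexive (∣p*q∣≡∣p∣*∣q∣ (x m - x n) (y n)))
              (mul-≤ (0≤∣p∣ _) (<⇒≤ 0<D)
                (h m n (ℕ.m⊔n≤o⇒m≤o M N a) (ℕ.m⊔n≤o⇒m≤o M N b)) (yD n))))
          (≤-reflexive (solve 3 (λ e b d → b :* e :+ e :* d := (b :+ d) :* e) refl ε B D))))

∣_∣ᴿ : ℝ → ℝ
∣ mkℝ x cx ∣ᴿ = mkℝ (λ n → ∣ x n ∣) λ ε 0<ε → proj₁ (cx ε 0<ε) , λ m n a b →
  ≤-trans (∣∣x∣-∣y∣∣≤ (x m) (x n)) (proj₂ (cx ε 0<ε) m n a b)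

infix 4 _⟶ᴿ_

_⟶ᴿ_ : (ℕ → ℝ) → ℝ → Set
f ⟶ᴿ a = ∀ ε → 0ℚ < ε → ∃ λ N → ∀ n → N ℕ.≤ n → ∣ f n -ᴿ a ∣ᴿ <ᴿ fromℚ ε

record ℂ : Set where
  constructor _+i_
  field
    Re Im : ℝ

open ℂ public

infix  4 _≈ᶜ_ _⟶ᶜ_
infixl 6 _+ᶜ_ _-ᶜ_
infixl 7 _*ᶜ_
infix  8 -ᶜ_

_≈ᶜ_ : ℂ → ℂ → Set
z ≈ᶜ w = Re z ≈ᴿ Re w × Im z ≈ᴿ Im w

fromℝ : ℝ → ℂ
fromℝ x = x +i 0ᴿ

fromℕ : ℕ → ℂ
fromℕ n = fromℝ (fromℚ (+ n / 1))

0ᶜ 1ᶜ : ℂ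
0ᶜ = fromℕ 0
1ᶜ = fromℕ 1

_+ᶜ_ : ℂ → ℂ → ℂ
z +ᶜ w = (Re z +ᴿ Re w) +i (Im z +ᴿ Im w)

-ᶜ_ : ℂ → ℂ
-ᶜ z = (-ᴿ Re z) +i (-ᴿ Im z)

_-ᶜ_ : ℂ → ℂ → ℂ
z -ᶜ w = z +ᶜ -ᶜ w

_*ᶜ_ : ℂ → ℂ → ℂ
z *ᶜ w = (Re z *ᴿ Re w -ᴿ Im z *ᴿ Im w) +i (Re z *ᴿ Im w +ᴿ Im z *ᴿ Re w)

_⟶ᶜ_ : (ℕ → ℂ) → ℂ → Set
f ⟶ᶜ a = ((λ n → Re (f n)) ⟶ᴿ Re a) × ((λ n → Im (f n)) ⟶ᴿ Im a)

-- Σ₁ f N = f 1 + ⋯ + f N, so f 0 never contributes.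
Σ₁ : (ℕ → ℂ) → ℕ → ℂ
Σ₁ f zero    = 0ᶜ
Σ₁ f (suc N) = Σ₁ f N +ᶜ f (suc N)

HasSum : (ℕ → ℂ) → ℂ → Set
HasSum f a = Σ₁ f ⟶ᶜ a

ℚ[i] : Set
ℚ[i] = ℚ × ℚ

infixl 6 _⊕_ _⊖_
infixl 7 _⊗_ _•_

_⊕_ _⊖_ _⊗_ : ℚ[i] → ℚ[i] → ℚ[i]
(a , b) ⊕ (c , d) = a + c , b + d
(a , b) ⊖ (c , d) = a - c , b - d
(a , b) ⊗ (c , d) = a * c - b * d , a * d + b * c

_•_ : ℚ → ℚ[i] → ℚ[i]
q • (a , b) = q * a , q * b

-- z ^ k / k !
expTerm : ℚ[i] → ℕ → ℚ[i]
expTerm z zero    = 1ℚ , 0ℚ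
expTerm z (suc k) = 1/suc k • (z ⊗ expTerm z k)

expSum : ℕ → ℚ[i] → ℚ[i]
expSum zero    z = 0ℚ , 0ℚ
expSum (suc n) z = expSum n z ⊕ expTerm z n

‖_‖ : ℚ[i] → ℚ
‖ a , b ‖ = ∣ a ∣ + ∣ b ∣

0≤‖‖ : ∀ z → 0ℚ ≤ ‖ z ‖
0≤‖‖ (a , b) = 0≤+ (0≤∣p∣ a) (0≤∣p∣ b)

‖⊕‖ : ∀ z w → ‖ z ⊕ w ‖ ≤ ‖ z ‖ + ‖ w ‖
‖⊕‖ (a , b) (c , d) = ≤-trans (+-mono-≤ (∣p+q∣≤∣p∣+∣q∣ a c) (∣p+q∣≤∣p∣+∣q∣ b d))
  (≤-reflexive (solve 4 (λ a b c d → (a :+ c) :+ (b :+ d) := (a :+ b) :+ (c :+ d))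
                      refl (∣ a ∣) (∣ b ∣) (∣ c ∣) (∣ d ∣)))

‖⊗‖ : ∀ z w → ‖ z ⊗ w ‖ ≤ ‖ z ‖ * ‖ w ‖
‖⊗‖ (a , b) (c , d) = ≤-trans
  (+-mono-≤ (∣p-q∣≤∣p∣+∣q∣ (a * c) (b * d)) (∣p+q∣≤∣p∣+∣q∣ (a * d) (b * c)))
  (≤-reflexive (trans
    (cong₂ _+_ (cong₂ _+_ (∣p*q∣≡∣p∣*∣q∣ a c) (∣p*q∣≡∣p∣*∣q∣ b d))
               (cong₂ _+_ (∣p*q∣≡∣p∣*∣q∣ a d) (∣p*q∣≡∣p∣*∣q∣ b c)))
    (solve 4 (λ a b c d → (a :* c :+ b :* d) :+ (a :* d :+ b :* c) := (a :+ b) :* (c :+ d))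
           refl (∣ a ∣) (∣ b ∣) (∣ c ∣) (∣ d ∣))))

‖•‖ : ∀ q z → 0ℚ ≤ q → ‖ q • z ‖ ≡ q * ‖ z ‖
‖•‖ q (a , b) 0≤q = trans (cong₂ _+_ (∣p*q∣≡∣p∣*∣q∣ q a) (∣p*q∣≡∣p∣*∣q∣ q b))
  (trans (cong (λ r → r * ∣ a ∣ + r * ∣ b ∣) (0≤p⇒∣p∣≡p 0≤q))
         (sym (*-distribˡ-+ q (∣ a ∣) (∣ b ∣))))

‖tri‖ : ∀ x y z → ‖ x ⊖ z ‖ ≤ ‖ x ⊖ y ‖ + ‖ y ⊖ z ‖
‖tri‖ (a , b) (c , d) (e , f) = ≤-trans (+-mono-≤ (tri a c e) (tri b d f))
  (≤-reflexive (solve 4 (λ a b c d → (a :+ c) :+ (b :+ d) := (a :+ b) :+ (c :+ d))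
                      refl (∣ a - c ∣) (∣ b - d ∣) (∣ c - e ∣) (∣ d - f ∣)))

‖⊖‖-sym : ∀ x y → ‖ x ⊖ y ‖ ≡ ‖ y ⊖ x ‖
‖⊖‖-sym (a , b) (c , d) = cong₂ _+_ (∣-∣-sym a c) (∣-∣-sym b d)

re≤‖‖ : ∀ z → ∣ proj₁ z ∣ ≤ ‖ z ‖
re≤‖‖ (a , b) = x≤x+p (0≤∣p∣ b)

im≤‖‖ : ∀ z → ∣ proj₂ z ∣ ≤ ‖ z ‖
im≤‖‖ (a , b) = x≤p+x (0≤∣p∣ a)

module ExpBounds (B : ℚ) (0<B : 0ℚ < B) where

  0≤B : 0ℚ ≤ B
  0≤B = <⇒≤ 0<B

  -- B ^ k / k !
  a : ℕ → ℚ
  a zero    = 1ℚ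
  a (suc k) = 1/suc k * (B * a k)

  0<a : ∀ k → 0ℚ < a k
  0<a zero    = 0<1
  0<a (suc k) = 0<* (0<1/suc k) (0<* 0<B (0<a k))

  0≤a : ∀ k → 0ℚ ≤ a k
  0≤a k = <⇒≤ (0<a k)

  term-bound : ∀ z → ‖ z ‖ ≤ B → ∀ k → ‖ expTerm z k ‖ ≤ a k
  term-bound z h zero    = ≤-refl
  term-bound z h (suc k) = ≤-trans
    (≤-reflexive (‖•‖ (1/suc k) (z ⊗ expTerm z k) (0≤1/suc k)))
    (mulˡ-≤ (0≤1/suc k) (≤-trans (‖⊗‖ z (expTerm z k))
      (mul-≤ (0≤‖‖ z) (0≤a k) h (term-bound z h k))))

  -- Lipschitz constants of expTerm and expSum on the ball of radius B
  c C : ℕ → ℚ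
  c zero    = 0ℚ
  c (suc k) = 1/suc k * (B * c k + a k)
  C zero    = 0ℚ
  C (suc n) = C n + c n

  0≤c : ∀ k → 0ℚ ≤ c k
  0≤c zero    = ≤-refl
  0≤c (suc k) = 0≤* (0≤1/suc k) (0≤+ (0≤* 0≤B (0≤c k)) (0≤a k))

  0≤C : ∀ k → 0ℚ ≤ C k
  0≤C zero    = ≤-refl
  0≤C (suc k) = 0≤+ (0≤C k) (0≤c k)

  term-lip : ∀ z w → ‖ z ‖ ≤ B → ‖ w ‖ ≤ B → ∀ k →
             ‖ expTerm z k ⊖ expTerm w k ‖ ≤ c k * ‖ z ⊖ w ‖
  term-lip z w hz hw zero = ≤-reflexive (sym (*-zeroˡ ‖ z ⊖ w ‖))
  term-lip z w hz hw (suc k) = ≤-trans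
    (≤-reflexive (trans (cong ‖_‖ eq) (‖•‖ r S (0≤1/suc k))))
    (≤-trans (mulˡ-≤ (0≤1/suc k) S≤)
      (≤-reflexive (solve 5 (λ r B ck ak d → r :* (B :* (ck :* d) :+ d :* ak) := r :* (B :* ck :+ ak) :* d)
                          refl r B (c k) (a k) ‖ z ⊖ w ‖)))
    where
    r = 1/suc k
    U = expTerm z k
    V = expTerm w k
    S = z ⊗ (U ⊖ V) ⊕ (z ⊖ w) ⊗ V
    eq : r • (z ⊗ U) ⊖ r • (w ⊗ V) ≡ r • S
    eq = cong₂ _,_
      (solve 9 (λ r z₁ z₂ w₁ w₂ u₁ u₂ v₁ v₂ →
         r :* (z₁ :* u₁ :- z₂ :* u₂) :- r :* (w₁ :* v₁ :- w₂ :* v₂)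
         := r :* ((z₁ :* (u₁ :- v₁) :- z₂ :* (u₂ :- v₂)) :+ ((z₁ :- w₁) :* v₁ :- (z₂ :- w₂) :* v₂)))
         refl r (proj₁ z) (proj₂ z) (proj₁ w) (proj₂ w) (proj₁ U) (proj₂ U) (proj₁ V) (proj₂ V))
      (solve 9 (λ r z₁ z₂ w₁ w₂ u₁ u₂ v₁ v₂ →
         r :* (z₁ :* u₂ :+ z₂ :* u₁) :- r :* (w₁ :* v₂ :+ w₂ :* v₁)
         := r :* ((z₁ :* (u₂ :- v₂) :+ z₂ :* (u₁ :- v₁)) :+ ((z₁ :- w₁) :* v₂ :+ (z₂ :- w₂) :* v₁)))
         refl r (proj₁ z) (proj₂ z) (proj₁ w) (proj₂ w) (proj₁ U) (proj₂ U) (proj₁ V) (proj₂ V))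
    S≤ : ‖ S ‖ ≤ B * (c k * ‖ z ⊖ w ‖) + ‖ z ⊖ w ‖ * a k
    S≤ = ≤-trans (‖⊕‖ (z ⊗ (U ⊖ V)) ((z ⊖ w) ⊗ V)) (+-mono-≤
      (≤-trans (‖⊗‖ z (U ⊖ V))
        (mul-≤ (0≤‖‖ z) (0≤* (0≤c k) (0≤‖‖ (z ⊖ w))) hz (term-lip z w hz hw k)))
      (≤-trans (‖⊗‖ (z ⊖ w) V) (mulˡ-≤ (0≤‖‖ (z ⊖ w)) (term-bound w hw k))))

  sum-lip : ∀ z w → ‖ z ‖ ≤ B → ‖ w ‖ ≤ B → ∀ n →
            ‖ expSum n z ⊖ expSum n w ‖ ≤ C n * ‖ z ⊖ w ‖
  sum-lip z w hz hw zero = ≤-reflexive (sym (*-zeroˡ ‖ z ⊖ w ‖))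
  sum-lip z w hz hw (suc n) = ≤-trans
    (≤-reflexive (cong ‖_‖ (cong₂ _,_
      (lem (proj₁ E) (proj₁ T) (proj₁ F) (proj₁ U))
      (lem (proj₂ E) (proj₂ T) (proj₂ F) (proj₂ U)))))
    (≤-trans (‖⊕‖ (E ⊖ F) (T ⊖ U))
      (≤-trans (+-mono-≤ (sum-lip z w hz hw n) (term-lip z w hz hw n))
        (≤-reflexive (sym (*-distribʳ-+ ‖ z ⊖ w ‖ (C n) (c n))))))
    where
    E = expSum n z
    F = expSum n w
    T = expTerm z n
    U = expTerm w n
    lem : ∀ e t f u → (e + t) - (f + u) ≡ (e - f) + (t - u)
    lem = solve 4 (λ e t f u → (e :+ t) :- (f :+ u) := (e :- f) :+ (t :- u)) refl

  half : ∃ λ K → ∀ k → K ℕ.≤ k → 2ℚ * a (suc k) ≤ a k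
  half with archimedean-* 0<B (0<1/suc 1)
  ... | K , h = K , λ k K≤k → ≤-trans
    (≤-reflexive (solve 3 (λ r b a → con 2ℚ :* (r :* (b :* a)) := (con 2ℚ :* (r :* b)) :* a)
                        refl (1/suc k) B (a k)))
    (≤-trans (mulʳ-≤ (0≤a k) (mulˡ-≤ (<⇒≤ 0<2) (h k K≤k)))
             (≤-reflexive (*-identityˡ (a k))))

  K : ℕ
  K = proj₁ half

  half-step : ∀ j → 2ℚ * a (suc (K ℕ.+ j)) ≤ a (K ℕ.+ j)
  half-step j = proj₂ half (K ℕ.+ j) (ℕ.m≤m+n K j)

  1/suc-step : ∀ j → 1/suc j ≤ 2ℚ * 1/suc (suc j)
  1/suc-step j = toℚᵘ-cancel-≤ (ℚᵘ.≤-trans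
    (ℚᵘ.*≤* (ℤ.+≤+ le))
    (ℚᵘ.≤-reflexive (ℚᵘ.≃-sym (toℚᵘ-homo-* 2ℚ (1/suc (suc j))))))
    where
    le : suc (suc (j ℕ.+ zero)) ℕ.+ zero ℕ.≤ 2 ℕ.* suc j
    le = ℕ.≤-trans (ℕ.m≤m+n _ j) (ℕ.≤-reflexive (eq j))
      where
      eq : ∀ j → suc (suc (j ℕ.+ zero)) ℕ.+ zero ℕ.+ j ≡ 2 ℕ.* suc j
      eq = solve-∀

  decay : ∀ j → a (K ℕ.+ j) ≤ 1/suc j * a K
  decay zero = ≤-reflexive (trans (cong a (ℕ.+-identityʳ K)) (sym (*-identityˡ (a K))))
  decay (suc j) = *-cancelˡ-≤-pos 2ℚ (≤-trans
    (≤-reflexive (cong (λ i → 2ℚ * a i) (ℕ.+-suc K j)))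
    (≤-trans (half-step j) (≤-trans (decay j)
      (≤-trans (mulʳ-≤ (0≤a K) (1/suc-step j))
        (≤-reflexive (*-assoc 2ℚ (1/suc (suc j)) (a K)))))))

  tail : ∀ z → ‖ z ‖ ≤ B → ∀ i j →
    ‖ expSum (K ℕ.+ i ℕ.+ j) z ⊖ expSum (K ℕ.+ i) z ‖ + 2ℚ * a (K ℕ.+ i ℕ.+ j) ≤ 2ℚ * a (K ℕ.+ i)
  tail z h i zero rewrite ℕ.+-identityʳ (K ℕ.+ i) = ≤-reflexive
    (trans (cong (_+ 2ℚ * a (K ℕ.+ i))
             (cong₂ (λ p q → ∣ p ∣ + ∣ q ∣) (+-inverseʳ (proj₁ (expSum (K ℕ.+ i) z)))
                                            (+-inverseʳ (proj₂ (expSum (K ℕ.+ i) z)))))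
           (+-identityˡ _))
  tail z h i (suc j) rewrite ℕ.+-suc (K ℕ.+ i) j = ≤-trans
    (+-mono-≤ step (≤-trans (≤-reflexive (cong (λ k → 2ℚ * a (suc k)) (ℕ.+-assoc K i j)))
                     (≤-trans (half-step (i ℕ.+ j))
                              (≤-reflexive (cong a (sym (ℕ.+-assoc K i j)))))))
    (≤-trans (≤-reflexive (solve 2 (λ d x → (d :+ x) :+ x := d :+ con 2ℚ :* x) refl ‖ E ⊖ F ‖ (a k)))
             (tail z h i j))
    where
    k = K ℕ.+ i ℕ.+ j
    E = expSum k z
    F = expSum (K ℕ.+ i) z
    T = expTerm z k
    lem : ∀ e t f → (e + t) - f ≡ (e - f) + t
    lem = solve 3 (λ e t f → (e :+ t) :- f := (e :- f) :+ t) refl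
    step : ‖ (E ⊕ T) ⊖ F ‖ ≤ ‖ E ⊖ F ‖ + a k
    step = ≤-trans
      (≤-reflexive (cong ‖_‖ (cong₂ _,_ (lem (proj₁ E) (proj₁ T) (proj₁ F))
                                        (lem (proj₂ E) (proj₂ T) (proj₂ F)))))
      (≤-trans (‖⊕‖ (E ⊖ F) T) (+-monoʳ-≤ ‖ E ⊖ F ‖ (term-bound z h k)))

  tail-≤ : ∀ z → ‖ z ‖ ≤ B → ∀ i n → K ℕ.+ i ℕ.≤ n →
           ‖ expSum n z ⊖ expSum (K ℕ.+ i) z ‖ ≤ 2ℚ * a (K ℕ.+ i)
  tail-≤ z h i n le = subst
    (λ n → ‖ expSum n z ⊖ expSum (K ℕ.+ i) z ‖ ≤ 2ℚ * a (K ℕ.+ i))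
    (ℕ.m+[n∸m]≡n le)
    (≤-trans (x≤x+p (0≤* (<⇒≤ 0<2) (0≤a (K ℕ.+ i ℕ.+ (n ∸ (K ℕ.+ i))))))
             (tail z h i (n ∸ (K ℕ.+ i))))

5ℚ : ℚ
5ℚ = 2ℚ + 1ℚ + 2ℚ

0<5 : 0ℚ < 5ℚ
0<5 = *<* (ℤ.+<+ (s≤s z≤n))

module _ (s : ℂ) where

  approx : ℕ → ℚ[i]
  approx n = seq (Re s) n , seq (Im s) n

  expSeq : ℕ → ℚ[i]
  expSeq n = expSum n (approx n)

  expSeq-cauchy : ∀ ε → 0ℚ < ε →
    ∃ λ N → ∀ m n → N ℕ.≤ m → N ℕ.≤ n → ‖ expSeq m ⊖ expSeq n ‖ ≤ 5ℚ * ε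
  expSeq-cauchy ε 0<ε = P ℕ.⊔ (M₁ ℕ.⊔ M₂) , main
    where
    B₁ = proj₁ (bounded (Re s))
    B₂ = proj₁ (bounded (Im s))
    0<B : 0ℚ < B₁ + B₂
    0<B = <-≤-trans (proj₁ (proj₂ (bounded (Re s))))
                    (x≤x+p (<⇒≤ (proj₁ (proj₂ (bounded (Im s))))))
    open ExpBounds (B₁ + B₂) 0<B
    hB : ∀ n → ‖ approx n ‖ ≤ B₁ + B₂
    hB n = +-mono-≤ (proj₂ (proj₂ (bounded (Re s))) n) (proj₂ (proj₂ (bounded (Im s))) n)
    small : ∃ λ N → ∀ n → N ℕ.≤ n → 1/suc n * a K ≤ ε
    small = archimedean-* (0<a K) 0<ε
    i = proj₁ small
    P = K ℕ.+ i
    Lip = 2ℚ * (C P + 1ℚ)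
    modulus : ∃ λ δ → 0ℚ < δ × Lip * δ ≡ ε
    modulus = quotient (0<* 0<2 (<-≤-trans 0<1 (x≤p+x (0≤C P)))) 0<ε
    δ = proj₁ modulus
    0<δ : 0ℚ < δ
    0<δ = proj₁ (proj₂ modulus)
    M₁ = proj₁ (cauchy (Re s) δ 0<δ)
    M₂ = proj₁ (cauchy (Im s) δ 0<δ)
    g₁ = proj₂ (cauchy (Re s) δ 0<δ)
    g₂ = proj₂ (cauchy (Im s) δ 0<δ)
    aP : 2ℚ * a P ≤ 2ℚ * ε
    aP = mulˡ-≤ (<⇒≤ 0<2) (≤-trans (decay i) (proj₂ small i ℕ.≤-refl))
    main : ∀ m n → P ℕ.⊔ (M₁ ℕ.⊔ M₂) ℕ.≤ m → P ℕ.⊔ (M₁ ℕ.⊔ M₂) ℕ.≤ n →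
           ‖ expSeq m ⊖ expSeq n ‖ ≤ 5ℚ * ε
    main m n hm hn = ≤-trans (‖tri‖ (expSeq m) (expSum P (approx m)) (expSeq n))
      (≤-trans (+-mono-≤ t₁ (≤-trans (‖tri‖ (expSum P (approx m)) (expSum P (approx n)) (expSeq n))
                                    (+-mono-≤ t₂ t₃)))
        (≤-reflexive (solve 1 (λ e → con 2ℚ :* e :+ (e :+ con 2ℚ :* e)
                                     := con 5ℚ :* e) refl ε)))
      where
      M≤ : ∀ {k} → P ℕ.⊔ (M₁ ℕ.⊔ M₂) ℕ.≤ k → M₁ ℕ.⊔ M₂ ℕ.≤ k
      M≤ = ℕ.m⊔n≤o⇒n≤o P (M₁ ℕ.⊔ M₂)
      t₁ : ‖ expSeq m ⊖ expSum P (approx m) ‖ ≤ 2ℚ * ε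
      t₁ = ≤-trans (tail-≤ (approx m) (hB m) i m (ℕ.m⊔n≤o⇒m≤o P _ hm)) aP
      t₃ : ‖ expSum P (approx n) ⊖ expSeq n ‖ ≤ 2ℚ * ε
      t₃ = ≤-trans (≤-reflexive (‖⊖‖-sym (expSum P (approx n)) (expSeq n)))
        (≤-trans (tail-≤ (approx n) (hB n) i n (ℕ.m⊔n≤o⇒m≤o P _ hn)) aP)
      d≤ : ‖ approx m ⊖ approx n ‖ ≤ δ + δ
      d≤ = +-mono-≤
        (g₁ m n (ℕ.m⊔n≤o⇒m≤o M₁ M₂ (M≤ hm)) (ℕ.m⊔n≤o⇒m≤o M₁ M₂ (M≤ hn)))
        (g₂ m n (ℕ.m⊔n≤o⇒n≤o M₁ M₂ (M≤ hm)) (ℕ.m⊔n≤o⇒n≤o M₁ M₂ (M≤ hn)))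
      t₂ : ‖ expSum P (approx m) ⊖ expSum P (approx n) ‖ ≤ ε
      t₂ = ≤-trans (sum-lip (approx m) (approx n) (hB m) (hB n) P)
        (≤-trans (mul-≤ (0≤C P) (0≤+ (<⇒≤ 0<δ) (<⇒≤ 0<δ)) (x≤x+p 0≤1) d≤)
          (≤-reflexive (trans
            (solve 2 (λ c d → c :* (d :+ d) := (con 2ℚ :* c) :* d) refl (C P + 1ℚ) δ) (proj₂ (proj₂ modulus)))))

-- The n-th approximation to exp s is ∑_{k<n} zₙ ^ k / k !, where zₙ is the
-- n-th rational approximation to s.
exp : ℂ → ℂ
exp s = mkℝ (λ n → proj₁ (expSeq s n)) (cauchy-scale (λ n → proj₁ (expSeq s n)) 5ℚ 0<5 λ ε 0<ε →
          proj₁ (expSeq-cauchy s ε 0<ε) , λ m n a b →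
            ≤-trans (re≤‖‖ (expSeq s m ⊖ expSeq s n)) (proj₂ (expSeq-cauchy s ε 0<ε) m n a b))
     +i mkℝ (λ n → proj₂ (expSeq s n)) (cauchy-scale (λ n → proj₂ (expSeq s n)) 5ℚ 0<5 λ ε 0<ε →
          proj₁ (expSeq-cauchy s ε 0<ε) , λ m n a b →
            ≤-trans (im≤‖‖ (expSeq s m ⊖ expSeq s n)) (proj₂ (expSeq-cauchy s ε 0<ε) m n a b))

-- ∑_{i<l} 1 / (s + 1 + i)
harmonic : ℕ → ℕ → ℚ
harmonic s zero    = 0ℚ
harmonic s (suc l) = harmonic s l + 1/suc (s ℕ.+ l)

-- log n = ∫₁ⁿ dx/x is approximated by the left Riemann sum with mesh h = 1 / (m + 1):
-- (n - 1)(m + 1) terms h / (1 + i h) = 1 / (m + 1 + i).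
logSeq : ℕ → ℕ → ℚ
logSeq n m = harmonic m ((n ∸ 1) ℕ.* suc m)

harmonic-+ : ∀ s l j → harmonic s (l ℕ.+ j) ≡ harmonic s l + harmonic (s ℕ.+ l) j
harmonic-+ s l zero rewrite ℕ.+-identityʳ l = sym (+-identityʳ (harmonic s l))
harmonic-+ s l (suc j) rewrite ℕ.+-suc l j | harmonic-+ s l j | ℕ.+-assoc s l j =
  +-assoc (harmonic s l) (harmonic (s ℕ.+ l) j) (1/suc (s ℕ.+ (l ℕ.+ j)))

natℚ : ℕ → ℚ
natℚ zero    = 0ℚ
natℚ (suc n) = natℚ n + 1ℚ

private
  natℚᵘ : ∀ n → toℚᵘ (natℚ n) ℚᵘ.≃ ℚᵘ.mkℚᵘ (+ n) 0
  natℚᵘ zero    = ℚᵘ.≃-refl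
  natℚᵘ (suc n) = ℚᵘ.≃-trans (toℚᵘ-homo-+ (natℚ n) 1ℚ)
    (ℚᵘ.≃-trans (ℚᵘ.+-congˡ (toℚᵘ 1ℚ) (natℚᵘ n)) (ℚᵘ.*≡* eq))
    where
    eq : (+ n ℤ.* + 1 ℤ.+ + 1 ℤ.* + 1) ℤ.* + 1 ≡ + suc n ℤ.* (+ 1 ℤ.* + 1)
    eq = trans (ℤ.*-identityʳ _) (trans (cong (ℤ._+ + 1) (ℤ.*-identityʳ (+ n)))
      (trans (cong +_ (ℕ.+-comm n 1)) (sym (ℤ.*-identityʳ (+ suc n)))))

natℚ-1/suc : ∀ k b → natℚ (suc k) * 1/suc (k ℕ.+ b ℕ.* suc k) ≡ 1/suc b
natℚ-1/suc k b = toℚᵘ-injective (ℚᵘ.≃-trans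
  (toℚᵘ-homo-* (natℚ (suc k)) (1/suc (k ℕ.+ b ℕ.* suc k)))
  (ℚᵘ.≃-trans (ℚᵘ.*-congʳ {toℚᵘ (1/suc (k ℕ.+ b ℕ.* suc k))} (natℚᵘ (suc k)))
    (ℚᵘ.*≡* (cong +_ (eq k b)))))
  where
  eq : ∀ k b → (suc k ℕ.* 1) ℕ.* suc b ≡ 1 ℕ.* (1 ℕ.* suc (k ℕ.+ b ℕ.* suc k))
  eq = solve-∀

harmonic-upper : ∀ s l → harmonic s l ≤ natℚ l * 1/suc s
harmonic-upper s zero    = ≤-reflexive (sym (*-zeroˡ (1/suc s)))
harmonic-upper s (suc l) = ≤-trans
  (+-mono-≤ (harmonic-upper s l) (1/suc-anti (ℕ.m≤m+n s l)))
  (≤-reflexive (solve 2 (λ n r → n :* r :+ r := (n :+ con 1ℚ) :* r) refl (natℚ l) (1/suc s)))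

harmonic-lower : ∀ s l r → s ℕ.+ l ℕ.≤ r → natℚ l * 1/suc r ≤ harmonic s l
harmonic-lower s zero    r h = ≤-reflexive (*-zeroˡ (1/suc r))
harmonic-lower s (suc l) r h = ≤-trans
  (≤-reflexive (solve 2 (λ n r → (n :+ con 1ℚ) :* r := n :* r :+ r) refl (natℚ l) (1/suc r)))
  (+-mono-≤ (harmonic-lower s l r h') (1/suc-anti h'))
  where
  h' : s ℕ.+ l ℕ.≤ r
  h' = ℕ.≤-trans (ℕ.+-monoʳ-≤ s (ℕ.n≤1+n l)) h

block-upper : ∀ k b → harmonic (k ℕ.+ b ℕ.* suc k) (suc k) ≤ 1/suc b
block-upper k b = ≤-trans (harmonic-upper (k ℕ.+ b ℕ.* suc k) (suc k))
                          (≤-reflexive (natℚ-1/suc k b))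

block-lower : ∀ k b → 1/suc (suc b) ≤ harmonic (k ℕ.+ b ℕ.* suc k) (suc k)
block-lower k b = ≤-trans (≤-reflexive (sym (natℚ-1/suc k (suc b))))
  (harmonic-lower (k ℕ.+ b ℕ.* suc k) (suc k) (k ℕ.+ suc b ℕ.* suc k) (ℕ.≤-reflexive (eq k b)))
  where
  eq : ∀ k b → k ℕ.+ b ℕ.* suc k ℕ.+ suc k ≡ k ℕ.+ suc b ℕ.* suc k
  eq = solve-∀

refine-split : ∀ k m l → harmonic (k ℕ.+ m ℕ.* suc k) (suc l ℕ.* suc k)
  ≡ harmonic (k ℕ.+ m ℕ.* suc k) (l ℕ.* suc k) + harmonic (k ℕ.+ (m ℕ.+ l) ℕ.* suc k) (suc k)
refine-split k m l = trans
  (cong (harmonic (k ℕ.+ m ℕ.* suc k)) (ℕ.+-comm (suc k) (l ℕ.* suc k)))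
  (trans (harmonic-+ (k ℕ.+ m ℕ.* suc k) (l ℕ.* suc k) (suc k))
    (cong (λ s → harmonic (k ℕ.+ m ℕ.* suc k) (l ℕ.* suc k) + harmonic s (suc k)) (eq k m l)))
  where
  eq : ∀ k m l → k ℕ.+ m ℕ.* suc k ℕ.+ l ℕ.* suc k ≡ k ℕ.+ (m ℕ.+ l) ℕ.* suc k
  eq = solve-∀

refine-upper : ∀ k m l → harmonic (k ℕ.+ m ℕ.* suc k) (l ℕ.* suc k) ≤ harmonic m l
refine-upper k m zero    = ≤-refl
refine-upper k m (suc l) = ≤-trans (≤-reflexive (refine-split k m l))
  (+-mono-≤ (refine-upper k m l) (block-upper k (m ℕ.+ l)))

refine-lower : ∀ k m l → harmonic (suc m) l ≤ harmonic (k ℕ.+ m ℕ.* suc k) (l ℕ.* suc k)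
refine-lower k m zero    = ≤-refl
refine-lower k m (suc l) = ≤-trans
  (+-mono-≤ (refine-lower k m l) (block-lower k (m ℕ.+ l)))
  (≤-reflexive (sym (refine-split k m l)))

harmonic-shift : ∀ m l → harmonic m l ≤ harmonic (suc m) l + 1/suc m
harmonic-shift m l = ≤-trans (x≤x+p (0≤1/suc (m ℕ.+ l))) (≤-reflexive (trans
  (harmonic-+ m 1 l) (trans
    (cong₂ (λ r s → 0ℚ + 1/suc r + harmonic s l) (ℕ.+-identityʳ m) (ℕ.+-comm m 1))
    (solve 2 (λ a b → con 0ℚ :+ a :+ b := b :+ a) refl (1/suc m) (harmonic (suc m) l)))))

refine-close : ∀ n m k → ∣ logSeq n m - logSeq n (k ℕ.+ m ℕ.* suc k) ∣ ≤ 1/suc m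
refine-close n m k rewrite sym (ℕ.*-assoc (n ∸ 1) (suc m) (suc k)) = ∣∣-≤
  (x-y≤ (≤-trans (harmonic-shift m l) (+-monoˡ-≤ (1/suc m) (refine-lower k m l))))
  (≤-trans (≤-reflexive (solve 2 (λ a b → :- (a :- b) := b :- a) refl
             (harmonic m l) (harmonic (k ℕ.+ m ℕ.* suc k) (l ℕ.* suc k))))
    (x-y≤ (≤-trans (refine-upper k m l) (x≤x+p (0≤1/suc m)))))
  where
  l = (n ∸ 1) ℕ.* suc m

logSeq-close : ∀ n m k → ∣ logSeq n m - logSeq n k ∣ ≤ 1/suc m + 1/suc k
logSeq-close n m k = ≤-trans
  (tri (logSeq n m) (logSeq n (k ℕ.+ m ℕ.* suc k)) (logSeq n k))
  (+-mono-≤ (refine-close n m k)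
    (≤-trans (≤-reflexive (trans
        (cong (λ r → ∣ logSeq n r - logSeq n k ∣) (eq k m))
        (∣-∣-sym (logSeq n (m ℕ.+ k ℕ.* suc m)) (logSeq n k))))
      (refine-close n k m)))
  where
  eq : ∀ k m → k ℕ.+ m ℕ.* suc k ≡ m ℕ.+ k ℕ.* suc m
  eq = solve-∀

-- log 0 is a junk value.
log : ℕ → ℝ
log n = mkℝ (logSeq n) (cauchy-scale (logSeq n) 2ℚ 0<2 lem)
  where
  lem : ∀ ε → 0ℚ < ε → _
  lem ε 0<ε with archimedean 0<ε
  ... | N , h = N , λ m k a b → ≤-trans (logSeq-close n m k)
    (≤-trans (+-mono-≤ (h m a) (h k b))
             (≤-reflexive (solve 1 (λ e → e :+ e := con 2ℚ :* e) refl ε)))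

infixr 9 _^ᶜ_

_^ᶜ_ : ℕ → ℂ → ℂ
n ^ᶜ s = exp (s *ᶜ fromℝ (log n))

t : ℕ → ℕ
t n = sum (map toℕ (proj₁ (toDigits 2 n))) % 2

{-# OPTIONS --safe #-}
module Submission where

-- Put a n = n ^ (- s). Since t (2 n) = t n and t (2 n + 1) = 1 - t n, the sum of
-- t (n - 1) a n + t n a n - a n over 1 ≤ n ≤ 2 N equals ∑_{1≤n≤N} (t n - t (n - 1)) a (2 n),
-- and 2 ^ s a (2 n) = a n.
-- So 2 ^ s (A_{2N} + B_{2N} - Z_{2N}) = B_N - A_N for the partial sums, and N → ∞ gives the theorem.
-- Convergence: as log (n + 1) - log n ≥ 1 / (n + 1) and exp x ≥ 1 + x, the sequence (n + 1) n ^ (- σ)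
-- decreases by at least (σ - 1) (n + 1) ^ (- σ) at each step, and it tends to 0 like the inverse of
-- the harmonic series.

open import Algebra.Bundles using (CommutativeRing; CommutativeSemiring)
open import Algebra.Structures using (IsCommutativeSemiring)
open import Algebra.Structures.Biased using (isCommutativeSemiringˡ)
import Algebra.Solver.Ring.NaturalCoefficients.Default as SemiringSolver
open import Data.Digit using (toDigits; fromDigits; Expansion)
open import Data.Empty using (⊥-elim)
open import Data.Fin.Base using (toℕ) renaming (zero to fzero; suc to fsuc)
open import Data.Integer.Base using (+_)
open import Data.List.Base using (map; []; _∷_)
open import Data.Nat.Base as ℕ using (ℕ; zero; suc; _∸_; z≤n; s≤s; _%_)
open import Data.Nat.DivMod using (m%n<n; %-distribˡ-+)
open import Data.Nat.ListAction using (sum)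
import Data.Nat.Properties as ℕ
open import Data.Nat.Tactic.RingSolver using (solve-∀)
open import Data.Product.Base using (∃; _×_; _,_; proj₁; proj₂)
open import Data.Rational.Base
  using (ℚ; 0ℚ; 1ℚ; _+_; _*_; _-_; -_; ∣_∣; _≤_; _<_; _⊔_; _/_; positive)
open import Data.Rational.Properties hiding (≃-sym)
open import Data.Rational.Solver using (module +-*-Solver)
open import Data.Sum.Base using (_⊎_; inj₁; inj₂)
open import Function.Base using (_∘_)
open import Level using (0ℓ)
open import Relation.Binary.PropositionalEquality
open import Defs

-- The obstacle is the exponential: its `n`-th approximation is the `n`-term sum at the `n`-th
-- approximation of the argument, so the functional equation, and even compatibility with equality
-- of reals, need estimates uniform in `n`. The product of the `n`-term sums at z and w differs from
-- the `n`-term sum at z + w by the products of terms j and k with j, k < n ≤ j + k. Majorising the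
-- terms by B ^ k / k ! bounds this by the block from n to 2 n of the series for e ^ (2 B), which is
-- null because that series defines a real. The size of n ^ (- s) comes without trigonometry from
-- exp z * exp (conj z) = exp (2 Re z). For 1 + δ ≤ σ the decay rests on (n + 1) (1 + δ (1/3 + ... +
-- 1/(n + 1))) ≤ 2 n ^ σ, proved by induction on n. The sign of a real cannot be decided:
-- inequalities hold up to null sequences, and n ^ (- σ) ≥ 0 is read off from its inverse.

-- Formal power series: Cauchy products and the differential equation of the exponential

module Convolution {A : Set} {_+_ _*_ : A → A → A} {0# 1# : A}
  (isCommutativeSemiring : IsCommutativeSemiring _≡_ _+_ _*_ 0# 1#) where

  private
    infixl 6 _⊞_
    infixl 7 _⊠_

    _⊞_ _⊠_ : A → A → A
    _⊞_ = _+_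
    _⊠_ = _*_

    bundle : CommutativeSemiring 0ℓ 0ℓ
    bundle = record { isCommutativeSemiring = isCommutativeSemiring }

    open SemiringSolver bundle using (solve; _:+_; _:*_; _:=_; con)

  fromNat : ℕ → A
  fromNat zero    = 0#
  fromNat (suc n) = fromNat n + 1#

  Σ< : ℕ → (ℕ → A) → A
  Σ< zero    f = 0#
  Σ< (suc n) f = Σ< n f + f n

  -- conv f g m = ∑_{j+k=m} f j * g k
  conv : (ℕ → A) → (ℕ → A) → ℕ → A
  conv f g zero    = f 0 * g 0
  conv f g (suc m) = (f 0 * g (suc m)) + conv (f ∘ suc) g m

  -- The formal derivative of the power series with coefficients `f`.
  ∂ : (ℕ → A) → ℕ → A
  ∂ f k = fromNat (suc k) * f (suc k)

  Σ<-head : ∀ n f → Σ< (suc n) f ≡ f 0 ⊞ Σ< n (f ∘ suc)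
  Σ<-head zero    f = solve 1 (λ x → con 0 :+ x := x :+ con 0) refl (f 0)
  Σ<-head (suc n) f = trans (cong (_⊞ f (suc n)) (Σ<-head n f))
    (solve 3 (λ x s y → (x :+ s) :+ y := x :+ (s :+ y)) refl (f 0) (Σ< n (f ∘ suc)) (f (suc n)))

  conv-congˡ : ∀ {f g} h → (∀ n → f n ≡ g n) → ∀ m → conv f h m ≡ conv g h m
  conv-congˡ h e zero    = cong (_⊠ h 0) (e 0)
  conv-congˡ h e (suc m) = cong₂ _⊞_ (cong (_⊠ h (suc m)) (e 0)) (conv-congˡ h (e ∘ suc) m)

  conv-congʳ : ∀ f {g h} → (∀ n → g n ≡ h n) → ∀ m → conv f g m ≡ conv f h m
  conv-congʳ f e zero    = cong (f 0 ⊠_) (e 0)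
  conv-congʳ f e (suc m) = cong₂ _⊞_ (cong (f 0 ⊠_) (e (suc m))) (conv-congʳ (f ∘ suc) e m)

  conv-+ˡ : ∀ f g h m → conv (λ k → f k ⊞ g k) h m ≡ conv f h m ⊞ conv g h m
  conv-+ˡ f g h zero    = solve 3 (λ a b c → (a :+ b) :* c := a :* c :+ b :* c) refl (f 0) (g 0) (h 0)
  conv-+ˡ f g h (suc m) = trans
    (cong ((f 0 ⊞ g 0) ⊠ h (suc m) ⊞_) (conv-+ˡ (f ∘ suc) (g ∘ suc) h m))
    (solve 5 (λ a b c x y → (a :+ b) :* c :+ (x :+ y) := (a :* c :+ x) :+ (b :* c :+ y)) refl
      (f 0) (g 0) (h (suc m)) (conv (f ∘ suc) h m) (conv (g ∘ suc) h m))

  conv-scaleˡ : ∀ z f g m → conv (λ k → z ⊠ f k) g m ≡ z ⊠ conv f g m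
  conv-scaleˡ z f g zero    = solve 3 (λ z a b → (z :* a) :* b := z :* (a :* b)) refl z (f 0) (g 0)
  conv-scaleˡ z f g (suc m) = trans
    (cong ((z ⊠ f 0) ⊠ g (suc m) ⊞_) (conv-scaleˡ z (f ∘ suc) g m))
    (solve 4 (λ z a b x → (z :* a) :* b :+ z :* x := z :* (a :* b :+ x)) refl
      z (f 0) (g (suc m)) (conv (f ∘ suc) g m))

  conv-scaleʳ : ∀ z f g m → conv f (λ k → z ⊠ g k) m ≡ z ⊠ conv f g m
  conv-scaleʳ z f g zero    = solve 3 (λ z a b → a :* (z :* b) := z :* (a :* b)) refl z (f 0) (g 0)
  conv-scaleʳ z f g (suc m) = trans
    (cong (f 0 ⊠ (z ⊠ g (suc m)) ⊞_) (conv-scaleʳ z (f ∘ suc) g m))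
    (solve 4 (λ z a b x → a :* (z :* b) :+ z :* x := z :* (a :* b :+ x)) refl
      z (f 0) (g (suc m)) (conv (f ∘ suc) g m))

  -- Leibniz rule. Once the product with `f 0` is split off, the factor m + 2 of the rest is one
  -- more than the induction hypothesis handles; the extra copy of `conv Sf g` raises the factors of
  -- `∂ Sf` by one, which makes them those of the shifted `∂ f`.
  ∂-conv : ∀ f g m → ∂ (conv f g) m ≡ conv (∂ f) g m ⊞ conv f (∂ g) m
  ∂-conv f g zero = solve 4
    (λ a b c d → (con 0 :+ con 1) :* (a :* d :+ b :* c)
              := ((con 0 :+ con 1) :* b) :* c :+ a :* ((con 0 :+ con 1) :* d))
    refl (f 0) (f 1) (g 0) (g 1)
  ∂-conv f g (suc m) = trans
    (solve 4 (λ ν a b x → (ν :+ con 1) :* (a :* b :+ x)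
                       := a :* ((ν :+ con 1) :* b) :+ (ν :* x :+ x))
      refl (fromNat (suc m)) (f 0) (g (suc (suc m))) (conv Sf g (suc m)))
    (trans (cong (λ x → f 0 ⊠ ∂ g (suc m) ⊞ (x ⊞ conv Sf g (suc m))) (∂-conv Sf g m))
      (trans (solve 5 (λ a p q c r → a :+ ((p :+ q) :+ (c :+ r)) := (c :+ (p :+ r)) :+ (a :+ q)) refl
          (f 0 ⊠ ∂ g (suc m)) (conv (∂ Sf) g m) (conv Sf (∂ g) m)
          (f 1 ⊠ g (suc m)) (conv (Sf ∘ suc) g m))
        (cong (_⊞ conv f (∂ g) (suc m)) (cong₂ _⊞_
          (solve 2 (λ a b → a :* b := ((con 0 :+ con 1) :* a) :* b) refl (f 1) (g (suc m)))
          (trans (sym (conv-+ˡ (∂ Sf) (Sf ∘ suc) g m))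
            (conv-congˡ g (λ k → solve 2 (λ ν x → ν :* x :+ x := (ν :+ con 1) :* x) refl
                                   (fromNat (suc k)) (f (suc (suc k)))) m))))))
    where
    Sf : ℕ → A
    Sf = f ∘ suc

  -- The row j = 0 of the triangle j + k ≤ n is split off; this drives the inductions of both
  -- majorant estimates.
  Σ<-conv-head : ∀ f g n →
    Σ< (suc n) (conv f g) ≡ f 0 ⊠ Σ< (suc n) g ⊞ Σ< n (conv (f ∘ suc) g)
  Σ<-conv-head f g zero = solve 2 (λ a b → con 0 :+ a :* b := a :* (con 0 :+ b) :+ con 0) refl (f 0) (g 0)
  Σ<-conv-head f g (suc n) = trans
    (cong (_⊞ conv f g (suc n)) (Σ<-conv-head f g n))
    (solve 5 (λ a s d b x → (a :* s :+ d) :+ (a :* b :+ x) := a :* (s :+ b) :+ (d :+ x)) refl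
      (f 0) (Σ< (suc n) g) (Σ< n (conv (f ∘ suc) g)) (g (suc n)) (conv (f ∘ suc) g n))

  -- The initial value problem f′ = z f, f (0) = 1, which characterises the coefficients z ^ k / k
  -- !.
  record IsExp (z : A) (f : ℕ → A) : Set where
    field
      exp-0 : f 0 ≡ 1#
      ∂-exp : ∀ k → ∂ f k ≡ z * f k

  module _ (inv : ℕ → A) (inv-* : ∀ k → inv k * fromNat (suc k) ≡ 1#) where

    cancel : ∀ k {x y} → fromNat (suc k) ⊠ x ≡ fromNat (suc k) ⊠ y → x ≡ y
    cancel k {x} {y} e = trans (sym (lem x)) (trans (cong (inv k ⊠_) e) (lem y))
      where
      lem : ∀ x → inv k ⊠ (fromNat (suc k) ⊠ x) ≡ x
      lem x = trans
        (solve 3 (λ a b c → a :* (b :* c) := (a :* b) :* c) refl (inv k) (fromNat (suc k)) x)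
        (trans (cong (_⊠ x) (inv-* k)) (solve 1 (λ x → con 1 :* x := x) refl x))

    -- By the Leibniz rule the Cauchy product solves the initial value problem for z + w, and the
    -- problem determines its coefficients one after the other because k + 1 can be cancelled. This
    -- takes the place of the binomial theorem.
    conv-exp : ∀ {z w f g h} → IsExp z f → IsExp w g → IsExp (z + w) h → ∀ m → conv f g m ≡ h m
    conv-exp {z} {w} {f} {g} {h} F G H = go
      where
      open IsExp
      go : ∀ m → conv f g m ≡ h m
      go zero = trans (cong₂ _⊠_ (exp-0 F) (exp-0 G))
        (trans (solve 0 (con 1 :* con 1 := con 1) refl) (sym (exp-0 H)))
      go (suc m) = cancel m (trans (∂-conv f g m)
        (trans (cong₂ _⊞_ (trans (conv-congˡ g (∂-exp F) m) (conv-scaleˡ z f g m))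
                          (trans (conv-congʳ f (∂-exp G) m) (conv-scaleʳ w f g m)))
          (trans (solve 3 (λ z w c → z :* c :+ w :* c := (z :+ w) :* c) refl z w (conv f g m))
            (trans (cong ((z ⊞ w) ⊠_) (go m)) (sym (∂-exp H m))))))

-- Real numbers modulo null sequences

open +-*-Solver using (solve; _:+_; _:*_; :-_; _:-_; _:=_; con)

Eventually : (ℕ → Set) → Set
Eventually P = ∃ λ N → ∀ n → N ℕ.≤ n → P n

always : ∀ {P : ℕ → Set} → (∀ n → P n) → Eventually P
always h = 0 , λ n _ → h n

eventually-map : ∀ {P Q : ℕ → Set} → Eventually P → (∀ n → P n → Q n) → Eventually Q
eventually-map (N , p) h = N , λ n N≤n → h n (p n N≤n)

eventually-zip : ∀ {P Q R : ℕ → Set} → Eventually P → Eventually Q →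
                 (∀ n → P n → Q n → R n) → Eventually R
eventually-zip (M , p) (N , q) h = M ℕ.⊔ N , λ n le →
  h n (p n (ℕ.m⊔n≤o⇒m≤o M N le)) (q n (ℕ.m⊔n≤o⇒n≤o M N le))

abstract
  halve : ∀ {ε} → 0ℚ < ε → ∃ λ δ → 0ℚ < δ × δ + δ ≡ ε
  halve {ε} 0<ε = let δ , 0<δ , e = quotient 0<2 0<ε in
    δ , 0<δ , trans (solve 1 (λ d → d :+ d := con 2ℚ :* d) refl δ) e

p≤q⇒0≤q-p : ∀ {p q} → p ≤ q → 0ℚ ≤ q - p
p≤q⇒0≤q-p {p} {q} h = ≤-trans (≤-reflexive (sym (+-inverseʳ p))) (+-monoˡ-≤ (- p) h)

0≤q-p⇒p≤q : ∀ {p q} → 0ℚ ≤ q - p → p ≤ q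
0≤q-p⇒p≤q {p} {q} h = ≤-trans (≤-reflexive (sym (+-identityˡ p)))
  (≤-trans (+-monoˡ-≤ p h) (≤-reflexive (solve 2 (λ p q → q :- p :+ p := q) refl p q)))

Null : (ℕ → ℚ) → Set
Null f = ∀ ε → 0ℚ < ε → Eventually λ n → ∣ f n ∣ ≤ ε

null-0 : Null λ _ → 0ℚ
null-0 ε 0<ε = always λ _ → <⇒≤ 0<ε

null-+ : ∀ {f g : ℕ → ℚ} → Null f → Null g → Null λ n → f n + g n
null-+ {f} {g} F G ε 0<ε with halve 0<ε
... | δ , 0<δ , e = eventually-zip (F δ 0<δ) (G δ 0<δ)
  λ n p q → ≤-trans (∣p+q∣≤∣p∣+∣q∣ (f n) (g n)) (≤-trans (+-mono-≤ {∣ f n ∣} {δ} {∣ g n ∣} {δ} p q) (≤-reflexive e))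

null-dominated : ∀ {f g : ℕ → ℚ} → Null g → (∀ n → ∣ f n ∣ ≤ ∣ g n ∣) → Null f
null-dominated G h ε 0<ε = eventually-map (G ε 0<ε) λ n p → ≤-trans (h n) p

null-≡ : ∀ {f g : ℕ → ℚ} → (∀ n → f n ≡ g n) → Null f → Null g
null-≡ h F = null-dominated F λ n → ≤-reflexive (cong ∣_∣ (sym (h n)))

null-neg : ∀ {f : ℕ → ℚ} → Null f → Null λ n → - f n
null-neg {f} F = null-dominated F λ n → ≤-reflexive (∣-p∣≡∣p∣ (f n))

null-bounded-* : ∀ {f g : ℕ → ℚ} {C} → 0ℚ < C → (Eventually λ n → ∣ f n ∣ ≤ C) → Null g →
                 Null λ n → f n * g n
null-bounded-* {f} {g} {C} 0<C b G ε 0<ε with quotient {C} {ε} 0<C 0<ε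
... | δ , 0<δ , e = eventually-zip b (G δ 0<δ)
  λ n p q → ≤-trans (≤-reflexive (∣p*q∣≡∣p∣*∣q∣ (f n) (g n)))
    (≤-trans (mul-≤ {∣ f n ∣} {δ} {C} (0≤∣p∣ (f n)) (<⇒≤ 0<δ) p q) (≤-reflexive e))

null-ℝ-* : ∀ (x : ℝ) {g} → Null g → Null λ n → seq x n * g n
null-ℝ-* x with bounded x
... | B , 0<B , h = null-bounded-* {seq x} 0<B (always h)

null-* : ∀ {f g : ℕ → ℚ} → Null f → Null g → Null λ n → f n * g n
null-* {f} F = null-bounded-* {f} 0<1 (F 1ℚ 0<1)

null-modulus : ∀ (x : ℝ) (φ : ℕ → ℕ) → (∀ n → n ℕ.≤ φ n) → Null λ n → seq x (φ n) - seq x n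
null-modulus x φ h ε 0<ε with cauchy x ε 0<ε
... | N , p = N , λ n N≤n → p (φ n) n (ℕ.≤-trans N≤n (h n)) N≤n

infix 4 _≃_ _≼_

-- A record rather than _≈ᴿ_ itself, so that Agda can infer x and y.
record _≃_ (x y : ℝ) : Set where
  constructor ≈⇒≃
  field ≃⇒≈ : x ≈ᴿ y

open _≃_ public

≗⇒≃ : ∀ {x y} → (∀ n → seq x n ≡ seq y n) → x ≃ y
≗⇒≃ {x} {y} h = ≈⇒≃ (null-≡ {λ _ → 0ℚ}
  (λ n → sym (trans (cong (_- seq y n) (h n)) (+-inverseʳ (seq y n)))) null-0)

≃-refl : ∀ {x} → x ≃ x
≃-refl {x} = ≗⇒≃ {x} {x} λ _ → refl

≃-sym : ∀ {x y} → x ≃ y → y ≃ x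
≃-sym {x} {y} (≈⇒≃ p) = ≈⇒≃ (null-≡
  (λ n → solve 2 (λ a b → :- (a :- b) := b :- a) refl (seq x n) (seq y n))
  (null-neg p))

≃-trans : ∀ {x y z} → x ≃ y → y ≃ z → x ≃ z
≃-trans {x} {y} {z} (≈⇒≃ p) (≈⇒≃ q) = ≈⇒≃ (null-≡
  (λ n → solve 3 (λ a b c → (a :- b) :+ (b :- c) := a :- c) refl (seq x n) (seq y n) (seq z n))
  (null-+ p q))

+ᴿ-cong : ∀ {x y u v} → x ≃ y → u ≃ v → x +ᴿ u ≃ y +ᴿ v
+ᴿ-cong {x} {y} {u} {v} (≈⇒≃ p) (≈⇒≃ q) = ≈⇒≃ (null-≡
  (λ n → solve 4 (λ a b c d → (a :- b) :+ (c :- d) := (a :+ c) :- (b :+ d)) refl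
           (seq x n) (seq y n) (seq u n) (seq v n))
  (null-+ p q))

*ᴿ-cong : ∀ {x y u v} → x ≃ y → u ≃ v → x *ᴿ u ≃ y *ᴿ v
*ᴿ-cong {x} {y} {u} {v} (≈⇒≃ p) (≈⇒≃ q) = ≈⇒≃ (null-≡
  (λ n → solve 4 (λ a b c d → c :* (a :- b) :+ b :* (c :- d) := a :* c :- b :* d) refl
           (seq x n) (seq y n) (seq u n) (seq v n))
  (null-+ (null-ℝ-* u p) (null-ℝ-* y q)))

-- One null error sequence in place of a threshold for every ε: inequalities can then be added and
-- multiplied by termwise computation. `≼-by-ε` and `≼⇒eventually` show that both forms are
-- equivalent.
record _≼_ (x y : ℝ) : Set where
  constructor mk≼
  field
    err      : ℕ → ℚ
    err-null : Null err
    ≤+err    : ∀ n → seq x n ≤ seq y n + err n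

open _≼_ public

≼-everywhere : ∀ {x y} → (∀ n → seq x n ≤ seq y n) → x ≼ y
≼-everywhere {y = y} h = mk≼ (λ _ → 0ℚ) null-0
  λ n → ≤-trans (h n) (≤-reflexive (sym (+-identityʳ (seq y n))))

≼-by-ε : ∀ {x y} → (∀ ε → 0ℚ < ε → Eventually λ n → seq x n ≤ seq y n + ε) → x ≼ y
≼-by-ε {x} {y} h = mk≼ e null λ n → ≤-trans
  (≤-reflexive (solve 2 (λ a b → a := b :+ (a :- b)) refl (seq x n) (seq y n)))
  (+-monoʳ-≤ (seq y n) (p≤q⊔p 0ℚ (seq x n - seq y n)))
  where
  -- The difference itself need not be null, since `x` may lie well below `y`; only its positive
  -- part is.
  e : ℕ → ℚ
  e n = 0ℚ ⊔ (seq x n - seq y n)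
  null : Null e
  null ε 0<ε = eventually-map (h ε 0<ε)
    λ n p → ≤-trans (≤-reflexive (0≤p⇒∣p∣≡p (p≤p⊔q 0ℚ (seq x n - seq y n))))
                    (⊔-lub (<⇒≤ 0<ε) (x-y≤ {seq x n} {seq y n} p))

≼-eventually : ∀ {x y} → (Eventually λ n → seq x n ≤ seq y n) → x ≼ y
≼-eventually h = ≼-by-ε λ ε 0<ε → eventually-map h λ n p → ≤-trans p (x≤x+p (<⇒≤ 0<ε))

≼⇒eventually : ∀ {x y} → x ≼ y → ∀ ε → 0ℚ < ε → Eventually λ n → seq x n ≤ seq y n + ε
≼⇒eventually {y = y} (mk≼ e null h) ε 0<ε = eventually-map (null ε 0<ε)
  λ n p → ≤-trans (h n) (+-monoʳ-≤ (seq y n) (≤-trans (x≤∣x∣ (e n)) p))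

≃⇒≼ : ∀ {x y} → x ≃ y → x ≼ y
≃⇒≼ {x} {y} (≈⇒≃ p) = mk≼ _ p λ n →
  ≤-reflexive (solve 2 (λ a b → a := b :+ (a :- b)) refl (seq x n) (seq y n))

≼-trans : ∀ {x y z} → x ≼ y → y ≼ z → x ≼ z
≼-trans {z = z} (mk≼ e en e≤) (mk≼ f fn f≤) = mk≼ _ (null-+ fn en) λ n →
  ≤-trans (e≤ n) (≤-trans (+-monoˡ-≤ (e n) (f≤ n)) (≤-reflexive (+-assoc (seq z n) (f n) (e n))))

+ᴿ-mono : ∀ {x y u v} → x ≼ y → u ≼ v → x +ᴿ u ≼ y +ᴿ v
+ᴿ-mono {y = y} {v = v} (mk≼ e en e≤) (mk≼ f fn f≤) = mk≼ _ (null-+ en fn) λ n →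
  ≤-trans (+-mono-≤ (e≤ n) (f≤ n))
    (≤-reflexive (solve 4 (λ y e v f → (y :+ e) :+ (v :+ f) := (y :+ v) :+ (e :+ f)) refl
                        (seq y n) (e n) (seq v n) (f n)))

-- The approximations may be negative, but their sums with the errors are not. In the product of
-- these sums every term besides x y contains an error, and it is null because the approximations
-- are bounded.
0≼* : ∀ {x y} → 0ᴿ ≼ x → 0ᴿ ≼ y → 0ᴿ ≼ x *ᴿ y
0≼* {x} {y} (mk≼ e en e≤) (mk≼ f fn f≤) = mk≼ _
  (null-+ (null-+ (null-ℝ-* x fn) (null-ℝ-* y en)) (null-* en fn)) λ n →
  ≤-trans (0≤* (e≤ n) (f≤ n))
    (≤-reflexive (solve 4 (λ x e y f → (x :+ e) :* (y :+ f) := x :* y :+ (x :* f :+ y :* e :+ e :* f)) refl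
                        (seq x n) (e n) (seq y n) (f n)))

0≼-⇒≼ : ∀ {x y} → 0ᴿ ≼ y -ᴿ x → x ≼ y
0≼-⇒≼ {x} {y} (mk≼ e en e≤) = mk≼ e en λ n → ≤-trans
  (≤-reflexive (sym (+-identityʳ (seq x n))))
  (≤-trans (+-monoʳ-≤ (seq x n) (e≤ n))
    (≤-reflexive (solve 3 (λ x y e → x :+ (y :- x :+ e) := y :+ e) refl (seq x n) (seq y n) (e n))))

≼⇒0≼- : ∀ {x y} → x ≼ y → 0ᴿ ≼ y -ᴿ x
≼⇒0≼- {x} {y} (mk≼ e en e≤) = mk≼ e en λ n → ≤-trans
  (p≤q⇒0≤q-p (e≤ n))
  (≤-reflexive (solve 3 (λ x y e → y :+ e :- x := y :- x :+ e) refl (seq x n) (seq y n) (e n)))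

≼-resp-≗ : ∀ {x y u v} → (∀ n → seq x n ≡ seq u n) → (∀ n → seq y n ≡ seq v n) → x ≼ y → u ≼ v
≼-resp-≗ p q (mk≼ e en e≤) = mk≼ e en λ n → subst₂ (λ a b → a ≤ b + e n) (p n) (q n) (e≤ n)

*ᴿ-monoʳ : ∀ {p x y} → 0ᴿ ≼ p → x ≼ y → p *ᴿ x ≼ p *ᴿ y
*ᴿ-monoʳ {p} {x} {y} 0≼p x≼y = 0≼-⇒≼ {p *ᴿ x} {p *ᴿ y}
  (≼-resp-≗ {0ᴿ} {p *ᴿ (y -ᴿ x)} (λ _ → refl)
    (λ n → solve 3 (λ p x y → p :* (y :- x) := p :* y :- p :* x) refl (seq p n) (seq x n) (seq y n))
    (0≼* {p} {y -ᴿ x} 0≼p (≼⇒0≼- {x} {y} x≼y)))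

fromℚ-mono : ∀ {p q} → p ≤ q → fromℚ p ≼ fromℚ q
fromℚ-mono h = ≼-everywhere λ _ → h

-- The functional equation of the exponential function

ℚ-isCommutativeSemiring : IsCommutativeSemiring _≡_ _+_ _*_ 0ℚ 1ℚ
ℚ-isCommutativeSemiring = CommutativeRing.isCommutativeSemiring +-*-commutativeRing

ℚ[i]-isCommutativeSemiring : IsCommutativeSemiring _≡_ _⊕_ _⊗_ (0ℚ , 0ℚ) (1ℚ , 0ℚ)
ℚ[i]-isCommutativeSemiring = isCommutativeSemiringˡ record
  { +-isCommutativeMonoid = record
    { isMonoid = record
      { isSemigroup = record
        { isMagma = record { isEquivalence = isEquivalence ; ∙-cong = cong₂ _⊕_ }
        ; assoc = λ (a , b) (c , d) (e , f) → cong₂ _,_ (+-assoc a c e) (+-assoc b d f)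
        }
      ; identity = (λ (a , b) → cong₂ _,_ (+-identityˡ a) (+-identityˡ b))
                 , (λ (a , b) → cong₂ _,_ (+-identityʳ a) (+-identityʳ b))
      }
    ; comm = λ (a , b) (c , d) → cong₂ _,_ (+-comm a c) (+-comm b d)
    }
  ; *-isCommutativeMonoid = record
    { isMonoid = record
      { isSemigroup = record
        { isMagma = record { isEquivalence = isEquivalence ; ∙-cong = cong₂ _⊗_ }
        ; assoc = λ (a , b) (c , d) (e , f) → cong₂ _,_
            (solve 6 (λ a b c d e f →
               (a :* c :- b :* d) :* e :- (a :* d :+ b :* c) :* f
               := a :* (c :* e :- d :* f) :- b :* (c :* f :+ d :* e)) refl a b c d e f)
            (solve 6 (λ a b c d e f →
               (a :* c :- b :* d) :* f :+ (a :* d :+ b :* c) :* e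
               := a :* (c :* f :+ d :* e) :+ b :* (c :* e :- d :* f)) refl a b c d e f)
        }
      ; identity = (λ (a , b) → cong₂ _,_
            (solve 2 (λ a b → con 1ℚ :* a :- con 0ℚ :* b := a) refl a b)
            (solve 2 (λ a b → con 1ℚ :* b :+ con 0ℚ :* a := b) refl a b))
                 , (λ (a , b) → cong₂ _,_
            (solve 2 (λ a b → a :* con 1ℚ :- b :* con 0ℚ := a) refl a b)
            (solve 2 (λ a b → a :* con 0ℚ :+ b :* con 1ℚ := b) refl a b))
      }
    ; comm = λ (a , b) (c , d) → cong₂ _,_
        (solve 4 (λ a b c d → a :* c :- b :* d := c :* a :- d :* b) refl a b c d)
        (solve 4 (λ a b c d → a :* d :+ b :* c := c :* b :+ d :* a) refl a b c d)
    }
  ; distribʳ = λ (e , f) (a , b) (c , d) → cong₂ _,_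
      (solve 6 (λ a b c d e f → (a :+ c) :* e :- (b :+ d) :* f
         := (a :* e :- b :* f) :+ (c :* e :- d :* f)) refl a b c d e f)
      (solve 6 (λ a b c d e f → (a :+ c) :* f :+ (b :+ d) :* e
         := (a :* f :+ b :* e) :+ (c :* f :+ d :* e)) refl a b c d e f)
  ; zeroˡ = λ (a , b) → cong₂ _,_
      (solve 2 (λ a b → con 0ℚ :* a :- con 0ℚ :* b := con 0ℚ) refl a b)
      (solve 2 (λ a b → con 0ℚ :* b :+ con 0ℚ :* a := con 0ℚ) refl a b)
  }

module ConvQ = Convolution ℚ-isCommutativeSemiring
module ConvC = Convolution ℚ[i]-isCommutativeSemiring

fromNat≡natℚ : ∀ n → ConvQ.fromNat n ≡ natℚ n
fromNat≡natℚ zero    = refl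
fromNat≡natℚ (suc n) = cong (_+ 1ℚ) (fromNat≡natℚ n)

fromNat≡natℚ[i] : ∀ n → ConvC.fromNat n ≡ (natℚ n , 0ℚ)
fromNat≡natℚ[i] zero    = refl
fromNat≡natℚ[i] (suc n) = cong (_⊕ (1ℚ , 0ℚ)) (fromNat≡natℚ[i] n)

natℚ-*-1/suc : ∀ k → natℚ (suc k) * 1/suc k ≡ 1ℚ
natℚ-*-1/suc k = trans (cong (λ j → natℚ (suc k) * 1/suc j) (sym (ℕ.+-identityʳ k))) (natℚ-1/suc k 0)

1/suc-*-natℚ : ∀ k → 1/suc k * natℚ (suc k) ≡ 1ℚ
1/suc-*-natℚ k = trans (*-comm (1/suc k) (natℚ (suc k))) (natℚ-*-1/suc k)

abstract
  1/suc-inverseQ : ∀ k → 1/suc k * ConvQ.fromNat (suc k) ≡ 1ℚ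
  1/suc-inverseQ k = trans (cong (1/suc k *_) (fromNat≡natℚ (suc k))) (1/suc-*-natℚ k)

  1/suc-inverseC : ∀ k → (1/suc k , 0ℚ) ⊗ ConvC.fromNat (suc k) ≡ (1ℚ , 0ℚ)
  1/suc-inverseC k = trans (cong ((1/suc k , 0ℚ) ⊗_) (fromNat≡natℚ[i] (suc k))) (cong₂ _,_
    (trans (solve 2 (λ r n → r :* n :- con 0ℚ :* con 0ℚ := r :* n) refl (1/suc k) (natℚ (suc k)))
           (1/suc-*-natℚ k))
    (solve 2 (λ r n → r :* con 0ℚ :+ con 0ℚ :* n := con 0ℚ) refl (1/suc k) (natℚ (suc k))))

  natℚ-cancel : ∀ k x → natℚ (suc k) * (1/suc k * x) ≡ x
  natℚ-cancel k x = trans (sym (*-assoc (natℚ (suc k)) (1/suc k) x))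
    (trans (cong (_* x) (natℚ-*-1/suc k)) (*-identityˡ x))

  expTerm-isExp : ∀ z → ConvC.IsExp z (expTerm z)
  expTerm-isExp z = record
    { exp-0 = refl
    ; ∂-exp = λ k → trans (cong (_⊗ expTerm z (suc k)) (fromNat≡natℚ[i] (suc k)))
        (lem k (z ⊗ expTerm z k))
    }
    where
    lem : ∀ k y → (natℚ (suc k) , 0ℚ) ⊗ (1/suc k • y) ≡ y
    lem k (y₁ , y₂) = cong₂ _,_
      (trans (solve 3 (λ n r₁ r₂ → n :* r₁ :- con 0ℚ :* r₂ := n :* r₁) refl
               (natℚ (suc k)) (1/suc k * y₁) (1/suc k * y₂)) (natℚ-cancel k y₁))
      (trans (solve 3 (λ n r₁ r₂ → n :* r₂ :+ con 0ℚ :* r₁ := n :* r₂) refl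
               (natℚ (suc k)) (1/suc k * y₁) (1/suc k * y₂)) (natℚ-cancel k y₂))

  expSum≡Σ< : ∀ n z → expSum n z ≡ ConvC.Σ< n (expTerm z)
  expSum≡Σ< zero    z = refl
  expSum≡Σ< (suc n) z = cong (_⊕ expTerm z n) (expSum≡Σ< n z)

abstract
  split-lemma : ∀ x s u v w → (x ⊕ s) ⊗ u ⊖ (x ⊗ v ⊕ w) ≡ x ⊗ (u ⊖ v) ⊕ (s ⊗ u ⊖ w)
  split-lemma (x₁ , x₂) (s₁ , s₂) (u₁ , u₂) (v₁ , v₂) (w₁ , w₂) = cong₂ _,_
    (solve 9 (λ x₁ x₂ s₁ s₂ u₁ u₂ v₁ v₂ w → ((x₁ :+ s₁) :* u₁ :- (x₂ :+ s₂) :* u₂) :- ((x₁ :* v₁ :- x₂ :* v₂) :+ w)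
      := (x₁ :* (u₁ :- v₁) :- x₂ :* (u₂ :- v₂)) :+ ((s₁ :* u₁ :- s₂ :* u₂) :- w)) refl
      x₁ x₂ s₁ s₂ u₁ u₂ v₁ v₂ w₁)
    (solve 9 (λ x₁ x₂ s₁ s₂ u₁ u₂ v₁ v₂ w → ((x₁ :+ s₁) :* u₂ :+ (x₂ :+ s₂) :* u₁) :- ((x₁ :* v₂ :+ x₂ :* v₁) :+ w)
      := (x₁ :* (u₂ :- v₂) :+ x₂ :* (u₁ :- v₁)) :+ ((s₁ :* u₂ :+ s₂ :* u₁) :- w)) refl
      x₁ x₂ s₁ s₂ u₁ u₂ v₁ v₂ w₂)

module Majorant where
  open ConvQ using (Σ<; conv)
  open ConvC using () renaming (Σ< to Σ<ᶜ; conv to convᶜ)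

  abstract
    Σ<-nonneg : ∀ n f → (∀ k → 0ℚ ≤ f k) → 0ℚ ≤ Σ< n f
    Σ<-nonneg zero    f h = ≤-refl
    Σ<-nonneg (suc n) f h = 0≤+ (Σ<-nonneg n f h) (h n)

    Σ<-mono : ∀ {m n} f → (∀ k → 0ℚ ≤ f k) → m ℕ.≤ n → Σ< m f ≤ Σ< n f
    Σ<-mono {n = n} f h z≤n = Σ<-nonneg n f h
    Σ<-mono f h (s≤s {m} {n} m≤n) = subst₂ _≤_ (sym (ConvQ.Σ<-head m f)) (sym (ConvQ.Σ<-head n f))
      (+-monoʳ-≤ (f 0) (Σ<-mono (f ∘ suc) (h ∘ suc) m≤n))

    conv-nonneg : ∀ f g → (∀ k → 0ℚ ≤ f k) → (∀ k → 0ℚ ≤ g k) → ∀ m → 0ℚ ≤ conv f g m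
    conv-nonneg f g hf hg zero    = 0≤* (hf 0) (hg 0)
    conv-nonneg f g hf hg (suc m) = 0≤+ (0≤* (hf 0) (hg (suc m))) (conv-nonneg (f ∘ suc) g (hf ∘ suc) hg m)

    -- The rectangle j < n, k < N lies in the triangle j + k < n + N.
    Σ<*Σ<≤Σ<-conv : ∀ f g → (∀ k → 0ℚ ≤ f k) → (∀ k → 0ℚ ≤ g k) → ∀ n N →
      Σ< n f * Σ< N g ≤ Σ< (n ℕ.+ N) (conv f g)
    Σ<*Σ<≤Σ<-conv f g hf hg zero N = ≤-trans (≤-reflexive (*-zeroˡ (Σ< N g)))
      (Σ<-nonneg N (conv f g) (conv-nonneg f g hf hg))
    Σ<*Σ<≤Σ<-conv f g hf hg (suc n) N = ≤-trans
      (≤-reflexive (trans (cong (_* Σ< N g) (ConvQ.Σ<-head n f))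
                          (*-distribʳ-+ (Σ< N g) (f 0) (Σ< n (f ∘ suc)))))
      (≤-trans
        (+-mono-≤ (mulˡ-≤ (hf 0) (Σ<-mono g hg (ℕ.m≤n+m N (suc n))))
                  (Σ<*Σ<≤Σ<-conv (f ∘ suc) g (hf ∘ suc) hg n N))
        (≤-reflexive (sym (ConvQ.Σ<-conv-head f g (n ℕ.+ N)))))

    Σ<-tail-bound′ : (f : ℕ → ℚ[i]) (a : ℕ → ℚ) → (∀ k → ‖ f k ‖ ≤ a k) → ∀ {m n} → m ℕ.≤′ n →
      ‖ Σ<ᶜ n f ⊖ Σ<ᶜ m f ‖ ≤ Σ< n a - Σ< m a
    Σ<-tail-bound′ f a h {n = n} ℕ.≤′-refl = subst₂
      (λ z q → ‖ z ‖ ≤ q)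
      (sym (cong₂ _,_ (+-inverseʳ (proj₁ (Σ<ᶜ n f))) (+-inverseʳ (proj₂ (Σ<ᶜ n f)))))
      (sym (+-inverseʳ (Σ< n a)))
      ≤-refl
    Σ<-tail-bound′ f a h {m} {suc n} (ℕ.≤′-step m≤n) = subst₂
      (λ z q → ‖ z ‖ ≤ q)
      (cong₂ _,_
        (lem (proj₁ (Σ<ᶜ n f)) (proj₁ (Σ<ᶜ m f)) (proj₁ (f n)))
        (lem (proj₂ (Σ<ᶜ n f)) (proj₂ (Σ<ᶜ m f)) (proj₂ (f n))))
      (lem (Σ< n a) (Σ< m a) (a n))
      (≤-trans (‖⊕‖ (Σ<ᶜ n f ⊖ Σ<ᶜ m f) (f n)) (+-mono-≤ (Σ<-tail-bound′ f a h m≤n) (h n)))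
      where
      lem : ∀ x z y → (x - z) + y ≡ (x + y) - z
      lem = solve 3 (λ x z y → (x :- z) :+ y := (x :+ y) :- z) refl

    Σ<-tail-bound : (f : ℕ → ℚ[i]) (a : ℕ → ℚ) → (∀ k → ‖ f k ‖ ≤ a k) → ∀ {m n} → m ℕ.≤ n →
      ‖ Σ<ᶜ n f ⊖ Σ<ᶜ m f ‖ ≤ Σ< n a - Σ< m a
    Σ<-tail-bound f a h m≤n = Σ<-tail-bound′ f a h (ℕ.≤⇒≤′ m≤n)

    -- ∑_{j<n} f j * ∑_{k<N} g k - ∑_{j+k<n} f j * g k is a sum of products f j * g k
    -- and the right-hand side is the same sum with f and g replaced by a and b.
    Σ<-conv-bound : (f g : ℕ → ℚ[i]) (a b : ℕ → ℚ) → (∀ k → ‖ f k ‖ ≤ a k) → (∀ k → ‖ g k ‖ ≤ b k) →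
      ∀ {n N} → n ℕ.≤ N →
      ‖ Σ<ᶜ n f ⊗ Σ<ᶜ N g ⊖ Σ<ᶜ n (convᶜ f g) ‖ ≤ Σ< n a * Σ< N b - Σ< n (conv a b)
    Σ<-conv-bound f g a b hf hg {zero} {N} _ = subst₂
      (λ z q → ‖ z ‖ ≤ q) (sym eqᶜ) eq ≤-refl
      where
      eqᶜ : Σ<ᶜ 0 f ⊗ Σ<ᶜ N g ⊖ Σ<ᶜ 0 (convᶜ f g) ≡ (0ℚ , 0ℚ)
      eqᶜ = cong₂ _,_
        (solve 2 (λ x y → (con 0ℚ :* x :- con 0ℚ :* y) :- con 0ℚ := con 0ℚ) refl
          (proj₁ (Σ<ᶜ N g)) (proj₂ (Σ<ᶜ N g)))
        (solve 2 (λ x y → (con 0ℚ :* y :+ con 0ℚ :* x) :- con 0ℚ := con 0ℚ) refl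
          (proj₁ (Σ<ᶜ N g)) (proj₂ (Σ<ᶜ N g)))
      eq : 0ℚ ≡ 0ℚ * Σ< N b - 0ℚ
      eq = solve 1 (λ x → con 0ℚ := con 0ℚ :* x :- con 0ℚ) refl (Σ< N b)
    Σ<-conv-bound f g a b hf hg {suc n} {N} n<N = subst
      (λ z → ‖ z ‖ ≤ Σ< (suc n) a * Σ< N b - Σ< (suc n) (conv a b)) (sym eqᶜ)
      (≤-trans (‖⊕‖ (f 0 ⊗ (Σ<ᶜ N g ⊖ Σ<ᶜ (suc n) g)) (Σ<ᶜ n (f ∘ suc) ⊗ Σ<ᶜ N g ⊖ Σ<ᶜ n (convᶜ (f ∘ suc) g)))
        (≤-trans (+-mono-≤ head≤ rest≤) (≤-reflexive (sym eq))))
      where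
      tail≤ : ‖ Σ<ᶜ N g ⊖ Σ<ᶜ (suc n) g ‖ ≤ Σ< N b - Σ< (suc n) b
      tail≤ = Σ<-tail-bound g b hg n<N
      0≤tail : 0ℚ ≤ Σ< N b - Σ< (suc n) b
      0≤tail = ≤-trans (0≤‖‖ (Σ<ᶜ N g ⊖ Σ<ᶜ (suc n) g)) tail≤
      head≤ : ‖ f 0 ⊗ (Σ<ᶜ N g ⊖ Σ<ᶜ (suc n) g) ‖ ≤ a 0 * (Σ< N b - Σ< (suc n) b)
      head≤ = ≤-trans (‖⊗‖ (f 0) (Σ<ᶜ N g ⊖ Σ<ᶜ (suc n) g)) (mul-≤ (0≤‖‖ (f 0)) 0≤tail (hf 0) tail≤)
      rest≤ : ‖ Σ<ᶜ n (f ∘ suc) ⊗ Σ<ᶜ N g ⊖ Σ<ᶜ n (convᶜ (f ∘ suc) g) ‖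
            ≤ Σ< n (a ∘ suc) * Σ< N b - Σ< n (conv (a ∘ suc) b)
      -- Dropping the first coefficient of `f` lowers `n` but not `N`; this is why the estimate is
      -- proved for all n ≤ N although it is applied with n = N.
      rest≤ = Σ<-conv-bound (f ∘ suc) g (a ∘ suc) b (hf ∘ suc) hg (ℕ.<⇒≤ n<N)
      eq : Σ< (suc n) a * Σ< N b - Σ< (suc n) (conv a b)
         ≡ a 0 * (Σ< N b - Σ< (suc n) b) + (Σ< n (a ∘ suc) * Σ< N b - Σ< n (conv (a ∘ suc) b))
      eq = trans (cong₂ (λ x y → x * Σ< N b - y) (ConvQ.Σ<-head n a) (ConvQ.Σ<-conv-head a b n))
        (solve 5 (λ x s u v w → (x :+ s) :* u :- (x :* v :+ w) := x :* (u :- v) :+ (s :* u :- w)) refl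
          (a 0) (Σ< n (a ∘ suc)) (Σ< N b) (Σ< (suc n) b) (Σ< n (conv (a ∘ suc) b)))
      eqᶜ : Σ<ᶜ (suc n) f ⊗ Σ<ᶜ N g ⊖ Σ<ᶜ (suc n) (convᶜ f g)
          ≡ f 0 ⊗ (Σ<ᶜ N g ⊖ Σ<ᶜ (suc n) g) ⊕ (Σ<ᶜ n (f ∘ suc) ⊗ Σ<ᶜ N g ⊖ Σ<ᶜ n (convᶜ (f ∘ suc) g))
      eqᶜ = trans (cong₂ (λ x y → x ⊗ Σ<ᶜ N g ⊖ y) (ConvC.Σ<-head n f) (ConvC.Σ<-conv-head f g n))
        (split-lemma (f 0) (Σ<ᶜ n (f ∘ suc)) (Σ<ᶜ N g) (Σ<ᶜ (suc n) g) (Σ<ᶜ n (convᶜ (f ∘ suc) g)))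

Σ<-congQ : ∀ n {f g} → (∀ k → f k ≡ g k) → ConvQ.Σ< n f ≡ ConvQ.Σ< n g
Σ<-congQ zero    h = refl
Σ<-congQ (suc n) h = cong₂ _+_ (Σ<-congQ n h) (h n)

Σ<-congC : ∀ n {f g} → (∀ k → f k ≡ g k) → ConvC.Σ< n f ≡ ConvC.Σ< n g
Σ<-congC zero    h = refl
Σ<-congC (suc n) h = cong₂ _⊕_ (Σ<-congC n h) (h n)

module Majorised (B : ℚ) (0<B : 0ℚ < B) where
  open ExpBounds B 0<B public using (a; 0≤a; c; C; term-bound; sum-lip)

  S : ℕ → ℚ
  S n = ConvQ.Σ< n a

  -- The sums `S` are the approximations to this real, so they are bounded and Cauchy.
  exp-B : ℝ
  exp-B = Re (exp (fromℝ (fromℚ B)))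

  abstract
    expTerm-real : ∀ k → expTerm (B , 0ℚ) k ≡ (a k , 0ℚ)
    expTerm-real zero    = refl
    expTerm-real (suc k) = trans
      (cong (λ z → 1/suc k • ((B , 0ℚ) ⊗ z)) (expTerm-real k))
      (cong₂ _,_
        (solve 3 (λ r b x → r :* (b :* x :- con 0ℚ :* con 0ℚ) := r :* (b :* x)) refl (1/suc k) B (a k))
        (solve 3 (λ r b x → r :* (b :* con 0ℚ :+ con 0ℚ :* x) := con 0ℚ) refl (1/suc k) B (a k)))

    expSum-real : ∀ n → proj₁ (expSum n (B , 0ℚ)) ≡ S n
    expSum-real zero    = refl
    expSum-real (suc n) = cong₂ _+_ (expSum-real n) (cong proj₁ (expTerm-real n))

    a-isExp : ConvQ.IsExp B a
    a-isExp = record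
      { exp-0 = refl
      ; ∂-exp = λ k → trans (cong (_* a (suc k)) (fromNat≡natℚ (suc k))) (natℚ-cancel k (B * a k))
      }

    -- The Lipschitz constant of z ^ (k + 1) / (k + 1) ! on the ball of radius `B` is the bound B ^
    -- k / k ! of its derivative. Hence the constants `C` are partial sums of the series for e ^ B,
    -- bounded independently of `n`.
    c-suc : ∀ k → c (suc k) ≡ a k
    c-suc zero    = solve 1 (λ b → con (1/suc 0) :* (b :* con 0ℚ :+ con 1ℚ) := con 1ℚ) refl B
    c-suc (suc k) = trans
      (cong (λ x → 1/suc (suc k) * (B * x + a (suc k))) (c-suc k))
      (trans (cong (λ x → 1/suc (suc k) * (x + a (suc k))) (sym (natℚ-cancel k (B * a k))))
        (trans (solve 3 (λ r n x → r :* (n :* x :+ x) := (n :+ con 1ℚ) :* (r :* x)) refl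
                 (1/suc (suc k)) (natℚ (suc k)) (a (suc k)))
          (natℚ-cancel (suc k) (a (suc k)))))

    C-suc : ∀ n → C (suc n) ≡ S n
    C-suc zero    = refl
    C-suc (suc n) = cong₂ _+_ (C-suc n) (c-suc n)

    C-bounded : ∃ λ M → 0ℚ < M × (∀ n → C n ≤ M)
    C-bounded = let M , 0<M , h = bounded exp-B in M , 0<M , λ
      { zero    → <⇒≤ 0<M
      ; (suc n) → subst (_≤ M) (trans (expSum-real n) (sym (C-suc n)))
                    (≤-trans (x≤∣x∣ (seq exp-B n)) (h n))
      }

    S-null : Null λ n → S (n ℕ.+ n) - S n
    S-null = null-≡ (λ n → cong₂ _-_ (expSum-real (n ℕ.+ n)) (expSum-real n))
      (null-modulus exp-B (λ n → n ℕ.+ n) (λ n → ℕ.m≤m+n n n))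

abstract
  -- The defect is at most S(n) ^ 2 - S₂(n), where S and S₂ are the sums for B and 2 B. Since the
  -- Cauchy square of the series for e ^ B is the series for e ^ (2 B), S(n) ^ 2 is at most S₂(2 n).
  expSum-+ : ∀ B (0<B : 0ℚ < B) (0<2B : 0ℚ < B + B) z w → ‖ z ‖ ≤ B → ‖ w ‖ ≤ B → ∀ n →
    ‖ expSum n z ⊗ expSum n w ⊖ expSum n (z ⊕ w) ‖
    ≤ Majorised.S (B + B) 0<2B (n ℕ.+ n) - Majorised.S (B + B) 0<2B n
  expSum-+ B 0<B 0<2B z w hz hw n = subst
    (λ x → ‖ x ‖ ≤ M₂.S (n ℕ.+ n) - M₂.S n)
    (sym (cong₂ _⊖_ (cong₂ _⊗_ (expSum≡Σ< n z) (expSum≡Σ< n w))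
      (trans (expSum≡Σ< n (z ⊕ w)) (Σ<-congC n λ k → sym (convC k)))))
    (≤-trans
      (Majorant.Σ<-conv-bound (expTerm z) (expTerm w) M.a M.a (M.term-bound z hz) (M.term-bound w hw)
        (ℕ.≤-refl {n}))
      (subst (λ x → M.S n * M.S n - x ≤ M₂.S (n ℕ.+ n) - M₂.S n) (sym (Σ<-congQ n convQ))
        (+-monoˡ-≤ (- M₂.S n)
          (subst (M.S n * M.S n ≤_) (Σ<-congQ (n ℕ.+ n) convQ)
            (Majorant.Σ<*Σ<≤Σ<-conv M.a M.a M.0≤a M.0≤a n n)))))
    where
    module M  = Majorised B 0<B
    module M₂ = Majorised (B + B) 0<2B
    convQ : ∀ k → ConvQ.conv M.a M.a k ≡ M₂.a k
    convQ = ConvQ.conv-exp 1/suc 1/suc-inverseQ M.a-isExp M.a-isExp M₂.a-isExp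
    convC : ∀ k → ConvC.conv (expTerm z) (expTerm w) k ≡ expTerm (z ⊕ w) k
    convC = ConvC.conv-exp (λ k → 1/suc k , 0ℚ) 1/suc-inverseC
      (expTerm-isExp z) (expTerm-isExp w) (expTerm-isExp (z ⊕ w))

  approx-bounded : ∀ z → ∃ λ B → 0ℚ < B × (∀ n → ‖ approx z n ‖ ≤ B)
  approx-bounded z = let B₁ , 0<B₁ , h₁ = bounded (Re z) ; B₂ , 0<B₂ , h₂ = bounded (Im z) in
    B₁ + B₂ , <-≤-trans 0<B₁ (x≤x+p (<⇒≤ 0<B₂)) , λ n → +-mono-≤ (h₁ n) (h₂ n)

  common-bound : ∀ z w → ∃ λ B → 0ℚ < B × (∀ n → ‖ approx z n ‖ ≤ B) × (∀ n → ‖ approx w n ‖ ≤ B)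
  common-bound z w = let B₁ , 0<B₁ , h₁ = approx-bounded z ; B₂ , 0<B₂ , h₂ = approx-bounded w in
    B₁ + B₂ , <-≤-trans 0<B₁ (x≤x+p (<⇒≤ 0<B₂)) ,
    (λ n → ≤-trans (h₁ n) (x≤x+p (<⇒≤ 0<B₂))) , (λ n → ≤-trans (h₂ n) (x≤p+x (<⇒≤ 0<B₁)))

infix 4 _≃ᶜ_

record _≃ᶜ_ (z w : ℂ) : Set where
  constructor mk≃ᶜ
  field
    Re-≃ : Re z ≃ Re w
    Im-≃ : Im z ≃ Im w

open _≃ᶜ_ public

abstract
  ‖‖-null⇒≃ᶜ : ∀ z w g → Null g → (∀ n → ‖ approx z n ⊖ approx w n ‖ ≤ g n) → z ≃ᶜ w
  ‖‖-null⇒≃ᶜ z w g G h = mk≃ᶜ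
    (≈⇒≃ (null-dominated G λ n → ≤-trans (re≤‖‖ (approx z n ⊖ approx w n)) (≤-trans (h n) (x≤∣x∣ (g n)))))
    (≈⇒≃ (null-dominated G λ n → ≤-trans (im≤‖‖ (approx z n ⊖ approx w n)) (≤-trans (h n) (x≤∣x∣ (g n)))))

  exp-+ : ∀ z w → exp z *ᶜ exp w ≃ᶜ exp (z +ᶜ w)
  exp-+ z w = let B , 0<B , hz , hw = common-bound z w
                  0<2B = <-≤-trans 0<B (x≤x+p (<⇒≤ 0<B)) in
    ‖‖-null⇒≃ᶜ (exp z *ᶜ exp w) (exp (z +ᶜ w)) _ (Majorised.S-null (B + B) 0<2B)
      (λ n → expSum-+ B 0<B 0<2B (approx z n) (approx w n) (hz n) (hw n) n)

  -- The value of `exp` is computed from representatives at a growing number of terms, so the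
  -- Lipschitz constant of `expSum n` has to be bounded uniformly in `n`.
  exp-cong : ∀ {z w} → z ≃ᶜ w → exp z ≃ᶜ exp w
  exp-cong {z} {w} (mk≃ᶜ (≈⇒≃ p) (≈⇒≃ q)) =
    let B , 0<B , hz , hw = common-bound z w
        open Majorised B 0<B
        M , 0<M , C≤M = C-bounded
        d : ℕ → ℚ
        d n = ‖ approx z n ⊖ approx w n ‖
        d-null : Null d
        d-null = null-+ (null-dominated p λ n → ≤-reflexive (∣∣p∣∣≡∣p∣ (seq (Re z) n - seq (Re w) n)))
                        (null-dominated q λ n → ≤-reflexive (∣∣p∣∣≡∣p∣ (seq (Im z) n - seq (Im w) n)))
    in ‖‖-null⇒≃ᶜ (exp z) (exp w) (λ n → M * d n)
      (null-bounded-* {λ _ → M} {d} 0<M (always λ _ → ≤-reflexive (0≤p⇒∣p∣≡p (<⇒≤ 0<M))) d-null)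
      (λ n → ≤-trans (sum-lip (approx z n) (approx w n) (hz n) (hw n) n)
                     (mulʳ-≤ (0≤‖‖ (approx z n ⊖ approx w n)) (C≤M n)))

-- Real exponentials and logarithms

double : ℕ → ℕ
double zero    = zero
double (suc n) = suc (suc (double n))

double≡*2 : ∀ n → double n ≡ n ℕ.* 2
double≡*2 zero    = refl
double≡*2 (suc n) = cong (λ k → suc (suc k)) (double≡*2 n)

n≤double : ∀ n → n ℕ.≤ double n
n≤double zero    = z≤n
n≤double (suc n) = s≤s (ℕ.m≤n⇒m≤1+n (n≤double n))

E : ℝ → ℝ
E x = Re (exp (fromℝ x))

abstract
  0≤p*p : ∀ p → 0ℚ ≤ p * p
  0≤p*p p = subst (0ℚ ≤_) (lem p) (0≤* (0≤∣p∣ p) (0≤∣p∣ p))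
    where
    lem : ∀ p → ∣ p ∣ * ∣ p ∣ ≡ p * p
    lem p with ∣p∣≡p∨∣p∣≡-p p
    ... | inj₁ e = cong₂ _*_ e e
    ... | inj₂ e = trans (cong₂ _*_ e e) (solve 1 (λ p → (:- p) :* (:- p) := p :* p) refl p)

  expTerm-im : ∀ x k → proj₂ (expTerm (x , 0ℚ) k) ≡ 0ℚ
  expTerm-im x zero    = refl
  expTerm-im x (suc k) = trans
    (cong (λ i → 1/suc k * (x * i + 0ℚ * proj₁ (expTerm (x , 0ℚ) k))) (expTerm-im x k))
    (solve 3 (λ r x p → r :* (x :* con 0ℚ :+ con 0ℚ :* p) := con 0ℚ) refl
      (1/suc k) x (proj₁ (expTerm (x , 0ℚ) k)))

  expSum-im : ∀ x n → proj₂ (expSum n (x , 0ℚ)) ≡ 0ℚ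
  expSum-im x zero    = refl
  expSum-im x (suc n) = cong₂ _+_ (expSum-im x n) (expTerm-im x n)

  expTerm-nonneg : ∀ x → 0ℚ ≤ x → ∀ k → 0ℚ ≤ proj₁ (expTerm (x , 0ℚ) k)
  expTerm-nonneg x h zero    = 0≤1
  expTerm-nonneg x h (suc k) = subst (0ℚ ≤_)
    (solve 4 (λ r x p i → r :* (x :* p) := r :* (x :* p :- con 0ℚ :* i)) refl
      (1/suc k) x (proj₁ (expTerm (x , 0ℚ) k)) (proj₂ (expTerm (x , 0ℚ) k)))
    (0≤* (0≤1/suc k) (0≤* h (expTerm-nonneg x h k)))

  1+x≤expSum : ∀ x → 0ℚ ≤ x → ∀ n → 1ℚ + x ≤ proj₁ (expSum (suc (suc n)) (x , 0ℚ))
  1+x≤expSum x h zero    = ≤-reflexive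
    (solve 1 (λ x → con 1ℚ :+ x
      := (con 0ℚ :+ con 1ℚ) :+ con (1/suc 0) :* (x :* con 1ℚ :- con 0ℚ :* con 0ℚ)) refl x)
  1+x≤expSum x h (suc n) = ≤-trans (1+x≤expSum x h n) (x≤x+p (expTerm-nonneg x h (suc (suc n))))

  expSum-0 : ∀ n → proj₁ (expSum (suc n) (0ℚ , 0ℚ)) ≡ 1ℚ
  expSum-0 zero    = refl
  expSum-0 (suc n) = cong₂ _+_ (expSum-0 n)
    (solve 3 (λ r p i → r :* (con 0ℚ :* p :- con 0ℚ :* i) := con 0ℚ) refl
      (1/suc n) (proj₁ (expTerm (0ℚ , 0ℚ) n)) (proj₂ (expTerm (0ℚ , 0ℚ) n)))

  E-0 : E 0ᴿ ≃ 1ᴿ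
  -- Index 0 is left out because the sum with no terms is 0, not 1.
  E-0 = ≈⇒≃ λ ε 0<ε → 1 , λ { (suc n) _ →
    ≤-trans (≤-reflexive (cong (λ x → ∣ x - 1ℚ ∣) (expSum-0 n))) (<⇒≤ 0<ε) }

  E-cong : ∀ {x y} → x ≃ y → E x ≃ E y
  E-cong {x} {y} p = Re-≃ (exp-cong {fromℝ x} {fromℝ y} (mk≃ᶜ p (≃-refl {0ᴿ})))

  minus-zero : ∀ a b i j → i ≡ 0ℚ → j ≡ 0ℚ → a * b ≡ a * b - i * j
  minus-zero a b _ _ refl refl = solve 2 (λ a b → a :* b := a :* b :- con 0ℚ :* con 0ℚ) refl a b

  E-+ : ∀ x y → E x *ᴿ E y ≃ E (x +ᴿ y)
  E-+ x y = ≃-trans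
    (≗⇒≃ {E x *ᴿ E y} {Re (exp (fromℝ x) *ᶜ exp (fromℝ y))} λ n →
      minus-zero (seq (E x) n) (seq (E y) n)
        (proj₂ (expSum n (seq x n , 0ℚ))) (proj₂ (expSum n (seq y n , 0ℚ)))
        (expSum-im (seq x n) n) (expSum-im (seq y n) n))
    (≃-trans
      (Re-≃ (exp-+ (fromℝ x) (fromℝ y)))
      (Re-≃ (exp-cong {fromℝ x +ᶜ fromℝ y} {fromℝ (x +ᴿ y)}
        (mk≃ᶜ (≗⇒≃ λ _ → refl) (≗⇒≃ λ _ → refl)))))

  E-inverse : ∀ x → E (-ᴿ x) *ᴿ E x ≃ 1ᴿ
  E-inverse x = ≃-trans (E-+ (-ᴿ x) x)
    (≃-trans (E-cong {(-ᴿ x) +ᴿ x} {0ᴿ} (≗⇒≃ λ n → +-inverseˡ (seq x n))) E-0)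

  -- All terms of the series are nonnegative where the approximation to `x` is, and from index 2 on
  -- the constant and the linear term are both present.
  1+q≼E : ∀ x q → 0ℚ ≤ q → (Eventually λ n → q ≤ seq x n) → fromℚ (1ℚ + q) ≼ E x
  1+q≼E x q 0≤q (N , h) = ≼-eventually {fromℚ (1ℚ + q)} {E x} (2 ℕ.+ N , λ
    { (suc (suc n)) (s≤s (s≤s N≤n)) →
      let q≤x = h (suc (suc n)) (ℕ.≤-trans N≤n (ℕ.≤-trans (ℕ.n≤1+n n) (ℕ.n≤1+n (suc n)))) in
      ≤-trans (+-monoʳ-≤ 1ℚ q≤x)
        (1+x≤expSum (seq x (suc (suc n))) (≤-trans 0≤q q≤x) n) })

  -- u = u (u w) = u ^ 2 w, a product of nonnegative reals.
  inverse-nonneg : ∀ {u w} → 0ᴿ ≼ w → u *ᴿ w ≃ 1ᴿ → 0ᴿ ≼ u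
  inverse-nonneg {u} {w} 0≼w uw≃1 = ≼-trans
    (0≼* {u *ᴿ u} {w} (≼-everywhere {0ᴿ} {u *ᴿ u} λ n → 0≤p*p (seq u n)) 0≼w)
    (≃⇒≼ (≃-trans
      (≗⇒≃ {(u *ᴿ u) *ᴿ w} {u *ᴿ (u *ᴿ w)} λ n → *-assoc (seq u n) (seq u n) (seq w n))
      (≃-trans (*ᴿ-cong {u} {u} {u *ᴿ w} {1ᴿ} (≃-refl {u}) uw≃1)
        (≗⇒≃ {u *ᴿ 1ᴿ} {u} λ n → *-identityʳ (seq u n)))))

  -- If r ≥ e + 3 δ, then r ^ 2 - e ^ 2 - δ ^ 2 ≥ 6 δ (e + δ) + 2 δ ^ 2 > 0, which explains the
  -- value 6 of `k`. A margin of 2 δ would only leave 4 δ (e + δ) - δ ^ 2.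
  sqrt-mono-ε : ∀ {r e δ} → 0ℚ < δ → 0ℚ ≤ e + δ → r * r ≤ e * e + δ * δ → r ≤ e + (δ + δ + δ)
  sqrt-mono-ε {r} {e} {δ} 0<δ 0≤e+δ h with ≤-total r (e + (δ + δ + δ))
  ... | inj₁ p = p
  ... | inj₂ p = ⊥-elim (<-irrefl {0ℚ} {0ℚ} refl (<-≤-trans (0<* 0<δ 0<δ) bad))
    where
    0≤δ : 0ℚ ≤ δ
    0≤δ = <⇒≤ 0<δ
    0≤m : 0ℚ ≤ e + (δ + δ + δ)
    0≤m = subst (0ℚ ≤_) (solve 2 (λ e d → e :+ d :+ (d :+ d) := e :+ (d :+ d :+ d)) refl e δ)
            (0≤+ 0≤e+δ (0≤+ 0≤δ 0≤δ))
    m²≤ : (e + (δ + δ + δ)) * (e + (δ + δ + δ)) ≤ e * e + δ * δ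
    m²≤ = ≤-trans (mul-≤ 0≤m (≤-trans 0≤m p) p p) h
    k : ℚ
    k = 1ℚ + 1ℚ + 1ℚ + 1ℚ + 1ℚ + 1ℚ
    0≤k : 0ℚ ≤ k * δ * (e + δ) + δ * δ
    0≤k = 0≤+ (0≤* (0≤* (0≤+ (0≤+ (0≤+ (0≤+ (0≤+ 0≤1 0≤1) 0≤1) 0≤1) 0≤1) 0≤1) 0≤δ) 0≤e+δ) (0≤* 0≤δ 0≤δ)
    bad : δ * δ ≤ 0ℚ
    bad = 0≤q-p⇒p≤q (≤-trans (0≤+ 0≤k (p≤q⇒0≤q-p m²≤)) (≤-reflexive (solve 2
      (λ e d → (con k :* d :* (e :+ d) :+ d :* d) :+ (e :* e :+ d :* d :- (e :+ (d :+ d :+ d)) :* (e :+ (d :+ d :+ d)))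
            := con 0ℚ :- d :* d) refl e δ)))

  third : ∀ {ε} → 0ℚ < ε → ∃ λ δ → 0ℚ < δ × δ + δ + δ ≡ ε
  third {ε} 0<ε = let δ , 0<δ , e = quotient {2ℚ + 1ℚ} {ε} (0<+3) 0<ε in
    δ , 0<δ , trans (solve 1 (λ d → d :+ d :+ d := con (2ℚ + 1ℚ) :* d) refl δ) e
    where
    0<+3 : 0ℚ < 2ℚ + 1ℚ
    0<+3 = <-≤-trans 0<2 (x≤x+p 0≤1)

  sqrt-mono : ∀ {r e} → 0ᴿ ≼ e → r *ᴿ r ≼ e *ᴿ e → r ≼ e
  sqrt-mono {r} {e} 0≼e h = ≼-by-ε {r} {e} λ ε 0<ε → let δ , 0<δ , eq = third 0<ε in
    eventually-zip (≼⇒eventually {0ᴿ} {e} 0≼e δ 0<δ)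
      (≼⇒eventually {r *ᴿ r} {e *ᴿ e} h (δ * δ) (0<* 0<δ 0<δ))
      λ n p q → subst (λ d → seq r n ≤ seq e n + d) eq (sqrt-mono-ε {seq r n} {seq e n} {δ} 0<δ p q)

-- The modulus of the complex exponential

conj : ℂ → ℂ
conj z = Re z +i (-ᴿ Im z)

abstract
  expTerm-conj : ∀ a b k → expTerm (a , - b) k ≡ (proj₁ (expTerm (a , b) k) , - proj₂ (expTerm (a , b) k))
  expTerm-conj a b zero    = refl
  expTerm-conj a b (suc k) = trans
    (cong (λ z → 1/suc k • ((a , - b) ⊗ z)) (expTerm-conj a b k))
    (cong₂ _,_
      (solve 5 (λ r a b p q → r :* (a :* p :- (:- b) :* (:- q)) := r :* (a :* p :- b :* q)) refl
        (1/suc k) a b (proj₁ (expTerm (a , b) k)) (proj₂ (expTerm (a , b) k)))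
      (solve 5 (λ r a b p q → r :* (a :* (:- q) :+ (:- b) :* p) := :- (r :* (a :* q :+ b :* p))) refl
        (1/suc k) a b (proj₁ (expTerm (a , b) k)) (proj₂ (expTerm (a , b) k))))

  expSum-conj : ∀ a b n → expSum n (a , - b) ≡ (proj₁ (expSum n (a , b)) , - proj₂ (expSum n (a , b)))
  expSum-conj a b zero    = refl
  expSum-conj a b (suc n) = trans (cong₂ _⊕_ (expSum-conj a b n) (expTerm-conj a b n))
    (cong (proj₁ (expSum (suc n) (a , b)) ,_) (sym (neg-distrib-+ (proj₂ (expSum n (a , b))) (proj₂ (expTerm (a , b) n)))))

  -- The left side is exp z times its conjugate. Conjugation commutes with the partial sums, and z
  -- plus its conjugate is 2 Re z.
  ∣exp∣² : ∀ z → Re (exp z) *ᴿ Re (exp z) +ᴿ Im (exp z) *ᴿ Im (exp z) ≃ E (Re z) *ᴿ E (Re z)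
  ∣exp∣² z = ≃-trans
    (≗⇒≃ {Re (exp z) *ᴿ Re (exp z) +ᴿ Im (exp z) *ᴿ Im (exp z)} {Re (exp z *ᶜ exp (conj z))} λ n → trans
      (solve 2 (λ r i → r :* r :+ i :* i := r :* r :- i :* (:- i)) refl (seq (Re (exp z)) n) (seq (Im (exp z)) n))
      (cong (λ (p , q) → seq (Re (exp z)) n * p - seq (Im (exp z)) n * q)
        (sym (expSum-conj (seq (Re z) n) (seq (Im z) n) n))))
    (≃-trans (Re-≃ (exp-+ z (conj z)))
      (≃-trans (Re-≃ (exp-cong {z +ᶜ conj z} {fromℝ (Re z +ᴿ Re z)}
          (mk≃ᶜ (≗⇒≃ λ _ → refl) (≗⇒≃ λ n → +-inverseʳ (seq (Im z) n)))))
        (≃-sym (E-+ (Re z) (Re z)))))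

infix 4 ∣_∣≼_

∣_∣≼_ : ℝ → ℝ → Set
∣ x ∣≼ y = x ≼ y × -ᴿ x ≼ y

abstract
  sum-of-squares≃⇒≼ : ∀ r i e → 0ᴿ ≼ e → r *ᴿ r +ᴿ i *ᴿ i ≃ e *ᴿ e → (∣ r ∣≼ e) × (∣ i ∣≼ e)
  sum-of-squares≃⇒≼ r i e 0≼e h =
      (sqrt-mono 0≼e r² , sqrt-mono 0≼e (≼-trans (≃⇒≼ (neg² r)) r²))
    , (sqrt-mono 0≼e i² , sqrt-mono 0≼e (≼-trans (≃⇒≼ (neg² i)) i²))
    where
    neg² : ∀ x → (-ᴿ x) *ᴿ (-ᴿ x) ≃ x *ᴿ x
    neg² x = ≗⇒≃ λ n → solve 1 (λ x → (:- x) :* (:- x) := x :* x) refl (seq x n)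
    r² : r *ᴿ r ≼ e *ᴿ e
    r² = ≼-trans {r *ᴿ r} {r *ᴿ r +ᴿ i *ᴿ i} {e *ᴿ e} (≼-everywhere λ n → x≤x+p (0≤p*p (seq i n))) (≃⇒≼ h)
    i² : i *ᴿ i ≼ e *ᴿ e
    i² = ≼-trans {i *ᴿ i} {r *ᴿ r +ᴿ i *ᴿ i} {e *ᴿ e} (≼-everywhere λ n → x≤p+x (0≤p*p (seq r n))) (≃⇒≼ h)

  ∣exp∣≼ : ∀ z → 0ᴿ ≼ E (Re z) → (∣ Re (exp z) ∣≼ E (Re z)) × (∣ Im (exp z) ∣≼ E (Re z))
  ∣exp∣≼ z 0≼E = sum-of-squares≃⇒≼ (Re (exp z)) (Im (exp z)) (E (Re z)) 0≼E (∣exp∣² z)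

  -- Increments of the logarithm and its value at 2 n

  -- The part of the left Riemann sum that belongs to [j + 1, j + 2] is at least the minimum of 1 /
  -- x there, whatever the mesh.
  logSeq-step : ∀ j m → logSeq (suc j) m + 1/suc (suc j) ≤ logSeq (suc (suc j)) m
  logSeq-step j m = ≤-trans
    (+-monoʳ-≤ (harmonic m (j ℕ.* suc m)) (block-lower m j))
    (≤-reflexive (trans (sym (harmonic-+ m (j ℕ.* suc m) (suc m)))
      (cong (harmonic m) (ℕ.+-comm (j ℕ.* suc m) (suc m)))))

  -- With n = j + 1, the Riemann sum for log (2 n) is split at 2. The part on [1, 2] is the sum for
  -- log 2; the substitution x = 2 y turns the rest into the sum for log n with half the mesh, that
  -- is, with index 2 m + 1 instead of m.
  log-double : ∀ j → log (suc (suc (double j))) ≃ log 2 +ᴿ log (suc j)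
  log-double j = ≃-trans
    (≗⇒≃ {log (suc (suc (double j)))} {log 2 +ᴿ fine} λ m → trans
      (cong (harmonic m) (eq j m))
      (trans (harmonic-+ m (suc m) (j ℕ.* suc (m ℕ.+ suc m)))
        (cong (λ k → harmonic m k + harmonic (m ℕ.+ suc m) (j ℕ.* suc (m ℕ.+ suc m)))
              (sym (ℕ.+-identityʳ (suc m))))))
    (+ᴿ-cong {log 2} {log 2} {fine} {log (suc j)} (≃-refl {log 2})
      (≈⇒≃ (null-modulus (log (suc j)) φ (λ m → ℕ.m≤m+n m (suc m)))))
    where
    φ : ℕ → ℕ
    φ m = m ℕ.+ suc m
    fine : ℝ
    fine = mkℝ (λ m → logSeq (suc j) (φ m)) λ ε 0<ε → let N , h = cauchy (log (suc j)) ε 0<ε in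
      N , λ m n a b → h (φ m) (φ n) (ℕ.≤-trans a (ℕ.m≤m+n m (suc m))) (ℕ.≤-trans b (ℕ.m≤m+n n (suc n)))
    eq : ∀ j m → suc (double j) ℕ.* suc m ≡ suc m ℕ.+ j ℕ.* suc (m ℕ.+ suc m)
    eq j m = trans (cong (λ k → suc k ℕ.* suc m) (double≡*2 j)) (lem j m)
      where
      lem : ∀ j m → suc (j ℕ.* 2) ℕ.* suc m ≡ suc m ℕ.+ j ℕ.* suc (m ℕ.+ suc m)
      lem = solve-∀

  ≃ᶜ-trans : ∀ {x y z} → x ≃ᶜ y → y ≃ᶜ z → x ≃ᶜ z
  ≃ᶜ-trans (mk≃ᶜ p q) (mk≃ᶜ p′ q′) = mk≃ᶜ (≃-trans p p′) (≃-trans q q′)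

  exponent-sum : ∀ s x y v → v ≃ x +ᴿ y →
    s *ᶜ fromℝ x +ᶜ (-ᶜ s) *ᶜ fromℝ v ≃ᶜ (-ᶜ s) *ᶜ fromℝ y
  exponent-sum s x y v (≈⇒≃ h) = mk≃ᶜ
    (≈⇒≃ (null-≡ (λ n → solve 5 (λ σ τ x y v → (:- σ) :* (v :- (x :+ y))
        := ((σ :* x :- τ :* con 0ℚ) :+ ((:- σ) :* v :- (:- τ) :* con 0ℚ))
           :- ((:- σ) :* y :- (:- τ) :* con 0ℚ)) refl
        (seq (Re s) n) (seq (Im s) n) (seq x n) (seq y n) (seq v n)) (null-ℝ-* (-ᴿ Re s) h)))
    (≈⇒≃ (null-≡ (λ n → solve 5 (λ σ τ x y v → (:- τ) :* (v :- (x :+ y))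
        := ((σ :* con 0ℚ :+ τ :* x) :+ ((:- σ) :* con 0ℚ :+ (:- τ) :* v))
           :- ((:- σ) :* con 0ℚ :+ (:- τ) :* y)) refl
        (seq (Re s) n) (seq (Im s) n) (seq x n) (seq y n) (seq v n)) (null-ℝ-* (-ᴿ Im s) h)))

  exp-product : ∀ p q r z w v → p ≡ exp z → q ≡ exp w → r ≡ exp v →
    z +ᶜ w ≃ᶜ v → p *ᶜ q ≃ᶜ r
  exp-product _ _ _ z w v refl refl refl h =
    ≃ᶜ-trans {exp z *ᶜ exp w} {exp (z +ᶜ w)} {exp v} (exp-+ z w) (exp-cong {z +ᶜ w} {v} h)

  2^s*[2n]^-s : ∀ s j → 2 ^ᶜ s *ᶜ suc (suc (double j)) ^ᶜ (-ᶜ s) ≃ᶜ suc j ^ᶜ (-ᶜ s)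
  2^s*[2n]^-s s j = exp-product (2 ^ᶜ s) (suc (suc (double j)) ^ᶜ (-ᶜ s)) (suc j ^ᶜ (-ᶜ s))
    (s *ᶜ fromℝ (log 2))
    ((-ᶜ s) *ᶜ fromℝ (log (suc (suc (double j)))))
    ((-ᶜ s) *ᶜ fromℝ (log (suc j)))
    refl refl refl
    (exponent-sum s (log 2) (log (suc j)) (log (suc (suc (double j)))) (log-double j))

-- Divergence of the harmonic series and decay of n ^ (- σ)

abstract
  fromℚ-*-≼ : ∀ p q x y → 0ℚ ≤ p → 0ℚ ≤ q → fromℚ p ≼ x → fromℚ q ≼ y → fromℚ (p * q) ≼ x *ᴿ y
  fromℚ-*-≼ p q x y 0≤p 0≤q p≼x q≼y = ≼-trans {fromℚ (p * q)} {fromℚ p *ᴿ y} {x *ᴿ y}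
    (≼-resp-≗ {fromℚ p *ᴿ fromℚ q} {fromℚ p *ᴿ y} (λ _ → refl) (λ _ → refl)
      (*ᴿ-monoʳ {fromℚ p} {fromℚ q} {y} (fromℚ-mono 0≤p) q≼y))
    (≼-resp-≗ {y *ᴿ fromℚ p} {y *ᴿ x} (λ n → *-comm (seq y n) p) (λ n → *-comm (seq y n) (seq x n))
      (*ᴿ-monoʳ {y} {fromℚ p} {x} (≼-trans (fromℚ-mono 0≤q) q≼y) p≼x))

  fromℚ-*-cancel-≼ : ∀ c ε x → 0ℚ < c → fromℚ c *ᴿ x ≼ fromℚ (c * ε) → x ≼ fromℚ ε
  fromℚ-*-cancel-≼ c ε x 0<c h = ≼-by-ε λ η 0<η →
    eventually-map (≼⇒eventually {fromℚ c *ᴿ x} {fromℚ (c * ε)} h (c * η) (0<* 0<c 0<η))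
      λ n p → *-cancelˡ-≤-pos c {{positive 0<c}}
        (≤-trans p (≤-reflexive (sym (*-distribˡ-+ c ε η))))

  harmonic-nonneg : ∀ s l → 0ℚ ≤ harmonic s l
  harmonic-nonneg s zero    = ≤-refl
  harmonic-nonneg s (suc l) = 0≤+ (harmonic-nonneg s l) (0≤1/suc (s ℕ.+ l))

  -- Oresme's argument: each of the l + 3 terms 1/(l + 3), ..., 1/(2 l + 5) is at least 1/(2 l + 6).
  harmonic-block : ∀ l → harmonic 2 l + 1/suc 1 ≤ harmonic 2 (l ℕ.+ suc (2 ℕ.+ l))
  harmonic-block l = ≤-trans
    (+-monoʳ-≤ (harmonic 2 l) (subst (λ s → 1/suc 1 ≤ harmonic s (suc (2 ℕ.+ l)))
      (ℕ.+-identityʳ (2 ℕ.+ l)) (block-lower (2 ℕ.+ l) 0)))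
    (≤-reflexive (sym (harmonic-+ 2 l (suc (2 ℕ.+ l)))))

  harmonic-unbounded : ∀ k → ∃ λ n → natℚ k ≤ harmonic 2 n
  harmonic-unbounded zero    = 0 , ≤-refl
  -- Two blocks, each worth 1/2, gain 1.
  harmonic-unbounded (suc k) = let n , h = harmonic-unbounded k ; m = n ℕ.+ suc (2 ℕ.+ n) in
    m ℕ.+ suc (2 ℕ.+ m) ,
    ≤-trans (+-monoˡ-≤ 1ℚ h)
      (≤-trans (≤-reflexive (sym (+-assoc (harmonic 2 n) (1/suc 1) (1/suc 1))))
        (≤-trans (+-monoˡ-≤ (1/suc 1) (harmonic-block n)) (harmonic-block m)))

  harmonic-*-unbounded : ∀ {η} → 0ℚ < η → ∃ λ n → 2ℚ ≤ harmonic 2 n * η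
  harmonic-*-unbounded {η} 0<η =
    let η′ , 0<η′ , eq = quotient {2ℚ} {η} 0<2 0<η
        N , small = archimedean {η′} 0<η′
        n , big = harmonic-unbounded (suc N)
        1≤ : 1ℚ ≤ harmonic 2 n * η′
        1≤ = ≤-trans (≤-reflexive (sym (natℚ-*-1/suc N)))
          (mul-≤ (≤-trans (harmonic-nonneg 0 (suc N)) (≤-trans (harmonic-upper 0 (suc N))
                   (≤-reflexive (*-identityʳ (natℚ (suc N))))))
                 (<⇒≤ 0<η′) big (small N ℕ.≤-refl))
    in n , ≤-trans (mulˡ-≤ {2ℚ} {1ℚ} {harmonic 2 n * η′} (<⇒≤ 0<2) 1≤)
      (≤-reflexive (trans
        (solve 2 (λ h e → con 2ℚ :* (h :* e) := h :* (con 2ℚ :* e)) refl (harmonic 2 n) η′)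
        (cong (harmonic 2 n *_) eq)))

  natℚ-nonneg : ∀ n → 0ℚ ≤ natℚ n
  natℚ-nonneg zero    = ≤-refl
  natℚ-nonneg (suc n) = 0≤+ (natℚ-nonneg n) 0≤1

  natℚ-suc : ∀ n → natℚ (suc n) ≡ natℚ n + 1ℚ
  natℚ-suc n = refl

  harmonic-suc : ∀ s l → harmonic s (suc l) ≡ harmonic s l + 1/suc (s ℕ.+ l)
  harmonic-suc s l = refl

  -- The induction step of `p≼2w`, with n = j + 2, r = 1 / n, r′ = 1 / (n + 1) and h = 1/3 + ... +
  -- 1/n. The right side exceeds the left by exactly d ^ 2 h.
  growth-step : ∀ n d h r r′ → 0ℚ ≤ d → 0ℚ ≤ h → n * r ≡ 1ℚ → (n + 1ℚ) * r′ ≡ 1ℚ →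
    (n + 1ℚ) * (1ℚ + d * (h + r′)) ≤ n * (1ℚ + d * h) * (1ℚ + (1ℚ + d) * r)
  growth-step n d h r r′ 0≤d 0≤h nr≡1 nr′≡1 =
    0≤q-p⇒p≤q (≤-trans (0≤* (0≤* 0≤d 0≤d) 0≤h) (≤-reflexive (sym eq)))
    where
    lhs : (n + 1ℚ) * (1ℚ + d * (h + r′)) ≡ (n + 1ℚ) * (1ℚ + d * h) + d * 1ℚ
    lhs = trans
      (solve 4 (λ n d h r → (n :+ con 1ℚ) :* (con 1ℚ :+ d :* (h :+ r))
          := (n :+ con 1ℚ) :* (con 1ℚ :+ d :* h) :+ d :* ((n :+ con 1ℚ) :* r)) refl n d h r′)
      (cong (λ x → (n + 1ℚ) * (1ℚ + d * h) + d * x) nr′≡1)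
    rhs : n * (1ℚ + d * h) * (1ℚ + (1ℚ + d) * r) ≡ (1ℚ + d * h) * (n + (1ℚ + d) * 1ℚ)
    rhs = trans
      (solve 4 (λ n d h r → n :* (con 1ℚ :+ d :* h) :* (con 1ℚ :+ (con 1ℚ :+ d) :* r)
          := (con 1ℚ :+ d :* h) :* (n :+ (con 1ℚ :+ d) :* (n :* r))) refl n d h r)
      (cong (λ x → (1ℚ + d * h) * (n + (1ℚ + d) * x)) nr≡1)
    eq : n * (1ℚ + d * h) * (1ℚ + (1ℚ + d) * r) - (n + 1ℚ) * (1ℚ + d * (h + r′)) ≡ d * d * h
    eq = trans (cong₂ _-_ rhs lhs)
      (solve 3 (λ n d h → (con 1ℚ :+ d :* h) :* (n :+ (con 1ℚ :+ d) :* con 1ℚ)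
          :- ((n :+ con 1ℚ) :* (con 1ℚ :+ d :* h) :+ d :* con 1ℚ) := d :* d :* h) refl n d h)

  decay-step : ∀ n u d r → n * r ≡ 1ℚ → n * (u * (1ℚ + (1ℚ + d) * r)) ≡ d * u + (n + 1ℚ) * u
  decay-step n u d r nr≡1 = trans
    (solve 4 (λ n u d r → n :* (u :* (con 1ℚ :+ (con 1ℚ :+ d) :* r))
        := n :* u :+ (con 1ℚ :+ d) :* (n :* r) :* u) refl n u d r)
    (trans (cong (λ x → n * u + (1ℚ + d) * x * u) nr≡1)
      (solve 3 (λ n u d → n :* u :+ (con 1ℚ :+ d) :* con 1ℚ :* u := d :* u :+ (n :+ con 1ℚ) :* u) refl n u d))

abstract
  E-+-cong : ∀ x y z → (∀ n → seq x n + seq y n ≡ seq z n) → E x *ᴿ E y ≃ E z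
  E-+-cong x y z h = ≃-trans {E x *ᴿ E y} {E (x +ᴿ y)} {E z} (E-+ x y) (E-cong {x +ᴿ y} {z} (≗⇒≃ h))

abstract
  telescope-zero : ∀ d g b → fromℚ d *ᴿ (g -ᴿ g) +ᴿ b ≼ b
  telescope-zero d g b = ≃⇒≼ (≗⇒≃ λ n →
    solve 3 (λ d g b → d :* (g :- g) :+ b := b) refl d (seq g n) (seq b n))

  telescope-step : ∀ d g g₀ x u b b′ b₀ → 0ℚ ≤ d → x ≼ u → fromℚ d *ᴿ u +ᴿ b′ ≼ b →
    fromℚ d *ᴿ (g -ᴿ g₀) +ᴿ b ≼ b₀ → fromℚ d *ᴿ ((g +ᴿ x) -ᴿ g₀) +ᴿ b′ ≼ b₀
  telescope-step d g g₀ x u b b′ b₀ 0≤d (mk≼ e₁ n₁ h₁) (mk≼ e₂ n₂ h₂) (mk≼ e₃ n₃ h₃) = mk≼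
    (λ n → d * e₁ n + e₂ n + e₃ n) (null-+ (null-+ (null-ℝ-* (fromℚ d) n₁) n₂) n₃) λ n →
    go (seq g n) (seq g₀ n) (seq x n) (seq u n) (seq b n) (seq b′ n) (seq b₀ n) (e₁ n) (e₂ n) (e₃ n)
       (h₁ n) (h₂ n) (h₃ n)
    where
    go : ∀ g g₀ x u b b′ b₀ e₁ e₂ e₃ → x ≤ u + e₁ → d * u + b′ ≤ b + e₂ → d * (g - g₀) + b ≤ b₀ + e₃ →
      d * (g + x - g₀) + b′ ≤ b₀ + (d * e₁ + e₂ + e₃)
    go g g₀ x u b b′ b₀ e₁ e₂ e₃ p q r = ≤-trans
      (≤-trans (+-monoˡ-≤ b′ (mulˡ-≤ {d} {g + x - g₀} {g + (u + e₁) - g₀} 0≤d (+-monoˡ-≤ (- g₀) (+-monoʳ-≤ g p))))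
        (≤-reflexive (solve 6 (λ d g g₀ u b′ e₁ →
          d :* (g :+ (u :+ e₁) :- g₀) :+ b′ := (d :* u :+ b′) :+ (d :* (g :- g₀) :+ d :* e₁)) refl
          d g g₀ u b′ e₁)))
      (≤-trans (+-monoˡ-≤ (d * (g - g₀) + d * e₁) q)
        (≤-trans
          (≤-reflexive (solve 6 (λ d g g₀ b e₁ e₂ →
            (b :+ e₂) :+ (d :* (g :- g₀) :+ d :* e₁) := (d :* (g :- g₀) :+ b) :+ (d :* e₁ :+ e₂)) refl
            d g g₀ b e₁ e₂))
          (≤-trans (+-monoˡ-≤ (d * e₁ + e₂) r)
            (≤-reflexive (solve 3 (λ b₀ e₃ f → (b₀ :+ e₃) :+ f := b₀ :+ (f :+ e₃)) refl b₀ e₃ (d * e₁ + e₂))))))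

  drop-remainder : ∀ d c ε z b b₀ → 0ℚ < d → 0ℚ < c → 0ᴿ ≼ b → fromℚ d *ᴿ z +ᴿ b ≼ b₀ →
    fromℚ c *ᴿ b₀ ≼ fromℚ (c * d * ε) → z ≼ fromℚ ε
  drop-remainder d c ε z b b₀ 0<d 0<c 0≼b h k =
    fromℚ-*-cancel-≼ (c * d) ε z (0<* 0<c 0<d)
      (≼-trans {fromℚ (c * d) *ᴿ z} {fromℚ c *ᴿ b₀} {fromℚ (c * d * ε)}
        (≼-resp-≗ {fromℚ c *ᴿ (fromℚ d *ᴿ z)} {fromℚ c *ᴿ b₀}
          (λ n → sym (*-assoc c d (seq z n))) (λ _ → refl)
          (*ᴿ-monoʳ {fromℚ c} {fromℚ d *ᴿ z} {b₀} (fromℚ-mono (<⇒≤ 0<c))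
            (≼-trans {fromℚ d *ᴿ z} {fromℚ d *ᴿ z +ᴿ b} {b₀}
              (≼-resp-≗ {fromℚ d *ᴿ z +ᴿ 0ᴿ} {fromℚ d *ᴿ z +ᴿ b}
                (λ n → +-identityʳ (d * seq z n)) (λ _ → refl)
                (+ᴿ-mono {fromℚ d *ᴿ z} {fromℚ d *ᴿ z} {0ᴿ} {b}
                  (≃⇒≼ (≃-refl {fromℚ d *ᴿ z})) 0≼b))
              h)))
        k)

-- In the application u j = (j + 1) ^ (- σ), w j = (j + 1) ^ σ and e j = w (j + 1) / w j.
module Decay
  (δ : ℚ) (0<δ : 0ℚ < δ) (u w e : ℕ → ℝ)
  (uw≃1  : ∀ j → u j *ᴿ w j ≃ 1ᴿ)
  (we≃w  : ∀ j → w j *ᴿ e j ≃ w (suc j))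
  (ue≃u  : ∀ j → u (suc j) *ᴿ e j ≃ u j)
  (1≼w   : ∀ j → 1ᴿ ≼ w j)
  (1+q≼e : ∀ j → fromℚ (1ℚ + (1ℚ + δ) * 1/suc (suc j)) ≼ e j)
  where

  private
    0≤δ : 0ℚ ≤ δ
    0≤δ = <⇒≤ 0<δ

    0≤q : ∀ j → 0ℚ ≤ (1ℚ + δ) * 1/suc (suc j)
    0≤q j = 0≤* (0≤+ 0≤1 0≤δ) (0≤1/suc (suc j))

  abstract
    -- The rate at which `b` tends to 0: `cb≼2` gives b j ≤ 2 / c j. The harmonic sum begins with
    -- 1/3 because passing from j to j + 1 in `p-step` adds 1 / (j + 3).
    c : ℕ → ℚ
    c j = 1ℚ + δ * harmonic 2 j

    c≡ : ∀ j → c j ≡ 1ℚ + δ * harmonic 2 j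
    c≡ j = refl

    0<c : ∀ j → 0ℚ < c j
    0<c j = <-≤-trans 0<1 (x≤x+p (0≤* 0≤δ (harmonic-nonneg 2 j)))

  abstract
    b : ℕ → ℝ
    b j = fromℚ (natℚ (suc (suc j))) *ᴿ u j

    0≼u : ∀ j → 0ᴿ ≼ u j
    0≼u j = inverse-nonneg {u j} {w j} (≼-trans (fromℚ-mono 0≤1) (1≼w j)) (uw≃1 j)

    0≤p : ∀ j → 0ℚ ≤ natℚ (suc (suc j)) * c j
    0≤p j = 0≤* (natℚ-nonneg (suc (suc j))) (<⇒≤ (0<c j))

    p-step : ∀ j → natℚ (suc (suc (suc j))) * c (suc j)
                 ≤ natℚ (suc (suc j)) * c j * (1ℚ + (1ℚ + δ) * 1/suc (suc j))
    p-step j = subst₂ _≤_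
      (sym (cong₂ _*_ (natℚ-suc (suc (suc j)))
        (trans (c≡ (suc j)) (cong (λ x → 1ℚ + δ * x) (harmonic-suc 2 j)))))
      (cong (λ x → natℚ (suc (suc j)) * x * (1ℚ + (1ℚ + δ) * 1/suc (suc j))) (sym (c≡ j)))
      (growth-step (natℚ (suc (suc j))) δ (harmonic 2 j) (1/suc (suc j)) (1/suc (suc (suc j)))
        0≤δ (harmonic-nonneg 2 j) (natℚ-*-1/suc (suc j))
        (trans (cong (_* 1/suc (suc (suc j))) (sym (natℚ-suc (suc (suc j))))) (natℚ-*-1/suc (suc (suc j)))))

    -- At j = 0 the left side is 2 and w 0 ≥ 1. From there on w grows by the factor e j, which is at
    -- least 1 + (1 + δ) / (j + 2), and by `p-step` the left side grows by no more than that.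
    p≼2w : ∀ j → fromℚ (natℚ (suc (suc j)) * c j) ≼ fromℚ 2ℚ *ᴿ w j
    p≼2w zero = ≼-resp-≗ {fromℚ (2ℚ * 1ℚ)} {fromℚ 2ℚ *ᴿ w 0}
      (λ _ → cong (2ℚ *_) (trans (solve 1 (λ d → con 1ℚ := con 1ℚ :+ d :* con 0ℚ) refl δ) (sym (c≡ 0))))
      (λ _ → refl)
      (fromℚ-*-≼ 2ℚ 1ℚ (fromℚ 2ℚ) (w 0) (<⇒≤ 0<2) 0≤1 (fromℚ-mono ≤-refl) (1≼w 0))
    p≼2w (suc j) = ≼-trans {fromℚ ((natℚ (suc (suc (suc j))) * c (suc j)))} {fromℚ (natℚ (suc (suc j)) * c j * (1ℚ + (1ℚ + δ) * 1/suc (suc j)))} {fromℚ 2ℚ *ᴿ w (suc j)}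
      (fromℚ-mono (p-step j))
      (≼-trans {fromℚ (natℚ (suc (suc j)) * c j * (1ℚ + (1ℚ + δ) * 1/suc (suc j)))} {(fromℚ 2ℚ *ᴿ w j) *ᴿ e j} {fromℚ 2ℚ *ᴿ w (suc j)}
        (fromℚ-*-≼ (natℚ (suc (suc j)) * c j) (1ℚ + (1ℚ + δ) * 1/suc (suc j)) (fromℚ 2ℚ *ᴿ w j) (e j) (0≤p j) (0≤+ 0≤1 (0≤q j)) (p≼2w j) (1+q≼e j))
        (≃⇒≼ (≃-trans {(fromℚ 2ℚ *ᴿ w j) *ᴿ e j} {fromℚ 2ℚ *ᴿ (w j *ᴿ e j)} {fromℚ 2ℚ *ᴿ w (suc j)}
          (≗⇒≃ λ n → *-assoc 2ℚ (seq (w j) n) (seq (e j) n))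
          (*ᴿ-cong {fromℚ 2ℚ} {fromℚ 2ℚ} {w j *ᴿ e j} {w (suc j)} (≃-refl {fromℚ 2ℚ}) (we≃w j)))))

    0≼b : ∀ j → 0ᴿ ≼ b j
    0≼b j = 0≼* {fromℚ (natℚ (suc (suc j)))} {u j} (fromℚ-mono (natℚ-nonneg (suc (suc j)))) (0≼u j)

    -- `p≼2w` multiplied by `u j`, the inverse of `w j`.
    cb≼2 : ∀ j → fromℚ (c j) *ᴿ b j ≼ fromℚ 2ℚ
    cb≼2 j = ≼-trans {fromℚ (c j) *ᴿ b j} {u j *ᴿ (fromℚ 2ℚ *ᴿ w j)} {fromℚ 2ℚ}
      (≼-resp-≗ {u j *ᴿ fromℚ (natℚ (suc (suc j)) * c j)} {u j *ᴿ (fromℚ 2ℚ *ᴿ w j)}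
        (λ n → solve 3 (λ u n c → u :* (n :* c) := c :* (n :* u)) refl
                 (seq (u j) n) (natℚ (suc (suc j))) (c j))
        (λ _ → refl)
        (*ᴿ-monoʳ {u j} {fromℚ (natℚ (suc (suc j)) * c j)} {fromℚ 2ℚ *ᴿ w j} (0≼u j) (p≼2w j)))
      (≃⇒≼ (≃-trans {u j *ᴿ (fromℚ 2ℚ *ᴿ w j)} {fromℚ 2ℚ *ᴿ (u j *ᴿ w j)} {fromℚ 2ℚ}
        (≗⇒≃ λ n → solve 3 (λ u k w → u :* (k :* w) := k :* (u :* w)) refl (seq (u j) n) 2ℚ (seq (w j) n))
        (≃-trans {fromℚ 2ℚ *ᴿ (u j *ᴿ w j)} {fromℚ 2ℚ *ᴿ 1ᴿ} {fromℚ 2ℚ}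
          (*ᴿ-cong {fromℚ 2ℚ} {fromℚ 2ℚ} {u j *ᴿ w j} {1ᴿ} (≃-refl {fromℚ 2ℚ}) (uw≃1 j))
          (≗⇒≃ λ _ → *-identityʳ 2ℚ))))

    -- (j+2) u_j ≥ (j+2) (1 + (1+δ)/(j+2)) u_{j+1} = (j+3+δ) u_{j+1}
    b-step : ∀ j → fromℚ δ *ᴿ u (suc j) +ᴿ b (suc j) ≼ b j
    b-step j = ≼-trans
      {fromℚ δ *ᴿ u (suc j) +ᴿ b (suc j)} {fromℚ (natℚ (suc (suc j))) *ᴿ (u (suc j) *ᴿ e j)} {b j}
      (≼-resp-≗ {fromℚ (natℚ (suc (suc j))) *ᴿ (u (suc j) *ᴿ fromℚ (1ℚ + (1ℚ + δ) * 1/suc (suc j)))}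
                {fromℚ (natℚ (suc (suc j))) *ᴿ (u (suc j) *ᴿ e j)}
        (λ m → trans
          (decay-step (natℚ (suc (suc j))) (seq (u (suc j)) m) δ (1/suc (suc j)) (natℚ-*-1/suc (suc j)))
          (cong (λ x → δ * seq (u (suc j)) m + x * seq (u (suc j)) m) (sym (natℚ-suc (suc (suc j))))))
        (λ _ → refl)
        (*ᴿ-monoʳ {fromℚ (natℚ (suc (suc j)))}
          {u (suc j) *ᴿ fromℚ (1ℚ + (1ℚ + δ) * 1/suc (suc j))} {u (suc j) *ᴿ e j}
          (fromℚ-mono (natℚ-nonneg (suc (suc j))))
          (*ᴿ-monoʳ {u (suc j)} {fromℚ (1ℚ + (1ℚ + δ) * 1/suc (suc j))} {e j} (0≼u (suc j)) (1+q≼e j))))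
      (≃⇒≼ (*ᴿ-cong {fromℚ (natℚ (suc (suc j)))} {fromℚ (natℚ (suc (suc j)))} {u (suc j) *ᴿ e j} {u j}
        (≃-refl {fromℚ (natℚ (suc (suc j)))}) (ue≃u j)))

    -- Telescoping of `b-step`. The remainder `b i` stays on the left because the next step is paid
    -- for out of it.
    partial-sum-bound : ∀ (g x : ℕ → ℝ) → (∀ n m → seq (g (suc n)) m ≡ seq (g n) m + seq (x (suc n)) m) →
      (∀ n → x (suc n) ≼ u n) →
      ∀ {n i} → n ℕ.≤′ i → fromℚ δ *ᴿ (g (suc i) -ᴿ g (suc n)) +ᴿ b i ≼ b n
    partial-sum-bound g x g-suc x≼u {n} ℕ.≤′-refl = telescope-zero δ (g (suc n)) (b n)
    partial-sum-bound g x g-suc x≼u {n} {suc i} (ℕ.≤′-step n≤i) = ≼-resp-≗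
      {fromℚ δ *ᴿ ((g (suc i) +ᴿ x (suc (suc i))) -ᴿ g (suc n)) +ᴿ b (suc i)} {b n}
      (λ m → cong (λ y → δ * (y - seq (g (suc n)) m) + seq (b (suc i)) m) (sym (g-suc (suc i) m)))
      (λ _ → refl)
      (telescope-step δ (g (suc i)) (g (suc n)) (x (suc (suc i))) (u (suc i))
        (b i) (b (suc i)) (b n) 0≤δ (x≼u (suc i)) (b-step i)
        (partial-sum-bound g x g-suc x≼u n≤i))

    -- With z for the difference, c n δ z ≤ c n b n ≤ 2 ≤ c n δ ε, and the positive factor c n δ is
    -- cancelled.
    partial-sum-small : ∀ (g x : ℕ → ℝ) → (∀ n m → seq (g (suc n)) m ≡ seq (g n) m + seq (x (suc n)) m) →
      (∀ n → x (suc n) ≼ u n) → ∀ n {ε} → 2ℚ ≤ c n * δ * ε →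
      ∀ i → n ℕ.≤ i → g (suc i) -ᴿ g (suc n) ≼ fromℚ ε
    partial-sum-small g x g-suc x≼u n {ε} big i n≤i = drop-remainder δ (c n) ε
      (g (suc i) -ᴿ g (suc n)) (b i) (b n) 0<δ (0<c n) (0≼b i)
      (partial-sum-bound g x g-suc x≼u (ℕ.≤⇒≤′ n≤i))
      (≼-trans {fromℚ (c n) *ᴿ b n} {fromℚ 2ℚ} {fromℚ (c n * δ * ε)} (cb≼2 n) (fromℚ-mono big))

    c-large : ∀ {ε} → 0ℚ < ε → ∃ λ n → 2ℚ ≤ c n * δ * ε
    -- c n δ ε is the sum of δ ε ≥ 0 and the harmonic sum times δ ^ 2 ε; the second summand alone is
    -- made at least 2.
    c-large {ε} 0<ε = let n , big = harmonic-*-unbounded {δ * δ * ε} (0<* (0<* 0<δ 0<δ) 0<ε) in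
      n , subst (λ x → 2ℚ ≤ x * δ * ε) (sym (c≡ n)) (≤-trans big
        (0≤q-p⇒p≤q (≤-trans (0≤* 0≤δ (<⇒≤ 0<ε)) (≤-reflexive
          (solve 3 (λ h d e → d :* e := (con 1ℚ :+ d :* h) :* d :* e :- h :* (d :* d :* e)) refl
            (harmonic 2 n) δ ε)))))

module Power (σ : ℝ) (δ : ℚ) (0<δ : 0ℚ < δ) (1+δ≤σ : Eventually λ n → 1ℚ + δ ≤ seq σ n) where

  abstract
    n^-σ*n^σ≃1 : ∀ j → E (-ᴿ (σ *ᴿ log (suc j))) *ᴿ E (σ *ᴿ log (suc j)) ≃ 1ᴿ
    n^-σ*n^σ≃1 j = E-inverse (σ *ᴿ log (suc j))

    n^σ-step : ∀ j → E (σ *ᴿ log (suc j)) *ᴿ E (σ *ᴿ (log (suc (suc j)) -ᴿ log (suc j)))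
                   ≃ E (σ *ᴿ log (suc (suc j)))
    n^σ-step j = E-+-cong (σ *ᴿ log (suc j)) (σ *ᴿ (log (suc (suc j)) -ᴿ log (suc j))) (σ *ᴿ log (suc (suc j)))
      λ n → solve 3 (λ σ a b → σ :* a :+ σ :* (b :- a) := σ :* b) refl
              (seq σ n) (seq (log (suc j)) n) (seq (log (suc (suc j))) n)

    n^-σ-step : ∀ j → E (-ᴿ (σ *ᴿ log (suc (suc j)))) *ᴿ E (σ *ᴿ (log (suc (suc j)) -ᴿ log (suc j)))
                    ≃ E (-ᴿ (σ *ᴿ log (suc j)))
    n^-σ-step j = E-+-cong (-ᴿ (σ *ᴿ log (suc (suc j)))) (σ *ᴿ (log (suc (suc j)) -ᴿ log (suc j))) (-ᴿ (σ *ᴿ log (suc j)))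
      λ n → solve 3 (λ σ a b → (:- (σ :* b)) :+ σ :* (b :- a) := :- (σ :* a)) refl
              (seq σ n) (seq (log (suc j)) n) (seq (log (suc (suc j))) n)

    1≼n^σ : ∀ j → 1ᴿ ≼ E (σ *ᴿ log (suc j))
    1≼n^σ j = 1+q≼E (σ *ᴿ log (suc j)) 0ℚ ≤-refl (eventually-map 1+δ≤σ λ n 1+δ≤σₙ →
      0≤* {seq σ n} {logSeq (suc j) n} (≤-trans (0≤+ 0≤1 (<⇒≤ 0<δ)) 1+δ≤σₙ) (harmonic-nonneg n (j ℕ.* suc n)))

    1+q≼ratio : ∀ j → fromℚ (1ℚ + (1ℚ + δ) * 1/suc (suc j)) ≼ E (σ *ᴿ (log (suc (suc j)) -ᴿ log (suc j)))
    1+q≼ratio j = 1+q≼E (σ *ᴿ (log (suc (suc j)) -ᴿ log (suc j))) ((1ℚ + δ) * 1/suc (suc j))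
      (0≤* (0≤+ 0≤1 (<⇒≤ 0<δ)) (0≤1/suc (suc j)))
      (eventually-map 1+δ≤σ λ n 1+δ≤σₙ →
        let d≥ : 1/suc (suc j) ≤ logSeq (suc (suc j)) n - logSeq (suc j) n
            d≥ = ≤-trans
              (≤-reflexive (solve 2 (λ l r → r := (l :+ r) :- l) refl (logSeq (suc j) n) (1/suc (suc j))))
              (+-monoˡ-≤ (- logSeq (suc j) n) (logSeq-step j n))
        in ≤-trans
          (mulˡ-≤ {1ℚ + δ} {1/suc (suc j)} {logSeq (suc (suc j)) n - logSeq (suc j) n} (0≤+ 0≤1 (<⇒≤ 0<δ)) d≥)
          (mulʳ-≤ {logSeq (suc (suc j)) n - logSeq (suc j) n} {1ℚ + δ} {seq σ n}
            (≤-trans (0≤1/suc (suc j)) d≥) 1+δ≤σₙ))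

  open Decay δ 0<δ
    (λ j → E (-ᴿ (σ *ᴿ log (suc j))))
    (λ j → E (σ *ᴿ log (suc j)))
    (λ j → E (σ *ᴿ (log (suc (suc j)) -ᴿ log (suc j))))
    n^-σ*n^σ≃1 n^σ-step n^-σ-step 1≼n^σ 1+q≼ratio public

-- Completeness of the real numbers

-- The index from which the approximations are close may depend on `n`; only the threshold for `n`
-- itself is uniform.
IsCauchyᴿ : (ℕ → ℝ) → Set
IsCauchyᴿ g = ∀ ε → 0ℚ < ε →
  ∃ λ N → ∀ n → N ℕ.≤ n → Eventually λ i → ∣ seq (g n) i - seq (g N) i ∣ ≤ ε

infix 4 _⟶_

_⟶_ : (ℕ → ℝ) → ℝ → Set
g ⟶ a = ∀ ε → 0ℚ < ε → Eventually λ n → Eventually λ i → ∣ seq (g n) i - seq a i ∣ ≤ ε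

eventually⇒∃ : ∀ {P : ℕ → Set} → Eventually P → ∃ P
eventually⇒∃ (N , p) = N , p N ℕ.≤-refl

abstract
  tri₄ : ∀ a x y z b → ∣ a - b ∣ ≤ ∣ a - x ∣ + ∣ x - y ∣ + (∣ y - z ∣ + ∣ z - b ∣)
  tri₄ a x y z b = ≤-trans (tri a y b) (+-mono-≤ (tri a x y) (tri y z b))

  tri₃ : ∀ a x y b → ∣ a - b ∣ ≤ ∣ a - x ∣ + ∣ x - y ∣ + ∣ y - b ∣
  tri₃ a x y b = ≤-trans (tri a y b) (+-monoˡ-≤ (∣ y - b ∣) (tri a x y))

  ∣-∣≤-sym : ∀ {x y q} → ∣ x - y ∣ ≤ q → ∣ y - x ∣ ≤ q
  ∣-∣≤-sym {x} {y} {q} h = subst (_≤ q) (∣-∣-sym x y) h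

  -- The strict order asks for a positive gap: one half of ε bounds the distance and the other half
  -- is the gap.
  ⟶⇒⟶ᴿ : ∀ g a → g ⟶ a → g ⟶ᴿ a
  ⟶⇒⟶ᴿ g a h ε 0<ε = let δ , 0<δ , eq = halve 0<ε in
    eventually-map (h δ 0<δ) λ n ev → δ , 0<δ ,
      eventually-map ev λ i p → ≤-trans (+-monoˡ-≤ δ p) (≤-reflexive eq)

module Completion (g : ℕ → ℝ) (cauchyᴿ : IsCauchyᴿ g) where
  abstract
    M K : ℕ → ℕ
    M j = proj₁ (cauchyᴿ (1/suc j) (0<1/suc j))
    K j = proj₁ (cauchy (g (M j)) (1/suc j) (0<1/suc j))

    M-spec : ∀ j n → M j ℕ.≤ n → Eventually λ i → ∣ seq (g n) i - seq (g (M j)) i ∣ ≤ 1/suc j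
    M-spec j = proj₂ (cauchyᴿ (1/suc j) (0<1/suc j))

    K-spec : ∀ j i → K j ℕ.≤ i → ∣ seq (g (M j)) i - seq (g (M j)) (K j) ∣ ≤ 1/suc j
    K-spec j i h = proj₂ (cauchy (g (M j)) (1/suc j) (0<1/suc j)) i (K j) h ℕ.≤-refl

  -- A diagonal choice: `M j` makes the later reals close to `g (M j)` up to 1/(j + 1), and `K j`
  -- does the same for the later approximations to `g (M j)`.
  limit-seq : ℕ → ℚ
  limit-seq j = seq (g (M j)) (K j)

  abstract
    -- Both values are compared with g (max (M j) (M k)) at a single index i that is late enough for
    -- all four estimates. This index depends on j and k but does not enter the bound.
    limit-seq-close : ∀ j k →
      ∣ limit-seq j - limit-seq k ∣ ≤ 1/suc j + 1/suc j + (1/suc k + 1/suc k)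
    limit-seq-close j k = let
        n = M j ℕ.⊔ M k
        i , (p , q) , (r , s) = eventually⇒∃ (eventually-zip
          (eventually-zip (K j , K-spec j) (M-spec j n (ℕ.m≤m⊔n (M j) (M k))) λ _ → _,_)
          (eventually-zip (K k , K-spec k) (M-spec k n (ℕ.m≤n⊔m (M j) (M k))) λ _ → _,_)
          λ _ → _,_)
      in ≤-trans
        (tri₄ (limit-seq j) (seq (g (M j)) i) (seq (g n) i) (seq (g (M k)) i) (limit-seq k))
        (+-mono-≤
          (+-mono-≤ (∣-∣≤-sym {seq (g (M j)) i} {limit-seq j} p) (∣-∣≤-sym {seq (g n) i} {seq (g (M j)) i} q))
          (+-mono-≤ s r))

    limit-cauchy : IsCauchy limit-seq
    limit-cauchy = cauchy-scale limit-seq (2ℚ * 2ℚ) (0<* 0<2 0<2) λ ε 0<ε →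
      let N , small = archimedean {ε} 0<ε in
      N , λ m n N≤m N≤n → ≤-trans (limit-seq-close m n)
        (≤-trans (+-mono-≤ (+-mono-≤ (small m N≤m) (small m N≤m)) (+-mono-≤ (small n N≤n) (small n N≤n)))
          (≤-reflexive (solve 1 (λ e → e :+ e :+ (e :+ e) := con (2ℚ * 2ℚ) :* e) refl ε)))

  limit : ℝ
  limit = mkℝ limit-seq limit-cauchy

  private
    -- Two errors lead from `g n` to `limit-seq J`, and `limit-seq-close` contributes four more.
    6ℚ : ℚ
    6ℚ = 2ℚ * 2ℚ + 2ℚ

  abstract
    ⟶limit : g ⟶ limit
    ⟶limit ε 0<ε =
      let ε′ , 0<ε′ , eq = quotient {6ℚ} {ε} (<-≤-trans 0<2 (x≤p+x (0≤* (<⇒≤ 0<2) (<⇒≤ 0<2)))) 0<ε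
          J , small = archimedean {ε′} 0<ε′
          e≤ : 1/suc J ≤ ε′
          e≤ = small J ℕ.≤-refl
      in M J , λ n MJ≤n →
        eventually-zip (eventually-zip (M-spec J n MJ≤n) (K J , K-spec J) λ _ → _,_) (J , small)
          λ i (p , q) r → ≤-trans
            (tri₃ (seq (g n) i) (seq (g (M J)) i) (limit-seq J) (limit-seq i))
            (≤-trans
              (+-mono-≤ (+-mono-≤ (≤-trans p e≤) (≤-trans q e≤))
                (≤-trans (limit-seq-close J i) (+-mono-≤ (+-mono-≤ e≤ e≤) (+-mono-≤ r r))))
              (≤-trans (≤-reflexive (solve 1 (λ e → (e :+ e) :+ (e :+ e :+ (e :+ e)) := con 6ℚ :* e) refl ε′))
                (≤-reflexive eq)))

abstract
  -- It suffices to use the relation at one n for which all three terms are δ-close to their limits.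
  -- The factor `C` collects the bounds of p and q, one δ for the relation at n and one for the
  -- distance from `u n` to `U`.
  limit-of-linear-relation : ∀ p q (v w u : ℕ → ℝ) V W U → v ⟶ V → w ⟶ W → u ⟶ U →
    (∀ n → p *ᴿ v n +ᴿ q *ᴿ w n ≃ u n) → p *ᴿ V +ᴿ q *ᴿ W ≃ U
  limit-of-linear-relation p q v w u V W U v⟶V w⟶W u⟶U rel = ≈⇒≃ λ ε 0<ε →
    let Bp , 0<Bp , p≤ = bounded p
        Bq , 0<Bq , q≤ = bounded q
        C = Bp + Bq + 2ℚ
        0<C : 0ℚ < C
        0<C = <-≤-trans 0<2 (x≤p+x (0≤+ (<⇒≤ 0<Bp) (<⇒≤ 0<Bq)))
        δ , 0<δ , eq = quotient {C} {ε} 0<C 0<ε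
        n , (hv , hw) , hu = eventually⇒∃ (eventually-zip
          (eventually-zip (v⟶V δ 0<δ) (w⟶W δ 0<δ) λ _ → _,_) (u⟶U δ 0<δ) λ _ → _,_)
    in eventually-zip (eventually-zip hv hw λ _ → _,_) (eventually-zip hu (≃⇒≈ (rel n) δ 0<δ) λ _ → _,_)
      λ i (iv , iw) (iu , ir) → subst (∣ seq p i * seq V i + seq q i * seq W i - seq U i ∣ ≤_) eq
        (pointwise Bp Bq δ (<⇒≤ 0<δ) (seq p i) (seq q i) (seq (v n) i) (seq (w n) i) (seq (u n) i)
          (seq V i) (seq W i) (seq U i) (p≤ i) (q≤ i) iv iw iu ir)
    where
    pointwise : ∀ Bp Bq δ → 0ℚ ≤ δ → ∀ p q v w u V W U → ∣ p ∣ ≤ Bp → ∣ q ∣ ≤ Bq →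
      ∣ v - V ∣ ≤ δ → ∣ w - W ∣ ≤ δ → ∣ u - U ∣ ≤ δ → ∣ p * v + q * w - u ∣ ≤ δ →
      ∣ p * V + q * W - U ∣ ≤ (Bp + Bq + 2ℚ) * δ
    pointwise Bp Bq δ 0≤δ p q v w u V W U hp hq hv hw hu hr = ≤-trans
      (≤-reflexive (cong ∣_∣ (solve 8 (λ p q v w u V W U →
        p :* V :+ q :* W :- U := (p :* (V :- v) :+ q :* (W :- w)) :+ ((p :* v :+ q :* w :- u) :+ (u :- U)))
        refl p q v w u V W U)))
      (≤-trans (∣p+q∣≤∣p∣+∣q∣ (p * (V - v) + q * (W - w)) ((p * v + q * w - u) + (u - U)))
        (≤-trans (+-mono-≤
            (≤-trans (∣p+q∣≤∣p∣+∣q∣ (p * (V - v)) (q * (W - w)))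
              (+-mono-≤ (prod p (V - v) Bp hp (∣-∣≤-sym {v} {V} hv)) (prod q (W - w) Bq hq (∣-∣≤-sym {w} {W} hw))))
            (≤-trans (∣p+q∣≤∣p∣+∣q∣ (p * v + q * w - u) (u - U)) (+-mono-≤ hr hu)))
          (≤-reflexive (solve 3 (λ a b d → a :* d :+ b :* d :+ (d :+ d) := (a :+ b :+ con 2ℚ) :* d) refl Bp Bq δ))))
      where
      prod : ∀ x y B → ∣ x ∣ ≤ B → ∣ y ∣ ≤ δ → ∣ x * y ∣ ≤ B * δ
      prod x y B hx hy = ≤-trans (≤-reflexive (∣p*q∣≡∣p∣*∣q∣ x y)) (mul-≤ {∣ x ∣} {δ} {B} {∣ y ∣} (0≤∣p∣ x) 0≤δ hx hy)

  ⟶-+ : ∀ v w V W → v ⟶ V → w ⟶ W → (λ n → v n +ᴿ w n) ⟶ V +ᴿ W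
  ⟶-+ v w V W v⟶V w⟶W ε 0<ε = let δ , 0<δ , eq = halve 0<ε in
    eventually-zip (v⟶V δ 0<δ) (w⟶W δ 0<δ) λ n hv hw →
      eventually-zip hv hw λ i p q → ≤-trans
        (≤-reflexive (cong ∣_∣ (solve 4 (λ a b c d → (a :+ b) :- (c :+ d) := (a :- c) :+ (b :- d)) refl
          (seq (v n) i) (seq (w n) i) (seq V i) (seq W i))))
        (≤-trans (∣p+q∣≤∣p∣+∣q∣ (seq (v n) i - seq V i) (seq (w n) i - seq W i))
          (≤-trans (+-mono-≤ p q) (≤-reflexive eq)))

  ⟶-neg : ∀ v V → v ⟶ V → (λ n → -ᴿ v n) ⟶ -ᴿ V
  ⟶-neg v V v⟶V ε 0<ε = eventually-map (v⟶V ε 0<ε) λ n ev → eventually-map ev λ i p → ≤-trans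
    (≤-reflexive (trans (cong ∣_∣ (solve 2 (λ a b → (:- a) :- (:- b) := :- (a :- b)) refl (seq (v n) i) (seq V i)))
                        (∣-p∣≡∣p∣ (seq (v n) i - seq V i)))) p

  ⟶-reindex : ∀ v V (φ : ℕ → ℕ) → (∀ n → n ℕ.≤ φ n) → v ⟶ V → (λ n → v (φ n)) ⟶ V
  ⟶-reindex v V φ n≤φn v⟶V ε 0<ε = let N , h = v⟶V ε 0<ε in
    N , λ n N≤n → h (φ n) (ℕ.≤-trans N≤n (n≤φn n))

  ∣∣≼⇒eventually : ∀ z q → ∣ z ∣≼ fromℚ q → ∀ ε → 0ℚ < ε → Eventually λ i → ∣ seq z i ∣ ≤ q + ε
  ∣∣≼⇒eventually z q (h , k) ε 0<ε = eventually-zip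
    (≼⇒eventually {z} {fromℚ q} h ε 0<ε) (≼⇒eventually { -ᴿ z} {fromℚ q} k ε 0<ε)
    λ i → ∣∣-≤ {seq z i} {q + ε}

-- The Thue–Morse sequence

digitSum : Expansion 2 → ℕ
digitSum ds = sum (map toℕ ds)

private
  odd≢even : ∀ x y → suc (x ℕ.* 2) ≢ y ℕ.* 2
  odd≢even x y e = ℕ.even≢odd y x (trans (ℕ.*-comm 2 y) (trans (sym e) (cong suc (ℕ.*-comm x 2))))

digitSum-0 : ∀ ds → fromDigits ds ≡ 0 → digitSum ds ≡ 0
digitSum-0 []           e = refl
digitSum-0 (fzero ∷ ds) e = digitSum-0 ds (ℕ.*-cancelʳ-≡ (fromDigits ds) 0 2 e)

-- Two expansions of one number differ only by leading zeros, which add nothing. So `t` can be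
-- computed from any expansion, in particular from one with a new lowest digit in front.
digitSum-unique : ∀ ds es → fromDigits ds ≡ fromDigits es → digitSum ds ≡ digitSum es
digitSum-unique []       es e = sym (digitSum-0 es (sym e))
digitSum-unique (d ∷ ds) [] e = digitSum-0 (d ∷ ds) e
digitSum-unique (fzero      ∷ ds) (fzero      ∷ es) e =
  digitSum-unique ds es (ℕ.*-cancelʳ-≡ (fromDigits ds) (fromDigits es) 2 e)
digitSum-unique (fzero      ∷ ds) (fsuc fzero ∷ es) e = ⊥-elim (odd≢even (fromDigits es) (fromDigits ds) (sym e))
digitSum-unique (fsuc fzero ∷ ds) (fzero      ∷ es) e = ⊥-elim (odd≢even (fromDigits ds) (fromDigits es) e)
digitSum-unique (fsuc fzero ∷ ds) (fsuc fzero ∷ es) e =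
  cong suc (digitSum-unique ds es (ℕ.*-cancelʳ-≡ (fromDigits ds) (fromDigits es) 2 (ℕ.suc-injective e)))

abstract
  t-digits : ∀ n ds → fromDigits ds ≡ n → t n ≡ digitSum ds % 2
  t-digits n ds e = cong (_% 2)
    (digitSum-unique (proj₁ (toDigits 2 n)) ds (trans (proj₂ (toDigits 2 n)) (sym e)))

  t-double : ∀ n → t (double n) ≡ t n
  t-double n = t-digits (double n) (fzero ∷ proj₁ (toDigits 2 n))
    (trans (cong (ℕ._* 2) (proj₂ (toDigits 2 n))) (sym (double≡*2 n)))

  t-suc-double : ∀ n → t (suc (double n)) ≡ suc (t n) % 2
  t-suc-double n = trans
    (t-digits (suc (double n)) (fsuc fzero ∷ proj₁ (toDigits 2 n))
      (cong suc (trans (cong (ℕ._* 2) (proj₂ (toDigits 2 n))) (sym (double≡*2 n)))))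
    (%-distribˡ-+ 1 (digitSum (proj₁ (toDigits 2 n))) 2)

  <2⇒0∨1 : ∀ {k} → k ℕ.< 2 → k ≡ 0 ⊎ k ≡ 1
  <2⇒0∨1 {zero}     _ = inj₁ refl
  <2⇒0∨1 {suc zero} _ = inj₂ refl
  <2⇒0∨1 {suc (suc k)} (s≤s (s≤s ()))

  t≡0∨1 : ∀ n → t n ≡ 0 ⊎ t n ≡ 1
  t≡0∨1 n = <2⇒0∨1 (m%n<n (digitSum (proj₁ (toDigits 2 n))) 2)

τ : ℕ → ℚ
τ n = + t n / 1

abstract
  τ-double : ∀ n → τ (double n) ≡ τ n
  τ-double n = cong (λ k → + k / 1) (t-double n)

  τ-suc-double : ∀ n → τ (suc (double n)) ≡ 1ℚ - τ n
  τ-suc-double n = trans (cong (λ k → + k / 1) (t-suc-double n)) (flip-bit (t n) (t≡0∨1 n))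
    where
    flip-bit : ∀ k → k ≡ 0 ⊎ k ≡ 1 → + (suc k % 2) / 1 ≡ 1ℚ - + k / 1
    flip-bit _ (inj₁ refl) = refl
    flip-bit _ (inj₂ refl) = refl

-- Recursion for the partial sums and passage to the limit

-- One component (real or imaginary part) of the partial sums α, β and ζ of ∑ t (n - 1) a n,
-- ∑ t n a n and ∑ a n.
record PartialSums (a α β ζ : ℕ → ℝ) : Set where
  field
    α-0   : ∀ m → seq (α 0) m ≡ 0ℚ
    β-0   : ∀ m → seq (β 0) m ≡ 0ℚ
    ζ-0   : ∀ m → seq (ζ 0) m ≡ 0ℚ
    α-suc : ∀ n m → seq (α (suc n)) m ≡ seq (α n) m + τ n * seq (a (suc n)) m
    β-suc : ∀ n m → seq (β (suc n)) m ≡ seq (β n) m + τ (suc n) * seq (a (suc n)) m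
    ζ-suc : ∀ n m → seq (ζ (suc n)) m ≡ seq (ζ n) m + seq (a (suc n)) m

α+β-ζ : (α β ζ : ℕ → ℝ) → ℕ → ℝ
α+β-ζ α β ζ n = (α (double n) +ᴿ β (double n)) +ᴿ -ᴿ ζ (double n)

β-α : (α β : ℕ → ℝ) → ℕ → ℝ
β-α α β n = β n +ᴿ -ᴿ α n

module _ {a α β ζ : ℕ → ℝ} (S : PartialSums a α β ζ) where
  open PartialSums S

  abstract
    α+β-ζ-0 : ∀ m → seq (α+β-ζ α β ζ 0) m ≡ 0ℚ
    α+β-ζ-0 m = trans (cong₂ (λ x y → x + y + - seq (ζ 0) m) (α-0 m) (β-0 m)) (cong (λ x → 0ℚ + 0ℚ + - x) (ζ-0 m))

    β-α-0 : ∀ m → seq (β-α α β 0) m ≡ 0ℚ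
    β-α-0 m = cong₂ (λ x y → x + - y) (β-0 m) (α-0 m)

    β-α-suc : ∀ n m → seq (β-α α β (suc n)) m ≡ seq (β-α α β n) m + (τ (suc n) - τ n) * seq (a (suc n)) m
    β-α-suc n m = trans (cong₂ (λ x y → x + - y) (β-suc n m) (α-suc n m))
      (solve 5 (λ A B t t′ x → (B :+ t′ :* x) :+ :- (A :+ t :* x) := (B :+ :- A) :+ (t′ :- t) :* x) refl
        (seq (α n) m) (seq (β n) m) (τ n) (τ (suc n)) (seq (a (suc n)) m))

    -- At index 2 n + 1 the coefficient τ (2 n) + τ (2 n + 1) - 1 vanishes; at 2 n + 2 it is τ (2 n
    -- + 1) + τ (2 n + 2) - 1 = τ (n + 1) - τ n, the coefficient that occurs in `β-α-suc`.
    α+β-ζ-suc : ∀ n m → seq (α+β-ζ α β ζ (suc n)) m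
      ≡ seq (α+β-ζ α β ζ n) m + (τ (suc n) - τ n) * seq (a (suc (suc (double n)))) m
    α+β-ζ-suc n m = trans
      (cong₂ _+_
        (cong₂ _+_
          (trans (α-suc (suc k) m) (cong₂ (λ A s → A + s * y)
            (trans (α-suc k m) (cong (λ s → seq (α k) m + s * x) (τ-double n))) (τ-suc-double n)))
          (trans (β-suc (suc k) m) (cong₂ (λ B s → B + s * y)
            (trans (β-suc k m) (cong (λ s → seq (β k) m + s * x) (τ-suc-double n))) (τ-double (suc n)))))
        (cong -_ (trans (ζ-suc (suc k) m) (cong (_+ y) (ζ-suc k m)))))
      (solve 7 (λ A B Z x y t t′ →
          ((A :+ t :* x :+ (con 1ℚ :- t) :* y) :+ (B :+ (con 1ℚ :- t) :* x :+ t′ :* y)) :+ :- (Z :+ x :+ y)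
          := ((A :+ B) :+ :- Z) :+ (t′ :- t) :* y) refl
        (seq (α k) m) (seq (β k) m) (seq (ζ k) m) x y (τ n) (τ (suc n)))
      where
      k : ℕ
      k = double n
      x y : ℚ
      x = seq (a (suc k)) m
      y = seq (a (suc (suc k))) m

abstract
  ⟶α+β-ζ : ∀ α β ζ A B Z → α ⟶ A → β ⟶ B → ζ ⟶ Z → α+β-ζ α β ζ ⟶ (A +ᴿ B) +ᴿ -ᴿ Z
  ⟶α+β-ζ α β ζ A B Z α⟶A β⟶B ζ⟶Z =
    ⟶-reindex (λ n → (α n +ᴿ β n) +ᴿ -ᴿ ζ n) ((A +ᴿ B) +ᴿ -ᴿ Z) double n≤double
      (⟶-+ (λ n → α n +ᴿ β n) (λ n → -ᴿ ζ n) (A +ᴿ B) (-ᴿ Z) (⟶-+ α β A B α⟶A β⟶B) (⟶-neg ζ Z ζ⟶Z))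

  ⟶β-α : ∀ α β A B → α ⟶ A → β ⟶ B → β-α α β ⟶ B +ᴿ -ᴿ A
  ⟶β-α α β A B α⟶A β⟶B = ⟶-+ β (λ n → -ᴿ α n) B (-ᴿ A) β⟶B (⟶-neg α A α⟶A)

abstract
  linear-zero : ∀ p q v w u → (∀ m → seq v m ≡ 0ℚ) → (∀ m → seq w m ≡ 0ℚ) → (∀ m → seq u m ≡ 0ℚ) →
    p *ᴿ v +ᴿ q *ᴿ w ≃ u
  linear-zero p q v w u v≗0 w≗0 u≗0 = ≗⇒≃ λ m → trans
    (cong₂ (λ x y → seq p m * x + seq q m * y) {seq v m} {0ℚ} {seq w m} {0ℚ} (v≗0 m) (w≗0 m))
    (trans (solve 2 (λ p q → p :* con 0ℚ :+ q :* con 0ℚ := con 0ℚ) refl (seq p m) (seq q m)) (sym (u≗0 m)))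

  linear-step : ∀ p q v w u x y z v′ w′ u′ κ → p *ᴿ v +ᴿ q *ᴿ w ≃ u → p *ᴿ x +ᴿ q *ᴿ y ≃ z →
    (∀ m → seq v′ m ≡ seq v m + κ * seq x m) → (∀ m → seq w′ m ≡ seq w m + κ * seq y m) →
    (∀ m → seq u′ m ≡ seq u m + κ * seq z m) → p *ᴿ v′ +ᴿ q *ᴿ w′ ≃ u′
  linear-step p q v w u x y z v′ w′ u′ κ (≈⇒≃ h) (≈⇒≃ k) v≗ w≗ u≗ = ≈⇒≃ (null-≡
    {λ m → (seq p m * seq v m + seq q m * seq w m - seq u m)
         + κ * (seq p m * seq x m + seq q m * seq y m - seq z m)}
    {λ m → seq p m * seq v′ m + seq q m * seq w′ m - seq u′ m}
    (λ m → trans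
      (solve 9 (λ p q v w u x y z κ → (p :* v :+ q :* w :- u) :+ κ :* (p :* x :+ q :* y :- z)
          := p :* (v :+ κ :* x) :+ q :* (w :+ κ :* y) :- (u :+ κ :* z)) refl
        (seq p m) (seq q m) (seq v m) (seq w m) (seq u m) (seq x m) (seq y m) (seq z m) κ)
      (sym (trans (cong₂ (λ v w → seq p m * v + seq q m * w - seq u′ m) (v≗ m) (w≗ m))
        (cong (λ u → seq p m * (seq v m + κ * seq x m) + seq q m * (seq w m + κ * seq y m) - u) (u≗ m)))))
    (null-+ h (null-ℝ-* (fromℚ κ) k)))

  -- One component of a complex product is a real linear combination p Re + q Im. Since all three
  -- sequences grow with the same coefficients κ, the relation between the terms passes to the sums.
  linear-induction : ∀ p q (v w u x y z : ℕ → ℝ) (κ : ℕ → ℚ) →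
    (∀ m → seq (v 0) m ≡ 0ℚ) → (∀ m → seq (w 0) m ≡ 0ℚ) → (∀ m → seq (u 0) m ≡ 0ℚ) →
    (∀ n → p *ᴿ x n +ᴿ q *ᴿ y n ≃ z n) →
    (∀ n m → seq (v (suc n)) m ≡ seq (v n) m + κ n * seq (x n) m) →
    (∀ n m → seq (w (suc n)) m ≡ seq (w n) m + κ n * seq (y n) m) →
    (∀ n m → seq (u (suc n)) m ≡ seq (u n) m + κ n * seq (z n) m) →
    ∀ n → p *ᴿ v n +ᴿ q *ᴿ w n ≃ u n
  linear-induction p q v w u x y z κ v0 w0 u0 h v≗ w≗ u≗ zero =
    linear-zero p q (v zero) (w zero) (u zero) v0 w0 u0
  linear-induction p q v w u x y z κ v0 w0 u0 h v≗ w≗ u≗ (suc n) =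
    linear-step p q (v n) (w n) (u n) (x n) (y n) (z n) (v (suc n)) (w (suc n)) (u (suc n)) (κ n)
      (linear-induction p q v w u x y z κ v0 w0 u0 h v≗ w≗ u≗ n) (h n) (v≗ n) (w≗ n) (u≗ n)

  -- Unprimed data stand for real parts, primed data for imaginary parts, and `c`, `γ`, `δ` for the
  -- component being computed: (p, q) is (Re P, - Im P) for the real and (Im P, Re P) for the
  -- imaginary one.
  linear-limit : ∀ p q {a α β ζ a′ α′ β′ ζ′ c γ δ η} A B Z A′ B′ Z′ C D →
    PartialSums a α β ζ → PartialSums a′ α′ β′ ζ′ → PartialSums c γ δ η →
    (∀ n → p *ᴿ a (suc (suc (double n))) +ᴿ q *ᴿ a′ (suc (suc (double n))) ≃ c (suc n)) →
    α ⟶ A → β ⟶ B → ζ ⟶ Z → α′ ⟶ A′ → β′ ⟶ B′ → ζ′ ⟶ Z′ → γ ⟶ C → δ ⟶ D →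
    p *ᴿ ((A +ᴿ B) +ᴿ -ᴿ Z) +ᴿ q *ᴿ ((A′ +ᴿ B′) +ᴿ -ᴿ Z′) ≃ D +ᴿ -ᴿ C
  linear-limit p q {a} {α} {β} {ζ} {a′} {α′} {β′} {ζ′} {c} {γ} {δ} A B Z A′ B′ Z′ C D S S′ S″ h
      α⟶ β⟶ ζ⟶ α′⟶ β′⟶ ζ′⟶ γ⟶ δ⟶ =
    limit-of-linear-relation p q (α+β-ζ α β ζ) (α+β-ζ α′ β′ ζ′) (β-α γ δ)
      ((A +ᴿ B) +ᴿ -ᴿ Z) ((A′ +ᴿ B′) +ᴿ -ᴿ Z′) (D +ᴿ -ᴿ C)
      (⟶α+β-ζ α β ζ A B Z α⟶ β⟶ ζ⟶) (⟶α+β-ζ α′ β′ ζ′ A′ B′ Z′ α′⟶ β′⟶ ζ′⟶) (⟶β-α γ δ C D γ⟶ δ⟶) rel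
    where
    rel : ∀ n → p *ᴿ α+β-ζ α β ζ n +ᴿ q *ᴿ α+β-ζ α′ β′ ζ′ n ≃ β-α γ δ n
    rel = linear-induction p q (α+β-ζ α β ζ) (α+β-ζ α′ β′ ζ′) (β-α γ δ)
      (λ n → a (suc (suc (double n)))) (λ n → a′ (suc (suc (double n)))) (λ n → c (suc n))
      (λ n → τ (suc n) - τ n)
      (α+β-ζ-0 S) (α+β-ζ-0 S′) (β-α-0 S″) h (α+β-ζ-suc S) (α+β-ζ-suc S′) (β-α-suc S″)

  Re-*ᶜ : ∀ z w x → z *ᶜ w ≃ᶜ x → Re z *ᴿ Re w +ᴿ (-ᴿ Im z) *ᴿ Im w ≃ Re x
  Re-*ᶜ z w x (mk≃ᶜ (≈⇒≃ h) _) = ≈⇒≃ (null-≡ (λ n →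
    solve 5 (λ a b c d e → (a :* c :- b :* d) :- e := (a :* c :+ (:- b) :* d) :- e) refl
      (seq (Re z) n) (seq (Im z) n) (seq (Re w) n) (seq (Im w) n) (seq (Re x) n)) h)

  Im-*ᶜ : ∀ z w x → z *ᶜ w ≃ᶜ x → Im z *ᴿ Re w +ᴿ Re z *ᴿ Im w ≃ Im x
  Im-*ᶜ z w x (mk≃ᶜ _ (≈⇒≃ h)) = ≈⇒≃ (null-≡ (λ n →
    solve 5 (λ a b c d e → (a :* d :+ b :* c) :- e := (b :* c :+ a :* d) :- e) refl
      (seq (Re z) n) (seq (Im z) n) (seq (Re w) n) (seq (Im w) n) (seq (Im x) n)) h)

  -- P (A + B - Z) - (B - A) and (P + 1) A + (P - 1) B - P Z are the same polynomial, so the same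
  -- null sequence serves for both.
  rearrange : ∀ P A B Z →
    Re P *ᴿ (Re A +ᴿ Re B +ᴿ -ᴿ Re Z) +ᴿ (-ᴿ Im P) *ᴿ (Im A +ᴿ Im B +ᴿ -ᴿ Im Z) ≃ Re B +ᴿ -ᴿ Re A →
    Im P *ᴿ (Re A +ᴿ Re B +ᴿ -ᴿ Re Z) +ᴿ Re P *ᴿ (Im A +ᴿ Im B +ᴿ -ᴿ Im Z) ≃ Im B +ᴿ -ᴿ Im A →
    (P +ᶜ 1ᶜ) *ᶜ A +ᶜ (P -ᶜ 1ᶜ) *ᶜ B ≈ᶜ P *ᶜ Z
  rearrange P A B Z (≈⇒≃ h) (≈⇒≃ k) =
      null-≡ (λ n → solve 8 (λ p q a a′ b b′ z z′ →
          (p :* (a :+ b :+ :- z) :+ (:- q) :* (a′ :+ b′ :+ :- z′)) :- (b :+ :- a)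
          := (((p :+ con 1ℚ) :* a :- (q :+ con 0ℚ) :* a′) :+ ((p :- con 1ℚ) :* b :- (q :- con 0ℚ) :* b′))
             :- (p :* z :- q :* z′)) refl
        (seq (Re P) n) (seq (Im P) n) (seq (Re A) n) (seq (Im A) n)
        (seq (Re B) n) (seq (Im B) n) (seq (Re Z) n) (seq (Im Z) n)) h
    , null-≡ (λ n → solve 8 (λ p q a a′ b b′ z z′ →
          (q :* (a :+ b :+ :- z) :+ p :* (a′ :+ b′ :+ :- z′)) :- (b′ :+ :- a′)
          := (((p :+ con 1ℚ) :* a′ :+ (q :+ con 0ℚ) :* a) :+ ((p :- con 1ℚ) :* b′ :+ (q :- con 0ℚ) :* b))
             :- (p :* z′ :+ q :* z)) refl
        (seq (Re P) n) (seq (Im P) n) (seq (Re A) n) (seq (Im A) n)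
        (seq (Re B) n) (seq (Im B) n) (seq (Re Z) n) (seq (Im Z) n)) k

-- Comparison with n ^ (- σ) and convergence of the three series

infix 4 _BoundedBy_

-- Abstract, since otherwise Agda compares the bounded numbers by unfolding them.
abstract
  _BoundedBy_ : ℂ → ℝ → Set
  z BoundedBy y = (∣ Re z ∣≼ y) × (∣ Im z ∣≼ y)

  mkBounded : ∀ z y → ∣ Re z ∣≼ y → ∣ Im z ∣≼ y → z BoundedBy y
  mkBounded z y = _,_

  ∣Re∣≼ : ∀ z y → z BoundedBy y → ∣ Re z ∣≼ y
  ∣Re∣≼ z y = proj₁

  ∣Im∣≼ : ∀ z y → z BoundedBy y → ∣ Im z ∣≼ y
  ∣Im∣≼ z y = proj₂

Sum : (ℕ → ℂ) → ℂ → Set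
Sum f A = ((λ n → Re (Σ₁ f n)) ⟶ Re A) × ((λ n → Im (Σ₁ f n)) ⟶ Im A)

abstract
  Sum⇒HasSum : ∀ f A → Sum f A → HasSum f A
  Sum⇒HasSum f A (h , k) = ⟶⇒⟶ᴿ (λ n → Re (Σ₁ f n)) (Re A) h , ⟶⇒⟶ᴿ (λ n → Im (Σ₁ f n)) (Im A) k

module Convergence (s : ℂ) (δ : ℚ) (0<δ : 0ℚ < δ) (1+δ≤σ : Eventually λ n → 1ℚ + δ ≤ seq (Re s) n) where

  open Power (Re s) δ 0<δ 1+δ≤σ

  u : ℕ → ℝ
  u j = E (-ᴿ (Re s *ᴿ log (suc j)))

  Bounded : ℂ → ℕ → Set
  Bounded z j = z BoundedBy u j

  abstract
    ∣∣≼-resp-≃ : ∀ x y z → y ≃ z → ∣ x ∣≼ y → ∣ x ∣≼ z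
    ∣∣≼-resp-≃ x y z y≃z (h , k) = ≼-trans {x} {y} {z} h (≃⇒≼ y≃z) , ≼-trans { -ᴿ x} {y} {z} k (≃⇒≼ y≃z)

    exp-bound : ∀ w z y → w ≡ exp z → 0ᴿ ≼ E y → Re z ≃ y → (∣ Re w ∣≼ E y) × (∣ Im w ∣≼ E y)
    exp-bound _ z y refl 0≼E h =
      let p , q = ∣exp∣≼ z (≼-trans {0ᴿ} {E y} {E (Re z)} 0≼E (≃⇒≼ (E-cong {y} {Re z} (≃-sym h))))
      in ∣∣≼-resp-≃ (Re (exp z)) (E (Re z)) (E y) (E-cong {Re z} {y} h) p
       , ∣∣≼-resp-≃ (Im (exp z)) (E (Re z)) (E y) (E-cong {Re z} {y} h) q

    Re-exponent : ∀ s l → Re ((-ᶜ s) *ᶜ fromℝ l) ≃ -ᴿ (Re s *ᴿ l)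
    Re-exponent s l = ≗⇒≃ λ n → solve 3 (λ σ τ l → (:- σ) :* l :- (:- τ) :* con 0ℚ := :- (σ :* l)) refl
      (seq (Re s) n) (seq (Im s) n) (seq l n)

    n^-s-bounded : ∀ j → Bounded (suc j ^ᶜ (-ᶜ s)) j
    n^-s-bounded j = let p , q = exp-bound (suc j ^ᶜ (-ᶜ s)) ((-ᶜ s) *ᶜ fromℝ (log (suc j))) (-ᴿ (Re s *ᴿ log (suc j)))
                                   refl (0≼u j) (Re-exponent s (log (suc j)))
      in mkBounded (suc j ^ᶜ (-ᶜ s)) (u j) p q

    ∣∣≼-by-≗ : ∀ x y z → (∀ n → seq x n ≡ seq y n) → ∣ x ∣≼ z → ∣ y ∣≼ z
    ∣∣≼-by-≗ x y z x≗y (h , k) =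
      ≼-resp-≗ {x} {z} x≗y (λ _ → refl) h , ≼-resp-≗ { -ᴿ x} {z} (λ n → cong -_ (x≗y n)) (λ _ → refl) k

    ∣0∣≼ : ∀ z → 0ᴿ ≼ z → ∣ 0ᴿ ∣≼ z
    ∣0∣≼ z 0≼z = 0≼z , ≼-resp-≗ {0ᴿ} {z} (λ _ → refl) (λ _ → refl) 0≼z

    -- The term is either 0 or `z`; in the first case the bound needs `u j` to be nonnegative.
    bit-bounded : ∀ k z j → k ≡ 0 ⊎ k ≡ 1 → Bounded z j → Bounded (fromℕ k *ᶜ z) j
    bit-bounded _ z j (inj₁ refl) _ = mkBounded (fromℕ 0 *ᶜ z) (u j)
      (∣∣≼-by-≗ 0ᴿ (Re (fromℕ 0 *ᶜ z)) (u j)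
        (λ n → solve 2 (λ x y → con 0ℚ := con 0ℚ :* x :- con 0ℚ :* y) refl (seq (Re z) n) (seq (Im z) n))
        (∣0∣≼ (u j) (0≼u j)))
      (∣∣≼-by-≗ 0ᴿ (Im (fromℕ 0 *ᶜ z)) (u j)
        (λ n → solve 2 (λ x y → con 0ℚ := con 0ℚ :* y :+ con 0ℚ :* x) refl (seq (Re z) n) (seq (Im z) n))
        (∣0∣≼ (u j) (0≼u j)))
    bit-bounded _ z j (inj₂ refl) h = mkBounded (fromℕ 1 *ᶜ z) (u j)
      (∣∣≼-by-≗ (Re z) (Re (fromℕ 1 *ᶜ z)) (u j)
        (λ n → solve 2 (λ x y → x := con 1ℚ :* x :- con 0ℚ :* y) refl (seq (Re z) n) (seq (Im z) n)) (∣Re∣≼ z (u j) h))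
      (∣∣≼-by-≗ (Im z) (Im (fromℕ 1 *ᶜ z)) (u j)
        (λ n → solve 2 (λ x y → y := con 1ℚ :* y :+ con 0ℚ :* x) refl (seq (Re z) n) (seq (Im z) n)) (∣Im∣≼ z (u j) h))

    partial-sums-cauchy : ∀ (g x : ℕ → ℝ) → (∀ n m → seq (g (suc n)) m ≡ seq (g n) m + seq (x (suc n)) m) →
      (∀ j → ∣ x (suc j) ∣≼ u j) → IsCauchyᴿ g
    partial-sums-cauchy g x g-suc x≼u ε 0<ε =
      let δ′ , 0<δ′ , eq = halve 0<ε
          n , big = c-large {δ′} 0<δ′
      -- The shift by one arises because `u n` bounds the term with index n + 1, so `c n` controls
      -- what follows `g (suc n)`.
      in suc n , λ { (suc i) (s≤s n≤i) → eventually-map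
        (∣∣≼⇒eventually (g (suc i) -ᴿ g (suc n)) δ′
          ( partial-sum-small g x g-suc (λ j → proj₁ (x≼u j)) n {δ′} big i n≤i
          , ≼-resp-≗ {(-ᴿ g (suc i)) -ᴿ (-ᴿ g (suc n))} {fromℚ δ′}
              (λ m → solve 2 (λ a b → (:- a) :- (:- b) := :- (a :- b)) refl (seq (g (suc i)) m) (seq (g (suc n)) m))
              (λ _ → refl)
              -- The estimate is one-sided; the lower bound is the same estimate for the negated
              -- terms.
              (partial-sum-small (λ k → -ᴿ g k) (λ k → -ᴿ x k)
                (λ k m → trans (cong -_ (g-suc k m)) (neg-distrib-+ (seq (g k) m) (seq (x (suc k)) m)))
                (λ j → proj₂ (x≼u j)) n {δ′} big i n≤i))
          δ′ 0<δ′)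
        λ m p → ≤-trans p (≤-reflexive eq) }

  abstract
    summable : ∀ f → (∀ j → Bounded (f (suc j)) j) → ∃ λ A → Sum f A
    summable f bnd = Completion.limit r rc +i Completion.limit i ic , Completion.⟶limit r rc , Completion.⟶limit i ic
      where
      r i : ℕ → ℝ
      r n = Re (Σ₁ f n)
      i n = Im (Σ₁ f n)
      rc : IsCauchyᴿ r
      rc = partial-sums-cauchy r (λ n → Re (f n)) (λ _ _ → refl) (λ j → ∣Re∣≼ (f (suc j)) (u j) (bnd j))
      ic : IsCauchyᴿ i
      ic = partial-sums-cauchy i (λ n → Im (f n)) (λ _ _ → refl) (λ j → ∣Im∣≼ (f (suc j)) (u j) (bnd j))

-- The identity between the sums

abstract
  Re-Σ₁-suc : ∀ (f : ℕ → ℂ) n m κ z → f (suc n) ≡ fromℝ (fromℚ κ) *ᶜ z →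
    seq (Re (Σ₁ f (suc n))) m ≡ seq (Re (Σ₁ f n)) m + κ * seq (Re z) m
  Re-Σ₁-suc f n m κ z e = cong (λ x → seq (Re (Σ₁ f n)) m + x)
    {seq (Re (f (suc n))) m} {κ * seq (Re z) m}
    (trans (cong (λ w → seq (Re w) m) {f (suc n)} {fromℝ (fromℚ κ) *ᶜ z} e)
      (solve 3 (λ κ x y → κ :* x :- con 0ℚ :* y := κ :* x) refl κ (seq (Re z) m) (seq (Im z) m)))

  Im-Σ₁-suc : ∀ (f : ℕ → ℂ) n m κ z → f (suc n) ≡ fromℝ (fromℚ κ) *ᶜ z →
    seq (Im (Σ₁ f (suc n))) m ≡ seq (Im (Σ₁ f n)) m + κ * seq (Im z) m
  Im-Σ₁-suc f n m κ z e = cong (λ x → seq (Im (Σ₁ f n)) m + x)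
    {seq (Im (f (suc n))) m} {κ * seq (Im z) m}
    (trans (cong (λ w → seq (Im w) m) {f (suc n)} {fromℝ (fromℚ κ) *ᶜ z} e)
      (solve 3 (λ κ x y → κ :* y :+ con 0ℚ :* x := κ :* y) refl κ (seq (Re z) m) (seq (Im z) m)))

abstract
  fromℕ-t : ∀ n → fromℕ (t n) ≡ fromℝ (fromℚ (τ n))
  fromℕ-t n = cong (λ κ → fromℝ (fromℚ κ)) {+ t n / 1} {τ n} refl

module Identity (P : ℂ) (a f g : ℕ → ℂ)
  (P*a   : ∀ j → P *ᶜ a (suc (suc (double j))) ≃ᶜ a (suc j))
  (f-suc : ∀ n → f (suc n) ≡ fromℝ (fromℚ (τ n)) *ᶜ a (suc n))
  (g-suc : ∀ n → g (suc n) ≡ fromℝ (fromℚ (τ (suc n))) *ᶜ a (suc n))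
  where

  r : PartialSums (λ n → Re (a n)) (λ n → Re (Σ₁ f n)) (λ n → Re (Σ₁ g n)) (λ n → Re (Σ₁ a n))
  r = record
    { α-0   = λ _ → refl
    ; β-0   = λ _ → refl
    ; ζ-0   = λ _ → refl
    ; α-suc = λ n m → Re-Σ₁-suc f n m (τ n) (a (suc n)) (f-suc n)
    ; β-suc = λ n m → Re-Σ₁-suc g n m (τ (suc n)) (a (suc n)) (g-suc n)
    ; ζ-suc = λ _ _ → refl
    }

  i : PartialSums (λ n → Im (a n)) (λ n → Im (Σ₁ f n)) (λ n → Im (Σ₁ g n)) (λ n → Im (Σ₁ a n))
  i = record
    { α-0   = λ _ → refl
    ; β-0   = λ _ → refl
    ; ζ-0   = λ _ → refl
    ; α-suc = λ n m → Im-Σ₁-suc f n m (τ n) (a (suc n)) (f-suc n)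
    ; β-suc = λ n m → Im-Σ₁-suc g n m (τ (suc n)) (a (suc n)) (g-suc n)
    ; ζ-suc = λ _ _ → refl
    }

  abstract
    identity : ∀ A B Z →
      (λ n → Re (Σ₁ f n)) ⟶ Re A → (λ n → Im (Σ₁ f n)) ⟶ Im A →
      (λ n → Re (Σ₁ g n)) ⟶ Re B → (λ n → Im (Σ₁ g n)) ⟶ Im B →
      (λ n → Re (Σ₁ a n)) ⟶ Re Z → (λ n → Im (Σ₁ a n)) ⟶ Im Z →
      (P +ᶜ 1ᶜ) *ᶜ A +ᶜ (P -ᶜ 1ᶜ) *ᶜ B ≈ᶜ P *ᶜ Z
    identity A B Z fr fi gr gi ar ai = rearrange P A B Z
      (linear-limit (Re P) (-ᴿ Im P) (Re A) (Re B) (Re Z) (Im A) (Im B) (Im Z) (Re A) (Re B) r i r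
        (λ n → Re-*ᶜ P (a (suc (suc (double n)))) (a (suc n)) (P*a n))
        fr gr ar fi gi ai fr gr)
      (linear-limit (Im P) (Re P) (Re A) (Re B) (Re Z) (Im A) (Im B) (Im Z) (Im A) (Im B) r i i
        (λ n → Im-*ᶜ P (a (suc (suc (double n)))) (a (suc n)) (P*a n))
        fr gr ar fi gi ai fi gi)

  sums-identity : ∃ (Sum f) → ∃ (Sum g) → ∃ (Sum a) → ∃ λ A → ∃ λ B → ∃ λ Z →
    HasSum f A × HasSum g B × HasSum a Z × (P +ᶜ 1ᶜ) *ᶜ A +ᶜ (P -ᶜ 1ᶜ) *ᶜ B ≈ᶜ P *ᶜ Z
  sums-identity (A , A-sum) (B , B-sum) (Z , Z-sum) =
    A , B , Z , Sum⇒HasSum f A A-sum , Sum⇒HasSum g B B-sum , Sum⇒HasSum a Z Z-sum ,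
    identity A B Z
      (proj₁ A-sum) (proj₂ A-sum) (proj₁ B-sum) (proj₂ B-sum) (proj₁ Z-sum) (proj₂ Z-sum)

abstract
  t*-≡ : ∀ k n z → k ≡ n → fromℕ (t k) *ᶜ z ≡ fromℝ (fromℚ (τ n)) *ᶜ z
  t*-≡ k _ z refl = cong (_*ᶜ z) {fromℕ (t k)} {fromℝ (fromℚ (τ k))} (fromℕ-t k)

theorem3 : (s : ℂ) → 1ᴿ <ᴿ Re s → ∃ λ A → ∃ λ B → ∃ λ ζₛ →
    HasSum (λ n → fromℕ (t (n ∸ 1)) *ᶜ n ^ᶜ (-ᶜ s)) A ×
    HasSum (λ n → fromℕ (t n) *ᶜ n ^ᶜ (-ᶜ s)) B ×
    HasSum (λ n → n ^ᶜ (-ᶜ s)) ζₛ ×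
    (2 ^ᶜ s +ᶜ 1ᶜ) *ᶜ A +ᶜ (2 ^ᶜ s -ᶜ 1ᶜ) *ᶜ B ≈ᶜ 2 ^ᶜ s *ᶜ ζₛ
theorem3 s (δ , 0<δ , 1+δ≤σ) = Identity.sums-identity
  (2 ^ᶜ s)
  (λ n → n ^ᶜ (-ᶜ s))
  (λ n → fromℕ (t (n ∸ 1)) *ᶜ n ^ᶜ (-ᶜ s))
  (λ n → fromℕ (t n) *ᶜ n ^ᶜ (-ᶜ s))
  (2^s*[2n]^-s s)
  (λ n → t*-≡ (suc n ∸ 1) n (suc n ^ᶜ (-ᶜ s)) refl)
  (λ n → t*-≡ (suc n) (suc n) (suc n ^ᶜ (-ᶜ s)) refl)
  (summable (λ n → fromℕ (t (n ∸ 1)) *ᶜ n ^ᶜ (-ᶜ s))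
    λ j → bit-bounded (t (suc j ∸ 1)) (suc j ^ᶜ (-ᶜ s)) j (t≡0∨1 (suc j ∸ 1)) (n^-s-bounded j))
  (summable (λ n → fromℕ (t n) *ᶜ n ^ᶜ (-ᶜ s))
    λ j → bit-bounded (t (suc j)) (suc j ^ᶜ (-ᶜ s)) j (t≡0∨1 (suc j)) (n^-s-bounded j))
  (summable (λ n → n ^ᶜ (-ᶜ s)) n^-s-bounded)
  where open Convergence s δ 0<δ 1+δ≤σ
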